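{- For every integer $t\ge 5$, the graph $Q_t$ is connected and claw-free, but is not a line graph, and $$[s_{(4,4,4,4,2,1^{t-5})}]\,X_{Q_t}=-144\,(t-1)\,(t-1)!<0.$$ Consequently, the graphs $Q_t$, for $t\ge5$, form an infinite family of claw-free non-line-graph counterexamples to the conjecture that every claw-free graph is Schur-positive.
   Context: All graphs are finite and simple. The chromatic symmetric function of a graph $G$ is $X_G=\sum_{\kappa}\prod_{u\in V(G)}x_{\kappa(u)}$, where the sum is over all proper colorings $\kappa\colon V(G)\to\mathbb Z_{>0}$. For a partition $\lambda$, $[s_\lambda]X_G$ denotes the coefficient of the Schur function $s_\lambda$ in the Schur expansion of $X_G$; $1^{k}$ denotes $k$ parts equal to $1$. A graph is Schur-positive if all these coefficients are nonnegative. A graph is claw-free if it has no induced subgraph isomorphic to $K_{1,3}$. The line graph $L(H)$ of a (finite simple) graph $H$ has vertex set $E(H)$, two distinct edges being adjacent when they share an endpoint; a graph is a line graph if it is isomorphic to $L(H)$ for some finite simple graph $H$. The graph $H_1$ has vertex set $\{1,\dots,10\}$ and edge set $\{u_1,\dots,u_{12}\}$ with $u_1=\{1,8\}$, $u_2=\{7,10\}$, $u_3=\{2,7\}$, $u_4=\{4,5\}$, $u_5=\{4,9\}$, $u_6=\{3,6\}$, $u_7=\{6,10\}$, $u_8=\{3,10\}$, $u_9=\{5,9\}$, $u_{10}=\{8,10\}$, $u_{11}=\{8,9\}$, $u_{12}=\{7,9\}$. Set $G_1=L(H_1)$, with vertices $u_1,\dots,u_{12}$. The graph $Q$ is obtained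 from $G_1$ by adding a new vertex $u_{13}$ and the five edges $u_{13}u_4,\ u_{13}u_5,\ u_{13}u_9,\ u_{13}u_{11},\ u_{13}u_{12}$. For $t\ge5$, $Q_t$ is obtained from the disjoint union of $Q$ and a complete graph $K_t$ with a distinguished vertex $w\in V(K_t)$ by adding the single edge $u_1w$. -}

module Defs where

open import Data.Empty using (⊥)
open import Data.Fin using (Fin; zero; suc; _↑ˡ_; _↑ʳ_; splitAt; #_)
  renaming (_<_ to _<ᶠ_; _≤_ to _≤ᶠ_)
open import Data.Fin.Properties using (all?; any?)
  renaming (_≟_ to _≟ᶠ_; _<?_ to _<ᶠ?_; _≤?_ to _≤ᶠ?_)
open import Data.Integer using (ℤ; +_; 0ℤ)
  renaming (_+_ to _+ᶻ_; _*_ to _*ᶻ_; _≤_ to _≤ᶻ_)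
open import Data.List using (List; []; _∷_; map; length; filter; foldr; zip;
  concat; concatMap; upTo; allFin; cartesianProductWith)
open import Data.List.Membership.Propositional using (_∈_)
open import Data.List.Relation.Unary.All using (All) renaming (all? to allᴸ?)
open import Data.List.Relation.Unary.Linked using (Linked; linked?)
open import Data.Nat using (ℕ; zero; suc; _+_; _≥_; _<_; _≥?_; _<?_; _≟_)
open import Data.Nat.ListAction using (sum)
open import Data.Product using (Σ; ∃; _×_; _,_; proj₁; proj₂; uncurry)
open import Data.Sum using (_⊎_; inj₁; inj₂)
open import Data.Unit using (⊤; tt)
open import Data.Vec using (Vec; []; _∷_; lookup; tabulate; toList; fromList; count)
  renaming (sum to sumᵛ)
open import Data.Vec.Properties using () renaming (≡-dec to ≡-decᵛ)
open import Function using (_∘_; _↔_; _⇔_; Inverse)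
open import Function.Definitions using (Injective)
open import Relation.Binary using (DecidableEquality) renaming (Decidable to Decidable₂)
open import Relation.Binary.Construct.Closure.ReflexiveTransitive using (Star)
open import Relation.Binary.PropositionalEquality using (_≡_; _≢_; refl; sym)
open import Relation.Nullary using (¬_; yes; no)
open import Relation.Nullary.Decidable using (¬?; _×-dec_; _⊎-dec_; _→-dec_; map′; toWitness)
open import Relation.Unary using (Decidable)

------------------------------------------------------------------------
-- Simple graphs.  A finite simple graph is a Graph (Fin n).

record Graph (V : Set) : Set₁ where
  infix 4 _~_ _~?_
  field
    _~_     : V → V → Set
    _~?_    : Decidable₂ _~_
    ~-sym   : ∀ {u v} → u ~ v → v ~ u
    ~-irrefl : ∀ {u} → ¬ (u ~ u)

open Graph using (~-sym; ~-irrefl)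

module _ {V : Set} (G : Graph V) where
  open Graph G using (_~_)

  Connected : Set
  Connected = ∀ u v → Star _~_ u v

module _ {V W : Set} (G : Graph V) (H : Graph W) where
  private
    module G = Graph G
    module H = Graph H

  infix 4 _≅_ _IsInducedIn_

  _≅_ : Set
  _≅_ = Σ (V ↔ W) λ f → ∀ u v → (u G.~ v) ⇔ (Inverse.to f u H.~ Inverse.to f v)

  _IsInducedIn_ : Set
  _IsInducedIn_ = Σ (V → W) λ f →
    Injective _≡_ _≡_ f × (∀ u v → (u G.~ v) ⇔ (f u H.~ f v))

completeGraph : ∀ n → Graph (Fin n)
completeGraph n = record
  { _~_ = _≢_
  ; _~?_ = λ u v → ¬? (u ≟ᶠ v)
  ; ~-sym = λ u≢v v≡u → u≢v (sym v≡u)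
  ; ~-irrefl = λ u≢u → u≢u refl
  }

completeBipartite : ∀ m n → Graph (Fin m ⊎ Fin n)
completeBipartite m n = record
  { _~_ = _~_ ; _~?_ = _~?_
  ; ~-sym = λ {u} {v} → ~sym u v
  ; ~-irrefl = λ {u} → irr u
  }
  where
  _~_ : Fin m ⊎ Fin n → Fin m ⊎ Fin n → Set
  inj₁ _ ~ inj₂ _ = ⊤
  inj₂ _ ~ inj₁ _ = ⊤
  _      ~ _      = ⊥

  _~?_ : Decidable₂ _~_
  inj₁ _ ~? inj₂ _ = yes tt
  inj₂ _ ~? inj₁ _ = yes tt
  inj₁ _ ~? inj₁ _ = no λ ()
  inj₂ _ ~? inj₂ _ = no λ ()

  ~sym : ∀ u v → u ~ v → v ~ u
  ~sym (inj₁ _) (inj₂ _) _ = tt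
  ~sym (inj₂ _) (inj₁ _) _ = tt

  irr : ∀ u → ¬ (u ~ u)
  irr (inj₁ _) ()
  irr (inj₂ _) ()

ClawFree : {V : Set} → Graph V → Set
ClawFree G = ¬ (completeBipartite 1 3 IsInducedIn G)

------------------------------------------------------------------------
-- Line graphs

-- The endpoints are stored in increasing order and the proofs are
-- irrelevant, so each unordered edge of H is a single element.
record Edge {n} (H : Graph (Fin n)) : Set where
  constructor mkEdge
  field
    src tgt  : Fin n
    .src<tgt : src <ᶠ tgt
    .src~tgt : Graph._~_ H src tgt

open Edge using (src; tgt)

module _ {n} {H : Graph (Fin n)} where

  infix 4 _IsEndOf_ _≟ᵉ_

  _IsEndOf_ : Fin n → Edge H → Set
  v IsEndOf e = v ≡ src e ⊎ v ≡ tgt e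

  _≟ᵉ_ : DecidableEquality (Edge H)
  mkEdge a b _ _ ≟ᵉ mkEdge c d _ _ =
    map′ (λ { (refl , refl) → refl }) (λ { refl → refl , refl })
         ((a ≟ᶠ c) ×-dec (b ≟ᶠ d))

lineGraph : ∀ {n} (H : Graph (Fin n)) → Graph (Edge H)
lineGraph H = record
  { _~_ = λ e f → e ≢ f × ∃ λ v → v IsEndOf e × v IsEndOf f
  ; _~?_ = λ e f → ¬? (e ≟ᵉ f) ×-dec any? λ v →
      ((v ≟ᶠ src e) ⊎-dec (v ≟ᶠ tgt e)) ×-dec ((v ≟ᶠ src f) ⊎-dec (v ≟ᶠ tgt f))
  ; ~-sym = λ { (e≢f , v , v∈e , v∈f) → (e≢f ∘ sym) , v , v∈f , v∈e }
  ; ~-irrefl = λ { (e≢e , _) → e≢e refl }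
  }

IsLineGraph : {V : Set} → Graph V → Set₁
IsLineGraph G = ∃ λ n → Σ (Graph (Fin n)) λ H → G ≅ lineGraph H

------------------------------------------------------------------------
-- Constructions on graphs

-- Used below only for bijections f, where it relabels the vertices.
pullback : {V W : Set} → (V → W) → Graph W → Graph V
pullback f G = record
  { _~_ = λ u v → f u ~ f v
  ; _~?_ = λ u v → f u ~? f v
  ; ~-sym = ~-sym G
  ; ~-irrefl = ~-irrefl G
  }
  where open Graph G using (_~_; _~?_)

fromEdges : ∀ {n m} → Vec (Fin n × Fin n) m → Graph (Fin n)
fromEdges es = record
  { _~_ = λ u v → u ≢ v × ∃ λ i → lookup es i ≡ (u , v) ⊎ lookup es i ≡ (v , u)
  ; _~?_ = λ u v → ¬? (u ≟ᶠ v) ×-dec any? λ i →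
      (lookup es i ≟ᵖ (u , v)) ⊎-dec (lookup es i ≟ᵖ (v , u))
  ; ~-sym = λ { (u≢v , i , inj₁ p) → (u≢v ∘ sym) , i , inj₂ p
              ; (u≢v , i , inj₂ p) → (u≢v ∘ sym) , i , inj₁ p }
  ; ~-irrefl = λ { (u≢u , _) → u≢u refl }
  }
  where
  open import Data.Product.Properties using (≡-dec)
  _≟ᵖ_ = ≡-dec _≟ᶠ_ _≟ᶠ_

-- The new vertex is zero; the old vertex i becomes suc i.
addVertex : ∀ {n} → Graph (Fin n) → List (Fin n) → Graph (Fin (suc n))
addVertex {n} G S = record
  { _~_ = _~_ ; _~?_ = _~?_
  ; ~-sym = λ {u} {v} → ~sym u v
  ; ~-irrefl = λ {u} → irr u
  }
  where
  module G = Graph G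
  open import Data.List.Membership.DecPropositional (_≟ᶠ_ {n}) using (_∈?_)

  _~_ : Fin (suc n) → Fin (suc n) → Set
  zero  ~ zero  = ⊥
  zero  ~ suc v = v ∈ S
  suc u ~ zero  = u ∈ S
  suc u ~ suc v = u G.~ v

  _~?_ : Decidable₂ _~_
  zero  ~? zero  = no λ ()
  zero  ~? suc v = v ∈? S
  suc u ~? zero  = u ∈? S
  suc u ~? suc v = u G.~? v

  ~sym : ∀ u v → u ~ v → v ~ u
  ~sym zero    (suc _) p = p
  ~sym (suc _) zero    p = p
  ~sym (suc _) (suc _) p = G.~-sym p

  irr : ∀ u → ¬ (u ~ u)
  irr (suc _) p = G.~-irrefl p

infixr 5 _⊕_

_⊕_ : {V W : Set} → Graph V → Graph W → Graph (V ⊎ W)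
_⊕_ {V} {W} G H = record
  { _~_ = _~_ ; _~?_ = _~?_
  ; ~-sym = λ {u} {v} → ~sym u v
  ; ~-irrefl = λ {u} → irr u
  }
  where
  module G = Graph G
  module H = Graph H

  _~_ : V ⊎ W → V ⊎ W → Set
  inj₁ u ~ inj₁ v = u G.~ v
  inj₂ u ~ inj₂ v = u H.~ v
  _      ~ _      = ⊥

  _~?_ : Decidable₂ _~_
  inj₁ u ~? inj₁ v = u G.~? v
  inj₂ u ~? inj₂ v = u H.~? v
  inj₁ _ ~? inj₂ _ = no λ ()
  inj₂ _ ~? inj₁ _ = no λ ()

  ~sym : ∀ u v → u ~ v → v ~ u
  ~sym (inj₁ _) (inj₁ _) p = G.~-sym p
  ~sym (inj₂ _) (inj₂ _) p = H.~-sym p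

  irr : ∀ u → ¬ (u ~ u)
  irr (inj₁ _) p = G.~-irrefl p
  irr (inj₂ _) p = H.~-irrefl p

addEdge : ∀ {n} → Graph (Fin n) → Fin n → Fin n → Graph (Fin n)
addEdge G a b = record
  { _~_ = λ u v → u ≢ v × (u ~ v ⊎ (u ≡ a × v ≡ b) ⊎ (u ≡ b × v ≡ a))
  ; _~?_ = λ u v → ¬? (u ≟ᶠ v) ×-dec ((u ~? v) ⊎-dec
      ((u ≟ᶠ a) ×-dec (v ≟ᶠ b)) ⊎-dec ((u ≟ᶠ b) ×-dec (v ≟ᶠ a)))
  ; ~-sym = λ { (u≢v , inj₁ p)              → (u≢v ∘ sym) , inj₁ (~-sym G p)
              ; (u≢v , inj₂ (inj₁ (p , q))) → (u≢v ∘ sym) , inj₂ (inj₂ (q , p))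
              ; (u≢v , inj₂ (inj₂ (p , q))) → (u≢v ∘ sym) , inj₂ (inj₁ (q , p)) }
  ; ~-irrefl = λ { (u≢u , _) → u≢u refl }
  }
  where open Graph G using (_~_; _~?_)

------------------------------------------------------------------------
-- The graphs H₁, G₁, Q and Q_t

-- The vertex i ∈ {1,…,10} of H₁ is # (i - 1), and the edge u_a is entry
-- # (a - 1) of the vector.
edges₁ : Vec (Fin 10 × Fin 10) 12
edges₁ =
    (# 0 , # 7)   -- u₁  = {1,8}
  ∷ (# 6 , # 9)   -- u₂  = {7,10}
  ∷ (# 1 , # 6)   -- u₃  = {2,7}
  ∷ (# 3 , # 4)   -- u₄  = {4,5}
  ∷ (# 3 , # 8)   -- u₅  = {4,9}
  ∷ (# 2 , # 5)   -- u₆  = {3,6}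
  ∷ (# 5 , # 9)   -- u₇  = {6,10}
  ∷ (# 2 , # 9)   -- u₈  = {3,10}
  ∷ (# 4 , # 8)   -- u₉  = {5,9}
  ∷ (# 7 , # 9)   -- u₁₀ = {8,10}
  ∷ (# 7 , # 8)   -- u₁₁ = {8,9}
  ∷ (# 6 , # 8)   -- u₁₂ = {7,9}
  ∷ []

H₁ : Graph (Fin 10)
H₁ = fromEdges edges₁

edge₁ : Fin 12 → Edge H₁
edge₁ i = mkEdge (proj₁ (lookup edges₁ i)) (proj₂ (lookup edges₁ i))
  (toWitness {a? = all? λ j → proj₁ (lookup edges₁ j) <ᶠ? proj₂ (lookup edges₁ j)} tt i)
  (toWitness {a? = all? λ j →
     Graph._~?_ H₁ (proj₁ (lookup edges₁ j)) (proj₂ (lookup edges₁ j))} tt i)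

G₁ : Graph (Fin 12)
G₁ = pullback edge₁ (lineGraph H₁)

-- In Q, u₁₃ is # 0 and u_a is # a for 1 ≤ a ≤ 12.
Q : Graph (Fin 13)
Q = addVertex G₁ (# 3 ∷ # 4 ∷ # 8 ∷ # 10 ∷ # 11 ∷ [])

-- Q_t, for an arbitrary choice of the distinguished vertex w of K_t.
Qₜ : ∀ t → Fin t → Graph (Fin (13 + t))
Qₜ t w = addEdge (pullback (splitAt 13) (Q ⊕ completeGraph t)) (# 1 ↑ˡ t) (13 ↑ʳ w)

------------------------------------------------------------------------
-- Chromatic symmetric functions and Schur functions

-- A formal power series in x₁, x₂, … given by its coefficients: F k α is
-- the coefficient of x₁^α₁ ⋯ x_k^α_k.
Series : Set
Series = ∀ k → Vec ℕ k → ℤ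

words : {A : Set} → List A → ∀ n → List (Vec A n)
words xs zero    = [] ∷ []
words xs (suc n) = cartesianProductWith _∷_ xs (words xs n)

content : ∀ {k n} → Vec (Fin k) n → Vec ℕ k
content w = tabulate λ i → count (_≟ᶠ i) w

Proper : ∀ {n k} → Graph (Fin n) → Vec (Fin k) n → Set
Proper G κ = ∀ u v → Graph._~_ G u v → lookup κ u ≢ lookup κ v

proper? : ∀ {n k} (G : Graph (Fin n)) → Decidable (Proper {n} {k} G)
proper? G κ = all? λ u → all? λ v →
  Graph._~?_ G u v →-dec ¬? (lookup κ u ≟ᶠ lookup κ v)

-- Colourings contributing to x₁^α₁ ⋯ x_k^α_k only use the colours 1,…,k.
X : ∀ {n} → Graph (Fin n) → Series
X {n} G k α = + length
  (filter (λ κ → proper? G κ ×-dec ≡-decᵛ _≟_ (content κ) α) (words (allFin k) n))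

IsPartitionOf : ℕ → List ℕ → Set
IsPartitionOf n μ = sum μ ≡ n × Linked _≥_ μ × All (0 <_) μ

isPartitionOf? : ∀ n → Decidable (IsPartitionOf n)
isPartitionOf? n μ = (sum μ ≟ n) ×-dec linked? _≥?_ μ ×-dec allᴸ? (0 <?_) μ

-- All partitions of n, found among the lists of at most n numbers from 1 to n.
partitions : ℕ → List (List ℕ)
partitions n = filter (isPartitionOf? n)
  (concatMap (λ ℓ → map toList (words (map suc (upTo n)) ℓ)) (upTo (suc n)))

-- Tableaux are given by their rows, top row first (English notation).
Tableau : ℕ → Set
Tableau k = List (List (Fin k))

fillings : ∀ k → List ℕ → List (Tableau k)
fillings k []      = [] ∷ []
fillings k (r ∷ μ) =
  cartesianProductWith (λ w T → toList w ∷ T) (words (allFin k) r) (fillings k μ)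

-- As the row lengths decrease, zip pairs each entry of the lower row with
-- the entry just above it.
Semistandard : ∀ {k} → Tableau k → Set
Semistandard T =
  All (Linked _≤ᶠ_) T × Linked (λ r s → All (uncurry _<ᶠ_) (zip r s)) T

semistandard? : ∀ {k} → Decidable (Semistandard {k})
semistandard? T =
  allᴸ? (linked? _≤ᶠ?_) T ×-dec
  linked? (λ r s → allᴸ? (λ (a , b) → a <ᶠ? b) (zip r s)) T

schur : List ℕ → Series
schur μ k α = + length
  (filter (λ T → semistandard? T ×-dec ≡-decᵛ _≟_ (content (fromList (concat T))) α)
          (fillings k μ))

∑ : {A : Set} → List A → (A → ℤ) → ℤ
∑ xs f = foldr (λ x acc → f x +ᶻ acc) 0ℤ xs

-- F = Σ_μ c_μ s_μ over all partitions μ.  Since s_μ is homogeneous of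
-- degree |μ|, only the partitions of |α| contribute to the coefficient at α.
-- The values of c at lists that are not partitions are irrelevant.
IsSchurExpansion : Series → (List ℕ → ℤ) → Set
IsSchurExpansion F c = ∀ k (α : Vec ℕ k) →
  F k α ≡ ∑ (partitions (sumᵛ α)) λ μ → c μ *ᶻ schur μ k α

-- F has a Schur expansion, and the coefficient of s_μ in it is z.
infix 4 [s_]_≐_

[s_]_≐_ : List ℕ → Series → ℤ → Set
[s μ ] F ≐ z = ∃ (IsSchurExpansion F) × (∀ c → IsSchurExpansion F c → c μ ≡ z)

SchurPositive : ∀ {n} → Graph (Fin n) → Set
SchurPositive G = ∃ λ c → IsSchurExpansion (X G) c ×
  (∀ n μ → IsPartitionOf n μ → 0ℤ ≤ᶻ c μ)

ClawFreeConjecture : Set₁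
ClawFreeConjecture = ∀ n (G : Graph (Fin n)) → ClawFree G → SchurPositive G

module Submission where

-- A tableau is a chain of shapes, each a horizontal strip over the previous one, so
-- Kostka numbers satisfy a recursion that removes the largest letter.  Reflecting one
-- level of such a chain in the box over which it ranges shows that they are symmetric in
-- the content.  Together with unitriangularity for the lexicographic order this gives
-- every symmetric series a Schur expansion and determines its coefficients.
--
-- With t colours, a proper colouring of Q_t uses each colour exactly once on K_t, so in t
-- variables X_{Q_t} is (t-1)(t-1)! x₁⋯x_t X_Q.  Hence the coefficient at (4,4,4,4,2,1^{t-5})
-- is (t-1)(t-1)! times the one of s_{(3,3,3,3,1)} in X_Q, which is found from a column of the
-- inverse Kostka matrix and seven coefficients of X_Q.
--
-- Q_t is not a line graph because Q contains K₅ minus an edge: in a line graph the edges of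
-- a K₄ share an endpoint, so the two nonadjacent vertices would be adjacent.

open import Defs
open import Data.Bool using (Bool; true; false; if_then_else_)
open import Data.Empty using (⊥; ⊥-elim)
open import Data.Fin
  using (Fin; zero; suc; toℕ; fromℕ; inject₁; punchIn; punchOut; _↑ˡ_; _↑ʳ_; splitAt; #_; join)
  renaming (_<_ to _<ᶠ_; _≤_ to _≤ᶠ_)
open import Data.Fin.Permutation using (↔⇒≡)
import Data.Fin.Properties as Finₚ
open import Data.Fin.Relation.Unary.Top using (view; ‵fromℕ; ‵inject₁)
open import Data.Integer
  using (ℤ; +_; +<+; -_; 0ℤ; 1ℤ)
  renaming (_<_ to _<ᶻ_; _+_ to _+ᶻ_; _*_ to _*ᶻ_; _-_ to _-ᶻ_)
import Data.Integer.Properties as ℤₚ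
open import Data.List
  using (List; []; _∷_; _∷ʳ_; _++_; map; length; filter; zip; concat; concatMap; upTo; allFin;
    cartesianProductWith; replicate; drop; initLast; _∷ʳ′_)
  renaming (lookup to lookupᴸ)
open import Data.List.Membership.DecPropositional using () renaming (_∈?_ to ∈-dec)
open import Data.List.Membership.Propositional as Mem using (_∈_; _∉_; lose)
open import Data.List.Membership.Propositional.Properties
  using (∈-map⁺; ∈-map⁻; ∈-filter⁺; ∈-filter⁻; ∈-concatMap⁺; ∈-concatMap⁻;
    ∈-cartesianProductWith⁺; ∈-cartesianProductWith⁻; ∈-allFin; ∈-upTo⁺; ∈-upTo⁻)
open import Data.List.Membership.Propositional.Properties.WithK using (unique∧set⇒bag)
open import Data.List.Properties as Listₚ using (length-map)
open import Data.List.Relation.Binary.BagAndSetEquality using (∼bag⇒↭)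
open import Data.List.Relation.Binary.Permutation.Propositional
  using (_↭_; refl; prep; swap; trans; ↭-sym; ↭⇒↭ₛ)
open import Data.List.Relation.Binary.Permutation.Propositional.Properties
  using (↭-length; shift; All-resp-↭; ++⁺ˡ; ++-comm)
open import Data.List.Relation.Unary.All as Allₗ using (All; []; _∷_)
import Data.List.Relation.Unary.All.Properties as Allₚ
open import Data.List.Relation.Unary.AllPairs using ([]; _∷_)
open import Data.List.Relation.Unary.Any as Any using (here; there)
open import Data.List.Relation.Unary.Linked as Linkedₗ using (Linked; []; [-]; _∷_)
open import Data.List.Relation.Unary.Unique.Propositional using (Unique)
import Data.List.Relation.Unary.Unique.Propositional.Properties as Uniqueₚ
open import Data.List.Sort using (sort; sort-↭; sort-↗)
open import Data.Nat
  using (ℕ; nonZero; zero; suc; _+_; _*_; _∸_; _^_; _⊔_; _⊓_; _≤_; _<_; _≥_; _!; z≤n; s≤s; _≟_;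
    _<?_)
open import Data.Nat.ListAction using (sum)
open import Data.Nat.ListAction.Properties using (sum-↭; sum-++)
open import Data.Nat.Properties as ℕₚ
  using (≤-refl; ≤-trans; ≤-reflexive; ≤-antisym; <-irrefl; <⇒≤; ≮⇒≥; m≤m+n; m≤n+m; +-comm;
    +-assoc; +-suc; +-identityʳ; +-cancelˡ-≡; +-cancelʳ-≡; +-mono-≤; +-monoʳ-≤; +-monoˡ-≤;
    m+n∸m≡n; m+[n∸m]≡n; m≤n⇒m<n∨m≡n; suc-injective; ≤-pred; <-≤-trans; ≤-<-trans)
open import Data.Product using (Σ; ∃; _×_; _,_; proj₁; proj₂; uncurry)
open import Data.Sum using (_⊎_; inj₁; inj₂; [_,_]′)
open import Data.Unit using (⊤; tt)
open import Data.Vec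
  using (Vec; []; _∷_; lookup; tabulate; toList; fromList; count; insertAt; _[_]≔_; zipWith)
  renaming (map to mapᵛ; sum to sumᵛ; _++_ to _++ᵛ_; splitAt to splitAtᵛ; replicate to
    replicateᵛ)
import Data.Vec.Properties as Vecₚ
open import Function using (_∘_; id; mk⇔; _↔_; Inverse; Equivalence)
open import Relation.Binary.Construct.Closure.ReflexiveTransitive
  using (Star; ε; _◅_; _◅◅_; gmap)
  renaming (reverse to reverseˢ)
open import Relation.Binary.Construct.Flip.EqAndOrd using (decTotalOrder)
open import Relation.Binary.PropositionalEquality
  using (_≡_; _≢_; refl; sym; cong; cong₂; subst; module ≡-Reasoning)
  renaming (trans to _∙_; setoid to ≡-setoid)
open import Relation.Nullary using (¬_; Dec; yes; no; does; contradiction; recompute)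
open import Relation.Nullary.Decidable
  using (_×-dec_; ¬?; _→-dec_; _⊎-dec_; toWitness; dec-true; True)
open import Relation.Unary using (Decidable)
open import Algebra.Properties.CommutativeSemigroup ℤₚ.+-commutativeSemigroup
  using (interchange; x∙yz≈y∙xz)
open import Data.List.Relation.Binary.Permutation.Setoid (≡-setoid ℕ) using (onIndices)
open import Data.List.Relation.Binary.Permutation.Setoid.Properties (≡-setoid ℕ)
  using (onIndices-lookup)

-- The size 13 + t of the shapes grows with t, so the linear system for the coefficients must be cut
-- down to one that does not depend on t. Two obstructions to colouring do this. The clique K_t
-- forces at least t colours, and Q is covered by four cliques, so with K_t no colour occurs more
-- than 5 times. Both conditions propagate from contents to shapes: every coefficient at a shape
-- with fewer than t rows or with a first row longer than 5 is 0. At a content with exactly t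
-- positive parts that ends in t - 5 ones, the remaining shapes have exactly t rows and end in the
-- same ones. Without these ones they are partitions of 18 = 13 + 5 into five parts of size at most
-- 5, and there are nine of them. Division by x₁⋯x_t never takes place: the factorisation is used
-- only at these contents. The number -144 is 4032 - 3 · 1584 + 576. Since the notion of coefficient
-- includes the existence of an expansion, existence is proved for arbitrary symmetric series.

private variable
  A B C : Set
  k l n : ℕ

-- Counting with duplicate-free lists, and finite sums over them

-- Colourings, tableaux and partitions are all counted as lengths of filtered lists. Without
-- repetitions, two enumerations in different orders are compared by membership alone.
↭-unique : {xs ys : List A} → Unique xs → Unique ys →
  (∀ {x} → x ∈ xs → x ∈ ys) → (∀ {x} → x ∈ ys → x ∈ xs) → xs ↭ ys
↭-unique u v p q = ∼bag⇒↭ (unique∧set⇒bag u v (mk⇔ p q))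

map-unique : {f : A → B} {xs : List A} →
  (∀ {x y} → x ∈ xs → y ∈ xs → f x ≡ f y → x ≡ y) → Unique xs → Unique (map f xs)
map-unique inj []       = []
map-unique inj (p ∷ ps) =
  Allₚ.map⁺ (Allₗ.tabulate λ y∈ e → Allₗ.lookup p y∈ (inj (here refl) (there y∈) e))
  ∷ map-unique (λ x∈ y∈ → inj (there x∈) (there y∈)) ps

concatMap-unique : {f : A → List B} {xs : List A} → (∀ {x} → x ∈ xs → Unique (f x)) →
  (∀ {x x′ y} → y ∈ f x → y ∈ f x′ → x ≡ x′) → Unique xs → Unique (concatMap f xs)
concatMap-unique u disj []       = []
concatMap-unique {f = f} {xs = x ∷ xs} u disj (p ∷ ps) =
  Uniqueₚ.++⁺ (u (here refl)) (concatMap-unique (u ∘ there) disj ps) λ (y∈ , y∈′) →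
    go p (∈-concatMap⁻ f y∈′) y∈
  where
  go : ∀ {y zs} → All (x ≢_) zs → Any.Any (λ z → y ∈ f z) zs → y ∈ f x → ⊥
  go (x≢ ∷ _) (here y∈′) y∈ = x≢ (disj y∈ y∈′)
  go (_ ∷ ps) (there i)  y∈ = go ps i y∈

∈-concatMap : {f : A → List B} {xs : List A} {x : A} {y : B} → x ∈ xs → y ∈ f x → y ∈ concatMap f xs
∈-concatMap {f = f} x∈ y∈ = ∈-concatMap⁺ f (lose x∈ y∈)

∈-concatMap′ : {f : A → List B} {xs : List A} {y : B} → y ∈ concatMap f xs → ∃ λ x → x ∈ xs × y ∈ f x
∈-concatMap′ {f = f} y∈ = Mem.find (∈-concatMap⁻ f y∈)

bijection-↭ : {xs : List A} {ys : List B} (f : A → B) → Unique xs → Unique ys →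
  (∀ {x} → x ∈ xs → f x ∈ ys) →
  (∀ {x y} → x ∈ xs → y ∈ xs → f x ≡ f y → x ≡ y) →
  (∀ {y} → y ∈ ys → ∃ λ x → x ∈ xs × f x ≡ y) → map f xs ↭ ys
bijection-↭ {xs = xs} f u v to inj surj = ↭-unique (map-unique inj u) v
  (λ y∈ → let (x , x∈ , e) = ∈-map⁻ f y∈ in subst (_∈ _) (sym e) (to x∈))
  (λ y∈ → let (x , x∈ , e) = surj y∈ in subst (_∈ map f xs) e (∈-map⁺ f x∈))

bijection-length : {xs : List A} {ys : List B} (f : A → B) → Unique xs → Unique ys →
  (∀ {x} → x ∈ xs → f x ∈ ys) →
  (∀ {x y} → x ∈ xs → y ∈ xs → f x ≡ f y → x ≡ y) →
  (∀ {y} → y ∈ ys → ∃ λ x → x ∈ xs × f x ≡ y) → length xs ≡ length ys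
bijection-length {xs = xs} f u v to inj surj =
  sym (length-map f xs) ∙ ↭-length (bijection-↭ f u v to inj surj)

∑-cong : (xs : List A) {f g : A → ℤ} → (∀ {x} → x ∈ xs → f x ≡ g x) → ∑ xs f ≡ ∑ xs g
∑-cong []       e = refl
∑-cong (x ∷ xs) {f} {g} e = cong₂ _+ᶻ_ (e (here refl)) (∑-cong xs {f} {g} (e ∘ there))

∑-zero : (xs : List A) {f : A → ℤ} → (∀ {x} → x ∈ xs → f x ≡ 0ℤ) → ∑ xs f ≡ 0ℤ
∑-zero []       e = refl
∑-zero (x ∷ xs) {f} e = cong₂ _+ᶻ_ (e (here refl)) (∑-zero xs {f} (e ∘ there))

∑-↭ : {xs ys : List A} (f : A → ℤ) → xs ↭ ys → ∑ xs f ≡ ∑ ys f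
∑-↭ f refl        = refl
∑-↭ f (prep x p)  = cong (f x +ᶻ_) (∑-↭ f p)
∑-↭ f (swap x y p) = cong (λ z → f x +ᶻ (f y +ᶻ z)) (∑-↭ f p) ∙ x∙yz≈y∙xz (f x) (f y) _
∑-↭ f (trans p q) = ∑-↭ f p ∙ ∑-↭ f q

∑-map : (h : A → B) (xs : List A) (f : B → ℤ) → ∑ (map h xs) f ≡ ∑ xs (f ∘ h)
∑-map h []       f = refl
∑-map h (x ∷ xs) f = cong (f (h x) +ᶻ_) (∑-map h xs f)

∑-++ : (xs ys : List A) (f : A → ℤ) → ∑ (xs ++ ys) f ≡ ∑ xs f +ᶻ ∑ ys f
∑-++ []       ys f = sym (ℤₚ.+-identityˡ (∑ ys f))
∑-++ (x ∷ xs) ys f = cong (f x +ᶻ_) (∑-++ xs ys f) ∙ sym (ℤₚ.+-assoc (f x) (∑ xs f) (∑ ys f))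

∑-concatMap : (h : A → List B) (xs : List A) (f : B → ℤ) →
  ∑ (concatMap h xs) f ≡ ∑ xs (λ x → ∑ (h x) f)
∑-concatMap h []       f = refl
∑-concatMap h (x ∷ xs) f =
  ∑-++ (h x) (concatMap h xs) f ∙ cong (∑ (h x) f +ᶻ_) (∑-concatMap h xs f)

∑-+ : (xs : List A) (f g : A → ℤ) → ∑ xs (λ x → f x +ᶻ g x) ≡ ∑ xs f +ᶻ ∑ xs g
∑-+ []       f g = refl
∑-+ (x ∷ xs) f g = cong (f x +ᶻ g x +ᶻ_) (∑-+ xs f g) ∙ interchange (f x) (g x) (∑ xs f) (∑ xs g)

∑-const : (xs : List A) (c : ℤ) → ∑ xs (λ _ → c) ≡ + length xs *ᶻ c
∑-const []       c = sym (ℤₚ.*-zeroˡ c)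
∑-const (x ∷ xs) c = cong (c +ᶻ_) (∑-const xs c) ∙ sym (ℤₚ.suc-* (+ length xs) c)

∑-*ˡ : (c : ℤ) (xs : List A) (f : A → ℤ) → c *ᶻ ∑ xs f ≡ ∑ xs (λ x → c *ᶻ f x)
∑-*ˡ c []       f = ℤₚ.*-zeroʳ c
∑-*ˡ c (x ∷ xs) f = ℤₚ.*-distribˡ-+ c (f x) (∑ xs f) ∙ cong (c *ᶻ f x +ᶻ_) (∑-*ˡ c xs f)

∑-swap : (xs : List A) (ys : List B) (f : A → B → ℤ) →
  ∑ xs (λ x → ∑ ys (f x)) ≡ ∑ ys (λ y → ∑ xs (λ x → f x y))
∑-swap []       ys f = sym (∑-zero ys {λ _ → 0ℤ} (λ _ → refl))
∑-swap (x ∷ xs) ys f = cong (∑ ys (f x) +ᶻ_) (∑-swap xs ys f) ∙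
  sym (∑-+ ys (f x) (λ y → ∑ xs (λ x → f x y)))

length-concatMap : (f : A → List B) (xs : List A) → + length (concatMap f xs) ≡ ∑ xs (λ x → + length (f x))
length-concatMap f []       = refl
length-concatMap f (x ∷ xs) =
  cong +_ (Listₚ.length-++ (f x)) ∙ cong (+ length (f x) +ᶻ_) (length-concatMap f xs)

∑-filter : {P : A → Set} (P? : Decidable P) (xs : List A) (f : A → ℤ) →
  (∀ {x} → x ∈ xs → ¬ P x → f x ≡ 0ℤ) → ∑ (filter P? xs) f ≡ ∑ xs f
∑-filter P? []       f z = refl
∑-filter P? (x ∷ xs) f z with P? x
... | yes _ = cong (f x +ᶻ_) (∑-filter P? xs f (z ∘ there))
... | no ¬p = ∑-filter P? xs f (z ∘ there) ∙ sym (cong (_+ᶻ ∑ xs f) (z (here refl) ¬p) ∙ ℤₚ.+-identityˡ _)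

∑-bijection : {xs : List A} {ys : List B} {g : A → ℤ} {h : B → ℤ} (f : A → B) →
  Unique xs → Unique ys →
  (∀ {x} → x ∈ xs → f x ∈ ys) →
  (∀ {x y} → x ∈ xs → y ∈ xs → f x ≡ f y → x ≡ y) →
  (∀ {y} → y ∈ ys → ∃ λ x → x ∈ xs × f x ≡ y) →
  (∀ {x} → x ∈ xs → g x ≡ h (f x)) → ∑ xs g ≡ ∑ ys h
∑-bijection {xs = xs} {g = g} {h} f u v to inj surj e =
  ∑-cong xs {g} {h ∘ f} e ∙ (sym (∑-map f xs h) ∙ ∑-↭ h (bijection-↭ f u v to inj surj))

infix 4 _≟ᴸ_

_≟ᴸ_ : (μ ν : List ℕ) → Dec (μ ≡ ν)
_≟ᴸ_ = Listₚ.≡-dec _≟_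

open import Data.List.Membership.DecPropositional _≟ᴸ_ using () renaming (_∈?_ to _∈ᴸ?_)
open import Data.List.Relation.Unary.Unique.DecPropositional _≟ᴸ_ using (unique?)

∑-support : {xs ys : List (List ℕ)} {f : List ℕ → ℤ} → Unique xs → Unique ys →
  (∀ {y} → y ∈ ys → y ∈ xs) → (∀ {x} → x ∈ xs → x ∉ ys → f x ≡ 0ℤ) → ∑ xs f ≡ ∑ ys f
∑-support {xs} {ys} {f} u v sub z = sym (∑-filter (_∈ᴸ? ys) xs f z) ∙
  ∑-↭ f (↭-unique (Uniqueₚ.filter⁺ (_∈ᴸ? ys) u) v
    (λ x∈ → proj₂ (∈-filter⁻ (_∈ᴸ? ys) {xs = xs} x∈)) (λ y∈ → ∈-filter⁺ (_∈ᴸ? ys) (sub y∈) y∈))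

∑-single : {xs : List (List ℕ)} {f : List ℕ → ℤ} {y : List ℕ} → Unique xs → y ∈ xs →
  (∀ {x} → x ∈ xs → x ≢ y → f x ≡ 0ℤ) → ∑ xs f ≡ f y
∑-single {f = f} {y} u y∈ z =
  ∑-support {f = f} u ([] ∷ []) (λ { (here refl) → y∈ }) (λ x∈ x∉ → z x∈ (x∉ ∘ here))
  ∙ ℤₚ.+-identityʳ (f y)

-- Horizontal strips, Kostka numbers and their symmetry in the content

range : ℕ → ℕ → List ℕ
range l h = map (_+_ l) (upTo (suc h ∸ l))

range-unique : ∀ l h → Unique (range l h)
range-unique l h = Uniqueₚ.map⁺ (+-cancelˡ-≡ l _ _) (Uniqueₚ.upTo⁺ (suc h ∸ l))

∈-range : ∀ {l h n} → l ≤ n → n ≤ h → n ∈ range l h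
∈-range {l} {h} {n} l≤n n≤h = subst (_∈ range l h) (m+[n∸m]≡n l≤n)
  (∈-map⁺ (_+_ l) (∈-upTo⁺ (ℕₚ.∸-monoˡ-< (s≤s n≤h) l≤n)))

range-bounds : ∀ {l h n} → n ∈ range l h → l ≤ n × n ≤ h
range-bounds {l} {h} n∈ with i , i∈ , refl ← ∈-map⁻ (_+_ l) n∈ =
  m≤m+n l i , ≤-pred (bound (ℕₚ.≤-total l (suc h)) (∈-upTo⁻ i∈))
  where
  bound : ∀ {i} → l ≤ suc h ⊎ suc h ≤ l → i < suc h ∸ l → l + i < suc h
  bound (inj₁ l≤) i< = ≤-trans (ℕₚ.+-monoʳ-< l i<) (≤-reflexive (m+[n∸m]≡n l≤))
  bound {i} (inj₂ ≤l) i< = contradiction (subst (i <_) (ℕₚ.m≤n⇒m∸n≡0 ≤l) i<) λ ()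

head₀ : List ℕ → ℕ
head₀ []      = 0
head₀ (m ∷ _) = m

-- ν ⊴ μ: the skew shape μ / ν is a horizontal strip.  Both shapes are listed
-- with the same number of rows, so ν may end in zeros.
infix 4 _⊴_
data _⊴_ : List ℕ → List ℕ → Set where
  []  : [] ⊴ []
  row : ∀ {m n μ ν} → head₀ μ ≤ n → n ≤ m → ν ⊴ μ → n ∷ ν ⊴ m ∷ μ

-- If the list is not weakly decreasing, `range` is empty at some row, and so is the whole product.
strips : List ℕ → List (List ℕ)
strips []      = [] ∷ []
strips (m ∷ μ) = cartesianProductWith _∷_ (range (head₀ μ) m) (strips μ)

strips-unique : ∀ μ → Unique (strips μ)
strips-unique []      = [] ∷ []
strips-unique (m ∷ μ) = Uniqueₚ.cartesianProductWith⁺ _∷_ Listₚ.∷-injective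
  (range-unique (head₀ μ) m) (strips-unique μ)

∈-strips : ∀ {μ ν} → ν ⊴ μ → ν ∈ strips μ
∈-strips []          = here refl
∈-strips (row p q s) = ∈-cartesianProductWith⁺ _∷_ (∈-range p q) (∈-strips s)

strips-⊴ : ∀ {μ ν} → ν ∈ strips μ → ν ⊴ μ
strips-⊴ {[]}    (here refl) = []
strips-⊴ {m ∷ μ} ν∈
  with n , ν , n∈ , ν∈′ , refl ← ∈-cartesianProductWith⁻ _∷_ (range (head₀ μ) m) (strips μ) ν∈ =
  let (p , q) = range-bounds n∈ in row p q (strips-⊴ ν∈′)

peel : List ℕ → ℕ → List (List ℕ)
peel μ a = filter (λ ν → sum ν + a ≟ sum μ) (strips μ)

peel-unique : ∀ μ a → Unique (peel μ a)
peel-unique μ a = Uniqueₚ.filter⁺ (λ ν → sum ν + a ≟ sum μ) (strips-unique μ)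

∈-peel : ∀ {μ ν a} → ν ⊴ μ → sum ν + a ≡ sum μ → ν ∈ peel μ a
∈-peel {μ} {a = a} s e = ∈-filter⁺ (λ ν → sum ν + a ≟ sum μ) (∈-strips s) e

peel-⊴ : ∀ {μ ν a} → ν ∈ peel μ a → ν ⊴ μ × sum ν + a ≡ sum μ
peel-⊴ {μ} {a = a} ν∈ =
  let (s , e) = ∈-filter⁻ (λ ν → sum ν + a ≟ sum μ) {xs = strips μ} ν∈ in strips-⊴ s , e

-- The content lists the multiplicity of the largest letter first.
kostka : List ℕ → List ℕ → ℤ
kostka μ []      = if does (sum μ ≟ 0) then 1ℤ else 0ℤ
kostka μ (a ∷ α) = ∑ (peel μ a) λ ν → kostka ν α

kostka-[]-1 : ∀ μ → sum μ ≡ 0 → kostka μ [] ≡ 1ℤ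
kostka-[]-1 μ e rewrite e = refl

kostka-[]-0 : ∀ μ → sum μ ≢ 0 → kostka μ [] ≡ 0ℤ
kostka-[]-0 μ ne with sum μ
... | zero  = contradiction refl ne
... | suc _ = refl

-- The Bender–Knuth involution on one level of a Gelfand–Tsetlin pattern: for
-- given μ and ρ the row ν ranges over a box, which is reflected.  The bound u
-- is the part of ρ above the current one.
bk : ℕ → List ℕ → List ℕ → List ℕ → List ℕ
bk u (m ∷ μ) (n ∷ ν) (p ∷ ρ) = (u ⊓ m + (p ⊔ head₀ μ) ∸ n) ∷ bk p μ ν ρ
bk _ _       _       _       = []

-- The two conditions ρ ⊴ ν ⊴ μ become one interval per row of ν: from below by p and the entry of μ
-- one row down, from above by m and the entry u of ρ one row up. The intervals do not depend on ν,
-- so the rows can be reflected independently.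
data Chain : ℕ → List ℕ → List ℕ → List ℕ → Set where
  []  : ∀ {u} → Chain u [] [] []
  row : ∀ {u m n p μ ν ρ} → p ⊔ head₀ μ ≤ n → n ≤ u ⊓ m → Chain p μ ν ρ →
        Chain u (m ∷ μ) (n ∷ ν) (p ∷ ρ)

⊴⇒chain : ∀ {u μ ν ρ} → head₀ ν ≤ u → ν ⊴ μ → ρ ⊴ ν → Chain u μ ν ρ
⊴⇒chain h []          []            = []
⊴⇒chain h (row p q s) (row p′ q′ s′) =
  row (ℕₚ.⊔-lub q′ p) (ℕₚ.⊓-glb h q) (⊴⇒chain p′ s s′)

chain-head : ∀ {u μ ν ρ} → Chain u μ ν ρ → head₀ ν ≤ u
chain-head []          = z≤n
chain-head (row p q c) = ≤-trans q (ℕₚ.m⊓n≤m _ _)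

chain⇒⊴ˡ : ∀ {u μ ν ρ} → Chain u μ ν ρ → ν ⊴ μ
chain⇒⊴ˡ []          = []
chain⇒⊴ˡ (row p q c) = row (≤-trans (ℕₚ.m≤n⊔m _ _) p) (≤-trans q (ℕₚ.m⊓n≤n _ _)) (chain⇒⊴ˡ c)

chain⇒⊴ʳ : ∀ {u μ ν ρ} → Chain u μ ν ρ → ρ ⊴ ν
chain⇒⊴ʳ []          = []
chain⇒⊴ʳ (row p q c) = row (chain-head c) (≤-trans (ℕₚ.m≤m⊔n _ _) p) (chain⇒⊴ʳ c)

bk-chain : ∀ {u μ ν ρ} → Chain u μ ν ρ → Chain u μ (bk u μ ν ρ) ρ
bk-chain []          = []
bk-chain {u} {m ∷ μ} {n ∷ ν} {p ∷ ρ} (row l h c) = row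
  (≤-trans (≤-reflexive (sym (m+n∸m≡n (u ⊓ m) (p ⊔ head₀ μ))))
           (ℕₚ.∸-monoʳ-≤ (u ⊓ m + (p ⊔ head₀ μ)) h))
  (≤-trans (ℕₚ.∸-monoʳ-≤ (u ⊓ m + (p ⊔ head₀ μ)) l)
           (≤-reflexive (ℕₚ.m+n∸n≡m (u ⊓ m) (p ⊔ head₀ μ))))
  (bk-chain c)

bk-involutive : ∀ {u μ ν ρ} → Chain u μ ν ρ → bk u μ (bk u μ ν ρ) ρ ≡ ν
bk-involutive []          = refl
bk-involutive {u} {m ∷ μ} (row l h c) =
  cong₂ _∷_ (ℕₚ.m∸[m∸n]≡n (≤-trans h (m≤m+n (u ⊓ m) _))) (bk-involutive c)

-- A row and its reflection add up to the two ends of the interval. The maximum in the lower end of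
-- one row pairs with the minimum in the upper end of the next, and maximum plus minimum is the
-- plain sum, so everything telescopes. The summand `head₀ μ` on the left avoids a subtraction.
bk-sum : ∀ {u μ ν ρ} → Chain u μ ν ρ →
  sum ν + sum (bk u μ ν ρ) + head₀ μ ≡ (u ⊓ head₀ μ) + (sum μ + sum ρ)
bk-sum {u} []          = sym (+-identityʳ (u ⊓ 0) ∙ ℕₚ.⊓-zeroʳ u)
bk-sum {u} {m ∷ μ} {n ∷ ν} {p ∷ ρ} (row l h c) = +-cancelʳ-≡ (head₀ μ) _ _ (begin
  n + V + (n′ + V′) + m + H               ≡⟨ solve 6 (λ n V n′ V′ m H →
    n :+ V :+ (n′ :+ V′) :+ m :+ H := (n :+ n′) :+ (V :+ V′ :+ H) :+ m) refl n V n′ V′ m H ⟩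
  (n + n′) + (V + V′ + H) + m             ≡⟨ cong₂ (λ x y → x + y + m)
    (m+[n∸m]≡n (≤-trans h (m≤m+n (u ⊓ m) _))) (bk-sum c) ⟩
  (u ⊓ m + (p ⊔ H)) + ((p ⊓ H) + (M + R)) + m ≡⟨ solve 6 (λ a b c M R m →
    (a :+ b) :+ (c :+ (M :+ R)) :+ m := a :+ (m :+ M :+ R) :+ (b :+ c)) refl (u ⊓ m) (p ⊔ H) (p ⊓ H) M R m ⟩
  u ⊓ m + (m + M + R) + ((p ⊔ H) + (p ⊓ H)) ≡⟨ cong (_+_ (u ⊓ m + (m + M + R))) (⊔+⊓ p H) ⟩
  u ⊓ m + (m + M + R) + (p + H)           ≡⟨ solve 6 (λ a m M R p H →
    a :+ (m :+ M :+ R) :+ (p :+ H) := a :+ (m :+ M :+ (p :+ R)) :+ H) refl (u ⊓ m) m M R p H ⟩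
  u ⊓ m + (m + M + (p + R)) + H           ∎)
  where
  open ≡-Reasoning
  open import Data.Nat.Solver using (module +-*-Solver)
  open +-*-Solver
  V = sum ν
  V′ = sum (bk p μ ν ρ)
  n′ = u ⊓ m + (p ⊔ head₀ μ) ∸ n
  H = head₀ μ
  M = sum μ
  R = sum ρ
  ⊔+⊓ : ∀ a b → (a ⊔ b) + (a ⊓ b) ≡ a + b
  ⊔+⊓ a b with ℕₚ.≤-total a b
  ... | inj₁ a≤b = cong₂ _+_ (ℕₚ.m≤n⇒m⊔n≡n a≤b) (ℕₚ.m≤n⇒m⊓n≡m a≤b) ∙ +-comm b a
  ... | inj₂ b≤a = cong₂ _+_ (ℕₚ.m≥n⇒m⊔n≡m b≤a) (ℕₚ.m≥n⇒m⊓n≡n b≤a)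

chains : List ℕ → ℕ → ℕ → List (List ℕ × List ℕ)
chains μ a b = concatMap (λ ν → map (ν ,_) (peel ν b)) (peel μ a)

chains-unique : ∀ μ a b → Unique (chains μ a b)
chains-unique μ a b = concatMap-unique
  (λ {ν} _ → Uniqueₚ.map⁺ (cong proj₂) (peel-unique ν b))
  (λ {ν} {ν′} y∈ y∈′ → let (_ , _ , e) = ∈-map⁻ (ν ,_) y∈ ; (_ , _ , e′) = ∈-map⁻ (ν′ ,_) y∈′ in
     cong proj₁ (sym e ∙ e′))
  (peel-unique μ a)

∈-chains : ∀ {μ ν ρ a b} → Chain (head₀ μ) μ ν ρ → sum ν + a ≡ sum μ → sum ρ + b ≡ sum ν →
  (ν , ρ) ∈ chains μ a b
∈-chains {ν = ν} c e e′ = ∈-concatMap (∈-peel (chain⇒⊴ˡ c) e) (∈-map⁺ (ν ,_) (∈-peel (chain⇒⊴ʳ c) e′))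

⊴-head : ∀ {μ ν} → ν ⊴ μ → head₀ ν ≤ head₀ μ
⊴-head []          = z≤n
⊴-head (row p q s) = q

chains-chain : ∀ {μ ν ρ a b} → (ν , ρ) ∈ chains μ a b →
  Chain (head₀ μ) μ ν ρ × sum ν + a ≡ sum μ × sum ρ + b ≡ sum ν
chains-chain {μ} {a = a} {b} y∈ with ∈-concatMap′ {xs = peel μ a} y∈
... | ν , ν∈ , y∈′ with ρ , ρ∈ , refl ← ∈-map⁻ (ν ,_) y∈′ =
  let (s , e) = peel-⊴ ν∈ ; (s′ , e′) = peel-⊴ ρ∈ in ⊴⇒chain (⊴-head s) s s′ , e , e′

-- Reflecting ν with μ and ρ fixed replaces |ν| by |μ| + |ρ| - |ν|, which exchanges the sizes of the
-- two strips. No row of ρ lies above the first one; the bound `head₀ μ` makes the minimum there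
-- equal to m.
kostka-swap : ∀ μ a b α → kostka μ (a ∷ b ∷ α) ≡ kostka μ (b ∷ a ∷ α)
kostka-swap μ a b α = two a b ∙ (∑-bijection {g = g} {h = g} f (chains-unique μ a b) (chains-unique μ b a)
    (to a b)
    (λ x∈ y∈ e → let c = proj₁ (chains-chain x∈) ; c′ = proj₁ (chains-chain y∈) in
      sym (ff c) ∙ (cong f e ∙ ff c′))
    (λ {y} y∈ → f y , to b a y∈ , ff (proj₁ (chains-chain y∈)))
    (λ _ → refl) ∙ sym (two b a))
  where
  f : List ℕ × List ℕ → List ℕ × List ℕ
  f (ν , ρ) = bk (head₀ μ) μ ν ρ , ρ
  g : List ℕ × List ℕ → ℤ
  g (ν , ρ) = kostka ρ α
  ff : ∀ {ν ρ} → Chain (head₀ μ) μ ν ρ → f (f (ν , ρ)) ≡ (ν , ρ)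
  ff {ρ = ρ} c = cong (_, ρ) (bk-involutive c)
  two : ∀ a b → kostka μ (a ∷ b ∷ α) ≡ ∑ (chains μ a b) g
  two a b = sym (∑-concatMap _ (peel μ a) g ∙
    ∑-cong (peel μ a) {λ ν → ∑ (map (ν ,_) (peel ν b)) g} (λ {ν} _ → ∑-map (ν ,_) (peel ν b) g))
  to : ∀ a b {x} → x ∈ chains μ a b → f x ∈ chains μ b a
  to a b {ν , ρ} x∈ with chains-chain x∈
  ... | c , e , e′ = ∈-chains (bk-chain c) (cong (_+ b) key ∙ (+-assoc (sum ρ) a b ∙
           (cong (_+_ (sum ρ)) (+-comm a b) ∙ (sym (+-assoc (sum ρ) b a) ∙ (cong (_+ a) e′ ∙ e))))) (sym key)
    where
    both : sum ν + sum (bk (head₀ μ) μ ν ρ) ≡ sum μ + sum ρ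
    both = +-cancelʳ-≡ (head₀ μ) _ _
      (bk-sum c ∙ (cong (_+ (sum μ + sum ρ)) (ℕₚ.⊓-idem (head₀ μ)) ∙ +-comm (head₀ μ) _))
    key : sum (bk (head₀ μ) μ ν ρ) ≡ sum ρ + a
    key = +-cancelˡ-≡ (sum ν) _ _ (both ∙ (cong (_+ sum ρ) (sym e) ∙
      (+-assoc (sum ν) a (sum ρ) ∙ cong (_+_ (sum ν)) (+-comm a (sum ρ)))))

kostka-↭ : ∀ {α β} μ → α ↭ β → kostka μ α ≡ kostka μ β
kostka-↭ μ refl = refl
kostka-↭ μ (prep a p) = ∑-cong (peel μ a) (λ {ν} _ → kostka-↭ ν p)
kostka-↭ {_ ∷ _ ∷ α} {_ ∷ _ ∷ β} μ (swap a b p) = kostka-swap μ a b α ∙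
  ∑-cong (peel μ b) {λ ν → kostka ν (a ∷ α)} {λ ν → kostka ν (a ∷ β)} (λ {ν} _ →
    ∑-cong (peel ν a) {λ ρ → kostka ρ α} {λ ρ → kostka ρ β} (λ {ρ} _ → kostka-↭ ρ p))
kostka-↭ μ (trans p q) = kostka-↭ μ p ∙ kostka-↭ μ q

-- Enumerations of words and fillings

words-unique : {xs : List A} → Unique xs → ∀ n → Unique (words xs n)
words-unique u zero    = [] ∷ []
words-unique u (suc n) =
  Uniqueₚ.cartesianProductWith⁺ _∷_ Vecₚ.∷-injective u (words-unique u n)

∈-words : {xs : List A} {n : ℕ} (w : Vec A n) → All (_∈ xs) (toList w) → w ∈ words xs n
∈-words []      []       = here refl
∈-words (x ∷ w) (p ∷ ps) = ∈-cartesianProductWith⁺ _∷_ p (∈-words w ps)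

allWords : ∀ n k → List (Vec (Fin k) n)
allWords n k = words (allFin k) n

allWords-unique : ∀ n k → Unique (allWords n k)
allWords-unique n k = words-unique (Uniqueₚ.allFin⁺ k) n

∈-allWords : ∀ {n} (w : Vec (Fin k) n) → w ∈ allWords n k
∈-allWords w = ∈-words w (Allₗ.universal ∈-allFin (toList w))

toList-injective : ∀ {n} (v w : Vec A n) → toList v ≡ toList w → v ≡ w
toList-injective []      []      e = refl
toList-injective (x ∷ v) (y ∷ w) e =
  let (p , q) = Listₚ.∷-injective e in cong₂ _∷_ p (toList-injective v w q)

fillings-unique : ∀ k μ → Unique (fillings k μ)
fillings-unique k []      = [] ∷ []
fillings-unique k (r ∷ μ) = Uniqueₚ.cartesianProductWith⁺ (λ w T → toList w ∷ T)
  (λ e → let (p , q) = Listₚ.∷-injective e in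
     toList-injective _ _ p , q)
  (allWords-unique r k) (fillings-unique k μ)

∈-fillings : ∀ {μ} {T : Tableau k} → map length T ≡ μ → T ∈ fillings k μ
∈-fillings {T = []}    refl = here refl
∈-fillings {T = r ∷ T} refl = subst (λ r′ → r′ ∷ T ∈ fillings _ (map length (r ∷ T))) (Vecₚ.toList∘fromList r)
  (∈-cartesianProductWith⁺ (λ w T → toList w ∷ T) (∈-allWords (fromList r)) (∈-fillings refl))

fillings-shape : ∀ {μ} {T : Tableau k} → T ∈ fillings k μ → map length T ≡ μ
fillings-shape {μ = []}    (here refl) = refl
fillings-shape {k} {r ∷ μ} T∈
  with w , T′ , _ , T′∈ , refl ←
    ∈-cartesianProductWith⁻ (λ w T → toList w ∷ T) (allWords r k) (fillings k μ) T∈ =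
  cong₂ _∷_ (Vecₚ.length-toList w) (fillings-shape T′∈)

-- Multiplicities

occ : ∀ {n} → Fin k → Vec (Fin k) n → ℕ
occ i = count (Finₚ._≟ i)

occ-yes : ∀ {n} {i x : Fin k} (w : Vec (Fin k) n) → x ≡ i → occ i (x ∷ w) ≡ suc (occ i w)
occ-yes {i = i} {x} w e with x Finₚ.≟ i
... | yes _ = refl
... | no ne = contradiction e ne

occ-no : ∀ {n} {i x : Fin k} (w : Vec (Fin k) n) → x ≢ i → occ i (x ∷ w) ≡ occ i w
occ-no {i = i} {x} w ne with x Finₚ.≟ i
... | yes e = contradiction e ne
... | no _  = refl

content-occ : ∀ {n} {w : Vec (Fin k) n} {α} → content w ≡ α → ∀ i → occ i w ≡ lookup α i
content-occ {w = w} refl i = sym (Vecₚ.lookup∘tabulate (λ i → occ i w) i)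

occ-content : ∀ {n} {w : Vec (Fin k) n} {α} → (∀ i → occ i w ≡ lookup α i) → content w ≡ α
occ-content {α = α} e = Vecₚ.tabulate-cong e ∙ Vecₚ.tabulate∘lookup α

occᴸ : Fin k → List (Fin k) → ℕ
occᴸ i xs = occ i (fromList xs)

occᴸ-++ : (i : Fin k) (xs ys : List (Fin k)) → occᴸ i (xs ++ ys) ≡ occᴸ i xs + occᴸ i ys
occᴸ-++ i []       ys = refl
occᴸ-++ i (x ∷ xs) ys with x Finₚ.≟ i
... | yes _ = cong suc (occᴸ-++ i xs ys)
... | no _  = occᴸ-++ i xs ys

-- Removing the largest letter from a semistandard tableau

-- The bijection is set up in the direction of insertion: the old letters are embedded by `inject₁`,
-- and copies of the new largest letter complete each row to its length in the bigger shape.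
pad : ℕ → List (Fin k) → List (Fin (suc k))
pad zero    _       = []
pad (suc m) []      = fromℕ _ ∷ pad m []
pad (suc m) (x ∷ r) = inject₁ x ∷ pad m r

padRows : List ℕ → Tableau k → Tableau (suc k)
padRows (m ∷ μ) (r ∷ T) = pad m r ∷ padRows μ T
padRows _       _       = []

Sorted : List (Fin k) → Set
Sorted = Linked _≤ᶠ_

_Above_ : List (Fin k) → List (Fin k) → Set
r Above s = All (uncurry _<ᶠ_) (zip r s)

length-pad : ∀ m (r : List (Fin k)) → length (pad m r) ≡ m
length-pad zero    r       = refl
length-pad (suc m) []      = cong suc (length-pad m [])
length-pad (suc m) (x ∷ r) = cong suc (length-pad m r)

pad-injective : ∀ m (r s : List (Fin k)) → length r ≤ m → length s ≤ m → pad m r ≡ pad m s → r ≡ s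
pad-injective m       []      []      p q e = refl
pad-injective (suc m) []      (y ∷ s) p q e =
  contradiction (proj₁ (Listₚ.∷-injective e)) Finₚ.fromℕ≢inject₁
pad-injective (suc m) (x ∷ r) []      p q e =
  contradiction (sym (proj₁ (Listₚ.∷-injective e))) Finₚ.fromℕ≢inject₁
pad-injective (suc m) (x ∷ r) (y ∷ s) (s≤s p) (s≤s q) e = let (e₁ , e₂) = Listₚ.∷-injective e in
  cong₂ _∷_ (Finₚ.inject₁-injective e₁) (pad-injective m r s p q e₂)

inject₁<fromℕ : (x : Fin k) → inject₁ x <ᶠ fromℕ k
inject₁<fromℕ {k} x rewrite Finₚ.toℕ-fromℕ k | Finₚ.toℕ-inject₁ x = Finₚ.toℕ<n x

inject₁-mono : {P : ℕ → ℕ → Set} {x y : Fin k} → P (toℕ x) (toℕ y) → P (toℕ (inject₁ x)) (toℕ (inject₁ y))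
inject₁-mono {x = x} {y} p rewrite Finₚ.toℕ-inject₁ x | Finₚ.toℕ-inject₁ y = p

inject₁-reflect : {P : ℕ → ℕ → Set} {x y : Fin k} → P (toℕ (inject₁ x)) (toℕ (inject₁ y)) → P (toℕ x) (toℕ y)
inject₁-reflect {x = x} {y} p rewrite Finₚ.toℕ-inject₁ x | Finₚ.toℕ-inject₁ y = p

pad-sorted : ∀ m {r : List (Fin k)} → Sorted r → Sorted (pad m r)
pad-sorted zero          s            = []
pad-sorted (suc zero)    []           = [-]
pad-sorted (suc (suc m)) []           = ≤-refl ∷ pad-sorted (suc m) []
pad-sorted (suc zero)    [-]          = [-]
pad-sorted (suc (suc m)) ([-] {x})    = <⇒≤ (inject₁<fromℕ x) ∷ pad-sorted (suc m) []
pad-sorted (suc zero)    (p ∷ s)      = [-]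
pad-sorted (suc (suc m)) (p ∷ s)      = inject₁-mono {P = _≤_} p ∷ pad-sorted (suc m) s

-- The inequality `l ≤ length r` is the horizontal-strip condition. It places every cell of the
-- padded lower row beneath an old letter, so the largest letter never stands above another cell.
pad-above : ∀ {m l} {r s : List (Fin k)} → l ≤ length r → length r ≤ m → length s ≤ l →
  r Above s → pad m r Above pad l s
pad-above {m = zero}              {r = []} z≤n _ _ a = []
pad-above {m = suc m} {r = []}    z≤n _ _ a = []
pad-above {m = suc m} {r = x ∷ r} z≤n _ _ a = []
pad-above {r = x ∷ r} {[]}    (s≤s p) (s≤s q) h       a       = inject₁<fromℕ x ∷ pad-above p q z≤n (zip-[] r)
  where
  zip-[] : (r : List (Fin _)) → r Above []
  zip-[] []      = []
  zip-[] (_ ∷ _) = []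
pad-above {r = x ∷ r} {y ∷ s} (s≤s p) (s≤s q) (s≤s h) (b ∷ a) = inject₁-mono {P = _<_} b ∷ pad-above p q h a

-- Nothing is strictly larger than the largest letter, so strict columns force the lower row to stop
-- before the padding of the upper row begins.
above-pad : ∀ {m l} {r s : List (Fin k)} → l ≤ m → length s ≤ l →
  pad m r Above pad l s → l ≤ length r × r Above s
above-pad {r = []}    {s = []} z≤n h a = z≤n , []
above-pad {r = x ∷ r} {s = []} z≤n h a = z≤n , []
above-pad {r = []}    {[]}     (s≤s p) h (b ∷ a) = contradiction b (ℕₚ.n≮n _)
above-pad {r = []}    {y ∷ s}  (s≤s p) h (b ∷ a) = contradiction (ℕₚ.<-trans b (inject₁<fromℕ y)) (ℕₚ.n≮n _)
above-pad {r = x ∷ r} {[]}     (s≤s p) h (b ∷ a) = s≤s (proj₁ (above-pad {r = r} p z≤n a)) , []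
above-pad {r = x ∷ r} {y ∷ s}  (s≤s p) (s≤s h) (b ∷ a) =
  let (q , a′) = above-pad {r = r} p h a in s≤s q , inject₁-reflect {P = _<_} b ∷ a′

-- In a sorted row the first largest letter starts a constant tail, which is where the row is cut.
unpad : {r : List (Fin (suc k))} → Sorted r →
  ∃ λ r′ → pad (length r) r′ ≡ r × length r′ ≤ length r × Sorted r′
unpad {r = []}    s = [] , refl , z≤n , []
unpad {k} {r = x ∷ r} s with view x
... | ‵fromℕ = [] , cong (fromℕ k ∷_) (tops s) , z≤n , []
  where
  tops : ∀ {r} → Sorted (fromℕ k ∷ r) → pad (length r) [] ≡ r
  tops {[]}    _       = refl
  tops {y ∷ r} (p ∷ s) with refl ← Finₚ.≤-antisym (Finₚ.≤fromℕ y) p = cong (fromℕ k ∷_) (tops s)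
... | ‵inject₁ i with unpad (Linkedₗ.tail s)
...   | []     , e , q , s′ = i ∷ [] , cong (inject₁ i ∷_) e , s≤s q , [-]
...   | j ∷ r′ , e , q , s′ = i ∷ j ∷ r′ , cong (inject₁ i ∷_) e , s≤s q , first e q s ∷ s′
  where
  first : ∀ {r} → pad (length r) (j ∷ r′) ≡ r → suc (length r′) ≤ length r → Sorted (inject₁ i ∷ r) → i ≤ᶠ j
  first {y ∷ r} e q (p ∷ _) with refl ← proj₁ (Listₚ.∷-injective e) = inject₁-reflect {P = _≤_} p

occ-pad-inject₁ : ∀ (i : Fin k) m {r} → length r ≤ m → occᴸ (inject₁ i) (pad m r) ≡ occᴸ i r
occ-pad-inject₁ i zero    {[]} _ = refl
occ-pad-inject₁ i (suc m) {[]} _ =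
  occ-no (fromList (pad m [])) Finₚ.fromℕ≢inject₁ ∙ occ-pad-inject₁ i m z≤n
occ-pad-inject₁ i (suc m) {x ∷ r} (s≤s p) with x Finₚ.≟ i
... | yes refl = occ-yes (fromList (pad m r)) refl ∙ cong suc (occ-pad-inject₁ i m p)
... | no ne    = occ-no (fromList (pad m r)) (ne ∘ Finₚ.inject₁-injective) ∙ occ-pad-inject₁ i m p

occ-pad-fromℕ : ∀ m {r : List (Fin k)} → length r ≤ m → length r + occᴸ (fromℕ k) (pad m r) ≡ m
occ-pad-fromℕ zero    {[]} _ = refl
occ-pad-fromℕ {k} (suc m) {[]} _ =
  occ-yes {x = fromℕ k} (fromList (pad m [])) refl ∙ cong suc (occ-pad-fromℕ m {[]} z≤n)
occ-pad-fromℕ (suc m) {x ∷ r} (s≤s p) = cong suc (cong (_+_ (length r))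
  (occ-no {x = inject₁ x} (fromList (pad m r)) (Finₚ.fromℕ≢inject₁ ∘ sym)) ∙ occ-pad-fromℕ m p)

module _ {k : ℕ} where

  padRows-shape : ∀ {μ} {T : Tableau k} → map length T ⊴ μ → map length (padRows μ T) ≡ μ
  padRows-shape {[]}    {[]}    []          = refl
  padRows-shape {m ∷ μ} {r ∷ T} (row _ _ s) = cong₂ _∷_ (length-pad m r) (padRows-shape s)

  padRows-injective : ∀ {μ} {T U : Tableau k} → map length T ⊴ μ → map length U ⊴ μ →
    padRows μ T ≡ padRows μ U → T ≡ U
  padRows-injective {[]}    {[]}    {[]}    [] [] e = refl
  padRows-injective {m ∷ μ} {r ∷ T} {s ∷ U} (row _ p t) (row _ q u) e =
    let (e₁ , e₂) = Listₚ.∷-injective e in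
    cong₂ _∷_ (pad-injective m r s p q e₁) (padRows-injective t u e₂)

  padRows-semistandard : ∀ {μ} {T : Tableau k} → map length T ⊴ μ →
    Semistandard T → Semistandard (padRows μ T)
  padRows-semistandard {[]} {[]} [] _ = [] , []
  padRows-semistandard {m ∷ []} {r ∷ []} (row _ _ []) (s ∷ [] , _) = pad-sorted m s ∷ [] , [-]
  padRows-semistandard {m ∷ m′ ∷ μ} {r ∷ r′ ∷ T} (row p q t@(row _ q′ _)) (s ∷ ss , a ∷ as) =
    let (ss′ , as′) = padRows-semistandard t (ss , as) in
    pad-sorted m s ∷ ss′ , pad-above p q q′ a ∷ as′

  unpadRows : ∀ {μ} {T : Tableau (suc k)} → Linked _≥_ μ → map length T ≡ μ → Semistandard T →
    ∃ λ U → padRows μ U ≡ T × map length U ⊴ μ × Semistandard U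
  unpadRows {T = []} _ refl _ = [] , refl , [] , [] , []
  unpadRows {T = r ∷ []} _ refl (s ∷ [] , _) = let (r′ , e , q , s′) = unpad s in
    r′ ∷ [] , cong (_∷ []) e , row z≤n q [] , s′ ∷ [] , [-]
  unpadRows {T = r ∷ r₂ ∷ T} (d ∷ ds) refl (s ∷ ss , a ∷ as)
    with unpad s | unpadRows ds refl (ss , as)
  ... | r′ , e , q , s′ | r₂′ ∷ U , e′ , t@(row _ q₂ _) , ss′ , as′
    with e₁ , _ ← Listₚ.∷-injective e′ | p , a′ ← above-pad {r = r′} {r₂′} d q₂
      (subst (pad (length r) r′ Above_) (sym (proj₁ (Listₚ.∷-injective e′))) (subst (_Above r₂) (sym e) a)) =
    r′ ∷ r₂′ ∷ U , cong₂ _∷_ e e′ , row p q t , s′ ∷ ss′ , a′ ∷ as′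

  occ-padRows-inject₁ : ∀ (i : Fin k) {μ T} → map length T ⊴ μ →
    occᴸ (inject₁ i) (concat (padRows μ T)) ≡ occᴸ i (concat T)
  occ-padRows-inject₁ i {[]}    {[]}    [] = refl
  occ-padRows-inject₁ i {m ∷ μ} {r ∷ T} (row _ q t) = occᴸ-++ (inject₁ i) (pad m r) _ ∙
    (cong₂ _+_ (occ-pad-inject₁ i m q) (occ-padRows-inject₁ i t) ∙ sym (occᴸ-++ i r (concat T)))

  occ-padRows-fromℕ : ∀ {μ} {T : Tableau k} → map length T ⊴ μ →
    sum (map length T) + occᴸ (fromℕ k) (concat (padRows μ T)) ≡ sum μ
  occ-padRows-fromℕ {[]}    {[]}    [] = refl
  occ-padRows-fromℕ {m ∷ μ} {r ∷ T} (row _ q t) =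
    cong (_+_ (length r + sum (map length T))) (occᴸ-++ (fromℕ k) (pad m r) _) ∙
    (ℕ-interchange (length r) (sum (map length T)) (occᴸ (fromℕ k) (pad m r)) _ ∙
     cong₂ _+_ (occ-pad-fromℕ m {r} q) (occ-padRows-fromℕ t))
    where open import Algebra.Properties.CommutativeSemigroup ℕₚ.+-commutativeSemigroup
            using () renaming (interchange to ℕ-interchange)

-- Schur coefficients as Kostka numbers

-- The largest letter `fromℕ k` has the last entry of a content vector, while `kostka` consumes its
-- content from the head. The reversal bridges this and is undone at the end by symmetry of
-- `kostka`.
reversed : ∀ k → (Fin k → ℕ) → List ℕ
reversed zero    f = []
reversed (suc k) f = f (fromℕ k) ∷ reversed k (f ∘ inject₁)

reversed-cong : ∀ k {f g} → (∀ i → f i ≡ g i) → reversed k f ≡ reversed k g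
reversed-cong zero    e = refl
reversed-cong (suc k) e = cong₂ _∷_ (e (fromℕ k)) (reversed-cong k (e ∘ inject₁))

reversed-zero : ∀ k (f : Fin (suc k) → ℕ) → reversed (suc k) f ↭ f zero ∷ reversed k (f ∘ suc)
reversed-zero zero    f = refl
reversed-zero (suc k) f =
  trans (prep _ (reversed-zero k (f ∘ inject₁))) (swap _ _ refl)

reversed-↭ : ∀ {k} (α : Vec ℕ k) → reversed k (lookup α) ↭ toList α
reversed-↭ []      = refl
reversed-↭ (a ∷ α) = trans (reversed-zero _ (lookup (a ∷ α))) (prep a (reversed-↭ α))

IsTableau? : ∀ {k} (α : Vec ℕ k) → Decidable λ (T : Tableau k) →
  Semistandard T × content (fromList (concat T)) ≡ α
IsTableau? α T = semistandard? T ×-dec Vecₚ.≡-dec _≟_ (content (fromList (concat T))) α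

tableaux : ∀ k → List ℕ → Vec ℕ k → List (Tableau k)
tableaux k μ α = filter (IsTableau? α) (fillings k μ)

tableaux-unique : ∀ k μ α → Unique (tableaux k μ α)
tableaux-unique k μ α = Uniqueₚ.filter⁺ (IsTableau? α) (fillings-unique k μ)

sum-⊴ : ∀ {μ ν} → ν ⊴ μ → sum ν ≤ sum μ
sum-⊴ []          = z≤n
sum-⊴ (row _ q s) = +-mono-≤ q (sum-⊴ s)

⊴-decreasing : ∀ {μ ν} → ν ⊴ μ → Linked _≥_ ν
⊴-decreasing []                        = []
⊴-decreasing (row _ _ [])              = [-]
⊴-decreasing (row p _ s@(row _ q _)) = ≤-trans q p ∷ ⊴-decreasing s

-- Strips preserve the number of rows, so at k = 0 the shape may be a nonempty list of zeros; the
-- one tableau to be counted there has empty rows. For larger k the tableaux are grouped by the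
-- shape that remains without the largest letter.
schur≡kostka-reversed : ∀ k {μ} (α : Vec ℕ k) → Linked _≥_ μ → schur μ k α ≡ kostka μ (reversed k (lookup α))
schur≡kostka-reversed zero {μ} [] d with sum μ ≟ 0
... | yes z = cong +_ (bijection-length {xs = tableaux 0 μ []} {ys = μ ∷ []} (map length) (tableaux-unique 0 μ []) ([] ∷ [])
  (λ T∈ → here (fillings-shape {0} {μ} (proj₁ (∈-filter⁻ (IsTableau? []) {xs = fillings 0 μ} T∈))))
  (λ {T} {U} _ _ → shapes T U)
  λ { (here refl) → zeros μ , ∈-filter⁺ (IsTableau? []) (∈-fillings (shape z)) (semi μ , refl) , shape z })
  ∙ sym (kostka-[]-1 μ z)
  where
  empty : ∀ (r : List (Fin 0)) → r ≡ []
  empty [] = refl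
  shapes : ∀ (T U : Tableau 0) → map length T ≡ map length U → T ≡ U
  shapes []      []      e = refl
  shapes (r ∷ T) (s ∷ U) e = cong₂ _∷_ (empty r ∙ sym (empty s)) (shapes T U (proj₂ (Listₚ.∷-injective e)))
  zeros : List ℕ → Tableau 0
  zeros = map (λ _ → [])
  shape : ∀ {μ} → sum μ ≡ 0 → map length (zeros μ) ≡ μ
  shape {[]}    z = refl
  shape {m ∷ μ} z = cong₂ _∷_ (sym (ℕₚ.m+n≡0⇒m≡0 m z)) (shape (ℕₚ.m+n≡0⇒n≡0 m z))
  semi : ∀ μ → Semistandard (zeros μ)
  semi []           = [] , []
  semi (_ ∷ [])     = [] ∷ [] , [-]
  semi (_ ∷ m ∷ μ)  = let (a , b) = semi (m ∷ μ) in [] ∷ a , [] ∷ b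
... | no nz = cong +_ (bijection-length {xs = tableaux 0 μ []} {ys = []} (λ T → T) (tableaux-unique 0 μ []) []
  (λ {T} T∈ → contradiction (subst (λ ν → sum ν ≡ 0)
     (fillings-shape {0} {μ} (proj₁ (∈-filter⁻ (IsTableau? []) {xs = fillings 0 μ} T∈))) (size T)) nz)
  (λ _ _ e → e) λ ()) ∙ sym (kostka-[]-0 μ nz)
  where
  size : ∀ (T : Tableau 0) → sum (map length T) ≡ 0
  size []       = refl
  size ([] ∷ T) = size T
schur≡kostka-reversed (suc k) {μ} α d = cong +_ (sym lengths) ∙ (length-concatMap (λ ν → tableaux k ν β) (peel μ a) ∙
  ∑-cong (peel μ a) {λ ν → schur ν k β} {λ ν → kostka ν (reversed k (lookup α ∘ inject₁))} (λ {ν} ν∈ →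
    schur≡kostka-reversed k β (⊴-decreasing (proj₁ (peel-⊴ {μ} ν∈))) ∙
    cong (kostka ν) (reversed-cong k (Vecₚ.lookup∘tabulate (lookup α ∘ inject₁)))))
  where
  a = lookup α (fromℕ k)
  β = tabulate (lookup α ∘ inject₁)

  smaller : List (Tableau k)
  smaller = concatMap (λ ν → tableaux k ν β) (peel μ a)

  tableau-shape : ∀ {ν T} → T ∈ tableaux k ν β → map length T ≡ ν
  tableau-shape {ν} T∈ = fillings-shape {k} {ν} (proj₁ (∈-filter⁻ (IsTableau? β) {xs = fillings k ν} T∈))

  from : ∀ {T} → T ∈ smaller → map length T ⊴ μ × sum (map length T) + a ≡ sum μ ×
    Semistandard T × content (fromList (concat T)) ≡ β
  from T∈ with ν , ν∈ , T∈′ ← ∈-concatMap′ {xs = peel μ a} T∈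
    with refl ← tableau-shape {ν} T∈′ =
    let (s , e) = peel-⊴ {μ} ν∈ in s , e , proj₂ (∈-filter⁻ (IsTableau? β) {xs = fillings k ν} T∈′)

  to : ∀ {T} → T ∈ smaller → padRows μ T ∈ tableaux (suc k) μ α
  to {T} T∈ with s , e , ss , c ← from T∈ =
    ∈-filter⁺ (IsTableau? α) (∈-fillings (padRows-shape s))
      (padRows-semistandard s ss , occ-content {w = fromList (concat (padRows μ T))} occurs)
    where
    occurs : ∀ i → occᴸ i (concat (padRows μ T)) ≡ lookup α i
    occurs i with view i
    ... | ‵fromℕ = +-cancelˡ-≡ (sum (map length T)) _ _ (occ-padRows-fromℕ s ∙ sym e)
    ... | ‵inject₁ j = occ-padRows-inject₁ j s ∙
      (content-occ {w = fromList (concat T)} c j ∙ Vecₚ.lookup∘tabulate (lookup α ∘ inject₁) j)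

  surj : ∀ {T} → T ∈ tableaux (suc k) μ α → ∃ λ U → U ∈ smaller × padRows μ U ≡ T
  surj T∈ with T∈′ , ss , c ← ∈-filter⁻ (IsTableau? α) {xs = fillings (suc k) μ} T∈
    with U , refl , s , us ← unpadRows d (fillings-shape {suc k} {μ} T∈′) ss =
    U , ∈-concatMap (∈-peel s size) (∈-filter⁺ (IsTableau? β) (∈-fillings refl)
      (us , occ-content {w = fromList (concat U)} occurs)) , refl
    where
    cα : ∀ i → occᴸ i (concat (padRows μ U)) ≡ lookup α i
    cα = content-occ {w = fromList (concat (padRows μ U))} c
    size : sum (map length U) + a ≡ sum μ
    size = cong (_+_ (sum (map length U))) (sym (cα (fromℕ k))) ∙ occ-padRows-fromℕ s
    occurs : ∀ i → occᴸ i (concat U) ≡ lookup β i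
    occurs i = sym (occ-padRows-inject₁ i s) ∙ (cα (inject₁ i) ∙ sym (Vecₚ.lookup∘tabulate (lookup α ∘ inject₁) i))

  lengths : length smaller ≡ length (tableaux (suc k) μ α)
  lengths = bijection-length (padRows μ)
    (concatMap-unique (λ {ν} _ → tableaux-unique k ν β)
      (λ {ν} {ν′} y∈ y∈′ → sym (tableau-shape {ν} y∈) ∙ tableau-shape {ν′} y∈′) (peel-unique μ a))
    (tableaux-unique (suc k) μ α) to
    (λ x∈ y∈ → padRows-injective (proj₁ (from x∈)) (proj₁ (from y∈))) surj

schur≡kostka : ∀ k {μ} (α : Vec ℕ k) → Linked _≥_ μ → schur μ k α ≡ kostka μ (toList α)
schur≡kostka k {μ} α d = schur≡kostka-reversed k α d ∙ kostka-↭ μ (reversed-↭ α)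

-- Vanishing and reduction rules for Kostka numbers

∑-nonzero : {A : Set} (xs : List A) (f : A → ℤ) → ∑ xs f ≢ 0ℤ → ∃ λ x → x ∈ xs × f x ≢ 0ℤ
∑-nonzero []       f ne = contradiction refl ne
∑-nonzero (x ∷ xs) f ne with f x ℤₚ.≟ 0ℤ
... | no fx≢0 = x , here refl , fx≢0
... | yes fx≡0 =
  let (y , y∈ , fy≢0) = ∑-nonzero xs f (λ e → ne (cong₂ _+ᶻ_ fx≡0 e)) in y , there y∈ , fy≢0

kostka-∷ : ∀ μ a α → kostka μ (a ∷ α) ≢ 0ℤ → ∃ λ ν → ν ⊴ μ × sum ν + a ≡ sum μ × kostka ν α ≢ 0ℤ
kostka-∷ μ a α ne =
  let (ν , ν∈ , ne′) = ∑-nonzero (peel μ a) (λ ν → kostka ν α) ne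
      (s , e) = peel-⊴ {μ} ν∈ in ν , s , e , ne′

kostka-[] : ∀ μ → kostka μ [] ≢ 0ℤ → sum μ ≡ 0
kostka-[] μ ne with sum μ ≟ 0
... | yes e = e
... | no e  = contradiction (kostka-[]-0 μ e) ne

kostka-sum : ∀ μ α → kostka μ α ≢ 0ℤ → sum μ ≡ sum α
kostka-sum μ []      ne = kostka-[] μ ne
kostka-sum μ (a ∷ α) ne =
  let (ν , _ , e , ne′) = kostka-∷ μ a α ne in
  sym e ∙ (cong (_+ a) (kostka-sum ν α ne′) ∙ +-comm (sum α) a)

⊴-sum-tail : ∀ {m μ ν} → ν ⊴ m ∷ μ → sum μ ≤ sum ν
⊴-sum-tail {μ = []}    (row _ _ [])            = z≤n
⊴-sum-tail {μ = _ ∷ _} (row p _ s)             = +-mono-≤ p (⊴-sum-tail s)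

-- A horizontal strip has at most one cell in each column, and the first row counts the columns.
kostka-head : ∀ μ a α → kostka μ (a ∷ α) ≢ 0ℤ → a ≤ head₀ μ
kostka-head μ a α ne with kostka-∷ μ a α ne
... | .[] , [] , refl , _ = z≤n
... | ν , s@(row {m} {μ = μ′} _ _ _) , e , _ = ℕₚ.+-cancelˡ-≤ (sum ν) a m
  (≤-trans (≤-reflexive e) (≤-trans (+-monoʳ-≤ m (⊴-sum-tail s)) (≤-reflexive (+-comm m (sum ν)))))

-- Each row left by a strip is at least as long as the next row of the shape, so one letter removes
-- at most one row. Because of trailing zeros this is stated by the sum of the surplus rows rather
-- than by length.
kostka-drop : ∀ μ α → kostka μ α ≢ 0ℤ → sum (drop (length α) μ) ≡ 0
kostka-drop μ []            ne = kostka-[] μ ne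
kostka-drop []      (a ∷ α) ne = refl
kostka-drop (m ∷ μ) (a ∷ α) ne =
  let (ν , s , _ , ne′) = kostka-∷ (m ∷ μ) a α ne in
  ℕₚ.n≤0⇒n≡0 (≤-trans (tails (length α) s) (≤-reflexive (kostka-drop ν α ne′)))
  where
  tails : ∀ l {m μ ν} → ν ⊴ m ∷ μ → sum (drop l μ) ≤ sum (drop l ν)
  tails zero                  s           = ⊴-sum-tail s
  tails (suc l) {μ = []}      s           = z≤n
  tails (suc l) {μ = _ ∷ _}   (row _ _ s) = tails l s

kostka-length : ∀ μ α → All (0 <_) μ → kostka μ α ≢ 0ℤ → length μ ≤ length α
kostka-length μ α pos ne = go (length α) μ pos (kostka-drop μ α ne)
  where
  go : ∀ l μ → All (0 <_) μ → sum (drop l μ) ≡ 0 → length μ ≤ l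
  go l       []      _         e = z≤n
  go zero    (m ∷ μ) (p ∷ _)   e = contradiction (subst (0 <_) (ℕₚ.m+n≡0⇒m≡0 m e) p) λ ()
  go (suc l) (m ∷ μ) (_ ∷ pos) e = s≤s (go l μ pos e)

sum-∷ʳ : ∀ μ x → sum (μ ∷ʳ x) ≡ sum μ + x
sum-∷ʳ []      x = +-identityʳ x
sum-∷ʳ (m ∷ μ) x = cong (_+_ m) (sum-∷ʳ μ x) ∙ sym (+-assoc m (sum μ) x)

sum-∷ʳ0 : ∀ μ → sum (μ ∷ʳ 0) ≡ sum μ
sum-∷ʳ0 μ = sum-∷ʳ μ 0 ∙ +-identityʳ (sum μ)

head₀-∷ʳ0 : ∀ μ → head₀ (μ ∷ʳ 0) ≡ head₀ μ
head₀-∷ʳ0 []      = refl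
head₀-∷ʳ0 (_ ∷ _) = refl

⊴-∷ʳ0 : ∀ {μ ν} → ν ⊴ μ → ν ∷ʳ 0 ⊴ μ ∷ʳ 0
⊴-∷ʳ0 []                  = row z≤n z≤n []
⊴-∷ʳ0 (row {μ = μ} p q s) = row (≤-trans (≤-reflexive (head₀-∷ʳ0 μ)) p) q (⊴-∷ʳ0 s)

∷ʳ0-⊴ : ∀ μ {ν} → ν ⊴ μ ∷ʳ 0 → ∃ λ ν′ → ν′ ∷ʳ 0 ≡ ν × ν′ ⊴ μ
∷ʳ0-⊴ []      (row z≤n z≤n []) = [] , refl , []
∷ʳ0-⊴ (m ∷ μ) (row {n = n} p q s) =
  let (ν , e , s′) = ∷ʳ0-⊴ μ s in
  n ∷ ν , cong (n ∷_) e , row (≤-trans (≤-reflexive (sym (head₀-∷ʳ0 μ))) p) q s′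

-- Removing a full row by a strip leaves a trailing zero, which has to be discarded before the
-- recursion can continue with the shorter shape.
kostka-∷ʳ0 : ∀ μ α → kostka (μ ∷ʳ 0) α ≡ kostka μ α
kostka-∷ʳ0 μ [] rewrite sum-∷ʳ0 μ = refl
kostka-∷ʳ0 μ (a ∷ α) = sym (∑-bijection {g = λ ν → kostka ν α} {h = λ ν → kostka ν α} (_∷ʳ 0)
  (peel-unique μ a) (peel-unique (μ ∷ʳ 0) a)
  (λ {ν} ν∈ → let (s , e) = peel-⊴ {μ} ν∈ in
    ∈-peel (⊴-∷ʳ0 s) (cong (_+ a) (sum-∷ʳ0 ν) ∙ (e ∙ sym (sum-∷ʳ0 μ))))
  (λ {ν} {ν′} _ _ → Listₚ.∷ʳ-injectiveˡ ν ν′)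
  (λ ν∈ → let (s , e) = peel-⊴ {μ ∷ʳ 0} ν∈ ; (ν′ , e′ , s′) = ∷ʳ0-⊴ μ s in
    ν′ , ∈-peel s′ (cong (_+ a) (sym (sum-∷ʳ0 ν′) ∙ cong sum e′) ∙ (e ∙ sum-∷ʳ0 μ)) , e′)
  (λ {ν} _ → sym (kostka-∷ʳ0 ν α)))

⊴-tail : ∀ {m μ} → Linked _≥_ (m ∷ μ) → μ ∷ʳ 0 ⊴ m ∷ μ
⊴-tail [-]     = row z≤n z≤n []
⊴-tail (p ∷ d) = row ≤-refl p (⊴-tail d)

+-squeeze : ∀ {a b c d} → a ≤ c → b ≤ d → c + d ≡ a + b → c ≡ a × d ≡ b
+-squeeze {a} {b} {c} {d} p q e =
  ≤-antisym (ℕₚ.+-cancelʳ-≤ b c a (≤-trans (+-monoʳ-≤ c q) (≤-reflexive e))) p ,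
  ≤-antisym (ℕₚ.+-cancelˡ-≤ a d b (≤-trans (+-monoˡ-≤ d p) (≤-reflexive e))) q

⊴-tail-unique : ∀ {m μ ν} → ν ⊴ m ∷ μ → sum ν ≡ sum μ → ν ≡ μ ∷ʳ 0
⊴-tail-unique {μ = []}    (row {n = n} _ _ []) e = cong (_∷ []) (sym (+-identityʳ n) ∙ e)
⊴-tail-unique {μ = _ ∷ _} (row p _ s) e =
  let (e₁ , e₂) = +-squeeze p (⊴-sum-tail s) e in cong₂ _∷_ e₁ (⊴-tail-unique s e₂)

-- A horizontal strip of size μ₁ in μ meets every column, hence is unique.
kostka-first-row : ∀ {m μ} α → Linked _≥_ (m ∷ μ) → kostka (m ∷ μ) (m ∷ α) ≡ kostka μ α
kostka-first-row {m} {μ} α d =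
  ∑-single {f = λ ν → kostka ν α} (peel-unique (m ∷ μ) m)
    (∈-peel (⊴-tail d) (cong (_+ m) (sum-∷ʳ0 μ) ∙ +-comm (sum μ) m))
    (λ {ν} ν∈ ne → let (s , e) = peel-⊴ {m ∷ μ} ν∈ in contradiction
      (⊴-tail-unique s (+-cancelʳ-≡ m (sum ν) (sum μ) (e ∙ +-comm m (sum μ)))) ne)
  ∙ kostka-∷ʳ0 μ α

kostka-diagonal : ∀ {μ} → Linked _≥_ μ → kostka μ μ ≡ 1ℤ
kostka-diagonal {[]}    d = refl
kostka-diagonal {m ∷ μ} d = kostka-first-row μ d ∙ kostka-diagonal (Linkedₗ.tail d)

module _ {x : ℕ} where

  ⊴-last : ∀ μ {ν} → ν ⊴ μ ∷ʳ x → sum (drop (length μ) ν) ≡ 0 → sum ν ≤ sum μ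
  ⊴-last []      s           e = ≤-reflexive e
  ⊴-last (m ∷ μ) (row _ q s) e = +-mono-≤ q (⊴-last μ s e)

  ⊴-last-unique : ∀ μ {ν} → ν ⊴ μ ∷ʳ x → sum (drop (length μ) ν) ≡ 0 → sum ν ≡ sum μ → ν ≡ μ ∷ʳ 0
  ⊴-last-unique []      (row {n = n} _ _ []) e _ = cong (_∷ []) (sym (+-identityʳ n) ∙ e)
  ⊴-last-unique (m ∷ μ) (row _ q s)          e e′ =
    let (e₁ , e₂) = +-squeeze q (⊴-last μ s e) (sym e′) in cong₂ _∷_ (sym e₁) (⊴-last-unique μ s e (sym e₂))

  ⊴-remove-last : ∀ μ → Linked _≥_ (μ ∷ʳ x) → μ ∷ʳ 0 ⊴ μ ∷ʳ x
  ⊴-remove-last []           d       = row z≤n z≤n []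
  ⊴-remove-last (m ∷ [])     (p ∷ d) = row p ≤-refl (⊴-remove-last [] d)
  ⊴-remove-last (m ∷ m′ ∷ μ) (p ∷ d) = row p ≤-refl (⊴-remove-last (m′ ∷ μ) d)

  -- With as many rows as letters, the last row contains only the last letter.
  kostka-last-row : ∀ {μ} α → length μ ≡ length α → Linked _≥_ (μ ∷ʳ x) →
    kostka (μ ∷ʳ x) (x ∷ α) ≡ kostka μ α
  kostka-last-row {μ} α l d =
    ∑-single {f = λ ν → kostka ν α} (peel-unique (μ ∷ʳ x) x)
      (∈-peel (⊴-remove-last μ d) (cong (_+ x) (sum-∷ʳ0 μ) ∙ sym (sum-∷ʳ μ x)))
      (λ {ν} ν∈ ne → zero-unless ν (peel-⊴ {μ ∷ʳ x} ν∈) ne)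
    ∙ kostka-∷ʳ0 μ α
    where
    zero-unless : ∀ ν → ν ⊴ μ ∷ʳ x × sum ν + x ≡ sum (μ ∷ʳ x) → ν ≢ μ ∷ʳ 0 → kostka ν α ≡ 0ℤ
    zero-unless ν (s , e) ne with kostka ν α ℤₚ.≟ 0ℤ
    ... | yes z = z
    ... | no nz = contradiction (⊴-last-unique μ s
      (subst (λ l → sum (drop l ν) ≡ 0) (sym l) (kostka-drop ν α nz))
      (+-cancelʳ-≡ x (sum ν) (sum μ) (e ∙ sum-∷ʳ μ x))) ne

linked-init : ∀ μ {x} → Linked _≥_ (μ ∷ʳ x) → Linked _≥_ μ
linked-init []          d       = []
linked-init (_ ∷ [])    d       = [-]
linked-init (_ ∷ _ ∷ μ) (p ∷ d) = p ∷ linked-init (_ ∷ μ) d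

replicate-∷ʳ : ∀ s (x : ℕ) → replicate (suc s) x ≡ replicate s x ∷ʳ x
replicate-∷ʳ zero    x = refl
replicate-∷ʳ (suc s) x = cong (x ∷_) (replicate-∷ʳ s x)

-- Symmetry brings one x to the front of the content, where it can only fill the last row. With x =
-- 1 this makes the matrix of the final linear system independent of t.
kostka-last-rows : ∀ μ α x s → length μ ≡ length α → Linked _≥_ (μ ++ replicate s x) →
  kostka (μ ++ replicate s x) (α ++ replicate s x) ≡ kostka μ α
kostka-last-rows μ α x zero    l d =
  cong₂ kostka (Listₚ.++-identityʳ μ) (Listₚ.++-identityʳ α)
kostka-last-rows μ α x (suc s) l d = begin
  kostka (μ ++ replicate (suc s) x) (α ++ replicate (suc s) x)
    ≡⟨ kostka-↭ (μ ++ replicate (suc s) x) (shift x α (replicate s x)) ⟩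
  kostka (μ ++ replicate (suc s) x) (x ∷ α ++ replicate s x)
    ≡⟨ cong (λ ν → kostka ν (x ∷ α ++ replicate s x)) (grow μ) ⟩
  kostka ((μ ++ replicate s x) ∷ʳ x) (x ∷ α ++ replicate s x)
    ≡⟨ kostka-last-row (α ++ replicate s x)
        (Listₚ.length-++ μ ∙ (cong (_+ _) l ∙ sym (Listₚ.length-++ α))) d′ ⟩
  kostka (μ ++ replicate s x) (α ++ replicate s x)
    ≡⟨ kostka-last-rows μ α x s l (linked-init (μ ++ replicate s x) d′) ⟩
  kostka μ α ∎
  where
  open ≡-Reasoning
  grow : ∀ μ → μ ++ replicate (suc s) x ≡ (μ ++ replicate s x) ∷ʳ x
  grow μ = cong (μ ++_) (replicate-∷ʳ s x) ∙ sym (Listₚ.++-assoc μ (replicate s x) (x ∷ []))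
  d′ : Linked _≥_ ((μ ++ replicate s x) ∷ʳ x)
  d′ = subst (Linked _≥_) (grow μ) d

-- The decreasing lexicographic order on lists of at most L numbers from 0 to n,
-- read as numbers in base n + 1.
rank : ℕ → ℕ → List ℕ → ℕ
rank n zero    μ       = 0
rank n (suc L) []      = 0
rank n (suc L) (m ∷ μ) = (n ∸ m) * suc n ^ L + rank n L μ

rank-bound : ∀ n L μ → rank n L μ < suc n ^ L
rank-bound n zero    μ       = s≤s z≤n
rank-bound n (suc L) []      = ℕₚ.m^n>0 (suc n) (suc L)
rank-bound n (suc L) (m ∷ μ) = <-≤-trans (ℕₚ.+-monoʳ-< ((n ∸ m) * suc n ^ L) (rank-bound n L μ))
  (≤-trans (≤-reflexive (+-comm _ (suc n ^ L))) (ℕₚ.*-monoˡ-≤ (suc n ^ L) (s≤s (ℕₚ.m∸n≤m n m))))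

-- The first part of ν is at most that of μ. If it is smaller, the leading digit already decides, as
-- the remaining digits stay below one unit of it. If they agree, `kostka-first-row` removes both
-- and induction applies.
kostka-triangular : ∀ n L {μ ν} → Linked _≥_ μ → All (0 <_) μ → All (0 <_) ν → All (_≤ n) μ → length ν ≤ L →
  kostka μ ν ≢ 0ℤ → μ ≡ ν ⊎ rank n L μ < rank n L ν
kostka-triangular n L {[]}    {[]}    d p q b l ne = inj₁ refl
kostka-triangular n L {m ∷ μ} {[]}    d (p ∷ _) q b l ne =
  contradiction (subst (0 <_) (ℕₚ.m+n≡0⇒m≡0 m (kostka-sum (m ∷ μ) [] ne)) p) λ ()
kostka-triangular n L {[]}    {a ∷ ν} d p (q ∷ _) b l ne =
  contradiction (subst (0 <_) (ℕₚ.m+n≡0⇒m≡0 a (sym (kostka-sum [] (a ∷ ν) ne))) q) λ ()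
kostka-triangular n (suc L) {m ∷ μ} {a ∷ ν} d (_ ∷ p) (_ ∷ q) (b ∷ bs) (s≤s l) ne
  with m≤n⇒m<n∨m≡n (kostka-head (m ∷ μ) a ν ne)
... | inj₁ a<m = inj₂ (<-≤-trans (ℕₚ.+-monoʳ-< ((n ∸ m) * suc n ^ L) (rank-bound n L μ))
  (≤-trans (≤-reflexive (+-comm _ (suc n ^ L)))
  (≤-trans (ℕₚ.*-monoˡ-≤ (suc n ^ L) (ℕₚ.∸-monoʳ-< a<m b)) (m≤m+n _ (rank n L ν)))))
... | inj₂ refl with kostka-triangular n L (Linkedₗ.tail d) p q bs l (ne ∘ (kostka-first-row ν d ∙_))
...   | inj₁ e = inj₁ (cong (m ∷_) e)
...   | inj₂ r = inj₂ (ℕₚ.+-monoʳ-< ((n ∸ m) * suc n ^ L) r)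

-- Partitions of a fixed size

infix 4 _⊢_
_⊢_ : List ℕ → ℕ → Set
μ ⊢ n = IsPartitionOf n μ

decreasing : ∀ {μ n} → μ ⊢ n → Linked _≥_ μ
decreasing = proj₁ ∘ proj₂

positive : ∀ {μ n} → μ ⊢ n → All (0 <_) μ
positive = proj₂ ∘ proj₂

parts≤sum : ∀ μ → All (_≤ sum μ) μ
parts≤sum []      = []
parts≤sum (m ∷ μ) = m≤m+n m (sum μ) ∷ Allₗ.map (λ q → ≤-trans q (m≤n+m (sum μ) m)) (parts≤sum μ)

length≤sum : ∀ {μ} → All (0 <_) μ → length μ ≤ sum μ
length≤sum []       = z≤n
length≤sum (p ∷ ps) = +-mono-≤ p (length≤sum ps)

partitions-⊢ : ∀ {n μ} → μ ∈ partitions n → μ ⊢ n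
partitions-⊢ {n} μ∈ = proj₂ (∈-filter⁻ (isPartitionOf? n)
  {xs = concatMap (λ ℓ → map toList (words (map suc (upTo n)) ℓ)) (upTo (suc n))} μ∈)

∈-partitions : ∀ {n μ} → μ ⊢ n → μ ∈ partitions n
∈-partitions {μ = μ} p@(refl , _ , pos) = ∈-filter⁺ (isPartitionOf? (sum μ))
  (∈-concatMap {f = λ ℓ → map toList (words (map suc (upTo (sum μ))) ℓ)} (∈-upTo⁺ (s≤s (length≤sum pos)))
    (subst (_∈ map toList (words (map suc (upTo (sum μ))) (length μ))) (Vecₚ.toList∘fromList μ)
      (∈-map⁺ toList (∈-words (fromList μ)
        (subst (All (_∈ map suc (upTo (sum μ)))) (sym (Vecₚ.toList∘fromList μ)) (entries pos (parts≤sum μ)))))))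
  p
  where
  entries : ∀ {n μ} → All (0 <_) μ → All (_≤ n) μ → All (_∈ map suc (upTo n)) μ
  entries []             []       = []
  entries (s≤s z≤n ∷ ps) (q ∷ qs) = ∈-map⁺ suc (∈-upTo⁺ q) ∷ entries ps qs

partitions-unique : ∀ n → Unique (partitions n)
partitions-unique n = Uniqueₚ.filter⁺ (isPartitionOf? n) (concatMap-unique
  (λ {ℓ} _ → Uniqueₚ.map⁺ (λ {v} {w} → toList-injective v w)
    (words-unique (Uniqueₚ.map⁺ suc-injective (Uniqueₚ.upTo⁺ n)) ℓ))
  (λ y∈ y∈′ → lengths y∈ ∙ sym (lengths y∈′)) (Uniqueₚ.upTo⁺ (suc n)))
  where
  lengths : ∀ {ℓ μ} → μ ∈ map toList (words (map suc (upTo n)) ℓ) → ℓ ≡ length μ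
  lengths {ℓ} μ∈ with w , _ , refl ← ∈-map⁻ toList {xs = words (map suc (upTo n)) ℓ} μ∈ =
    sym (Vecₚ.length-toList w)

order : ℕ → List ℕ → ℕ
order n = rank n n

order-bound : ∀ n μ → order n μ < suc n ^ n
order-bound n = rank-bound n n

partition-triangular : ∀ {n μ ν} → μ ⊢ n → ν ⊢ n → kostka μ ν ≢ 0ℤ → μ ≡ ν ⊎ order n μ < order n ν
partition-triangular {n} {μ} (refl , d , p) (e , _ , q) =
  kostka-triangular n n d p q (parts≤sum μ) (≤-trans (length≤sum q) (≤-reflexive e))

-- Symmetric series

⊴-full : ∀ {μ ν} → ν ⊴ μ → sum ν ≡ sum μ → ν ≡ μ
⊴-full []          e = refl
⊴-full (row _ q s) e =
  let (e₁ , e₂) = +-squeeze q (sum-⊴ s) (sym e) in cong₂ _∷_ (sym e₁) (⊴-full s (sym e₂))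

⊴-refl : ∀ {μ} → Linked _≥_ μ → μ ⊴ μ
⊴-refl []      = []
⊴-refl [-]     = row z≤n ≤-refl []
⊴-refl (p ∷ d) = row p ≤-refl (⊴-refl d)

kostka-0∷ : ∀ {μ} α → Linked _≥_ μ → kostka μ (0 ∷ α) ≡ kostka μ α
kostka-0∷ {μ} α d = ∑-single {f = λ ν → kostka ν α} (peel-unique μ 0) (∈-peel (⊴-refl d) (+-identityʳ (sum μ)))
  (λ {ν} ν∈ ne → let (s , e) = peel-⊴ {μ} ν∈ in
    contradiction (⊴-full s (sym (+-identityʳ (sum ν)) ∙ e)) ne)

-- A coefficient of a symmetric series depends only on the multiset of nonzero exponents. Reading
-- exponents as a list removes the number of variables from the type.
record IsSymmetric (F : Series) (f : List ℕ → ℤ) : Set where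
  field
    value : ∀ {k} (α : Vec ℕ k) → F k α ≡ f (toList α)
    perm  : ∀ {α β} → α ↭ β → f α ≡ f β
    drop₀ : ∀ α → f (0 ∷ α) ≡ f α

positiveParts : List ℕ → List ℕ
positiveParts = filter (0 <?_)

split-zeros : ∀ α → ∃ λ z → α ↭ replicate z 0 ++ positiveParts α
split-zeros []          = 0 , refl
split-zeros (zero  ∷ α) = let (z , p) = split-zeros α in suc z , prep 0 p
split-zeros (suc a ∷ α) = let (z , p) = split-zeros α in
  z , trans (prep (suc a) p) (↭-sym (shift (suc a) (replicate z 0) (positiveParts α)))

partition-of : List ℕ → List ℕ
partition-of α = sort (decTotalOrder ℕₚ.≤-decTotalOrder) (positiveParts α)

split-partition : ∀ α → ∃ λ z → α ↭ replicate z 0 ++ partition-of α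
split-partition α = let (z , p) = split-zeros α in
  z , trans p (++⁺ˡ (replicate z 0) (↭-sym (sort-↭ (decTotalOrder ℕₚ.≤-decTotalOrder) (positiveParts α))))

sum-zeros : ∀ z μ → sum (replicate z 0 ++ μ) ≡ sum μ
sum-zeros zero    μ = refl
sum-zeros (suc z) μ = sum-zeros z μ

partition-of-⊢ : ∀ α → partition-of α ⊢ sum α
partition-of-⊢ α =
  (let (z , p) = split-partition α in sym (sum-↭ p ∙ sum-zeros z (partition-of α))) ,
  sort-↗ (decTotalOrder ℕₚ.≤-decTotalOrder) (positiveParts α) ,
  All-resp-↭ (↭-sym (sort-↭ (decTotalOrder ℕₚ.≤-decTotalOrder) (positiveParts α)))
    (Allₚ.all-filter (0 <?_) α)

module _ {f : List ℕ → ℤ} (drop₀ : ∀ α → f (0 ∷ α) ≡ f α) where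

  drop-zeros : ∀ z α → f (replicate z 0 ++ α) ≡ f α
  drop-zeros zero    α = refl
  drop-zeros (suc z) α = drop₀ (replicate z 0 ++ α) ∙ drop-zeros z α

  to-partition : (∀ {α β} → α ↭ β → f α ≡ f β) → ∀ α → f α ≡ f (partition-of α)
  to-partition perm α = let (z , p) = split-partition α in perm p ∙ drop-zeros z (partition-of α)

Expands : (List ℕ → ℤ) → (List ℕ → ℤ) → List ℕ → Set
Expands f c α = f α ≡ ∑ (partitions (sum α)) λ μ → c μ *ᶻ kostka μ α

module _ {F f} (sym-F : IsSymmetric F f) where
  open IsSymmetric sym-F

  private
    sumᵛ≡sum : ∀ {k} (α : Vec ℕ k) → sumᵛ α ≡ sum (toList α)
    sumᵛ≡sum []      = refl
    sumᵛ≡sum (a ∷ α) = cong (_+_ a) (sumᵛ≡sum α)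

    schur-sum : ∀ (c : List ℕ → ℤ) {k} (α : Vec ℕ k) → ∑ (partitions (sumᵛ α)) (λ μ → c μ *ᶻ schur μ k α) ≡
      ∑ (partitions (sum (toList α))) (λ μ → c μ *ᶻ kostka μ (toList α))
    schur-sum c {k} α = cong (λ n → ∑ (partitions n) (λ μ → c μ *ᶻ schur μ k α)) (sumᵛ≡sum α) ∙
      ∑-cong (partitions (sum (toList α))) {λ μ → c μ *ᶻ schur μ k α} {λ μ → c μ *ᶻ kostka μ (toList α)}
        (λ {μ} μ∈ → cong (c μ *ᶻ_) (schur≡kostka k α (decreasing {μ} (partitions-⊢ {sum (toList α)} μ∈))))

  expansion⇒ : ∀ {c} → IsSchurExpansion F c → ∀ α → Expands f c α
  expansion⇒ {c} ex α = subst (Expands f c) (Vecₚ.toList∘fromList α)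
    (sym (value (fromList α)) ∙ (ex (length α) (fromList α) ∙ schur-sum c (fromList α)))

  -- Both sides of the equation are unchanged when exponents are permuted or zeros are deleted, so
  -- each content may be replaced by its partition.
  ⇒expansion : ∀ {c} → (∀ {n μ} → μ ⊢ n → Expands f c μ) → IsSchurExpansion F c
  ⇒expansion {c} ex k α = value α ∙ (to-partition drop₀ perm β ∙ (ex (partition-of-⊢ β) ∙
    (cong (λ n → ∑ (partitions n) (λ μ → c μ *ᶻ kostka μ (partition-of β))) (proj₁ (partition-of-⊢ β)) ∙
    (∑-cong (partitions (sum β)) {λ μ → c μ *ᶻ kostka μ (partition-of β)} {λ μ → c μ *ᶻ kostka μ β}
      (λ {μ} μ∈ → cong (c μ *ᶻ_) (sym (partition-content μ (decreasing {μ} (partitions-⊢ {sum β} μ∈))))) ∙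
    sym (schur-sum c α)))))
    where
    β = toList α
    partition-content : ∀ μ → Linked _≥_ μ → kostka μ β ≡ kostka μ (partition-of β)
    partition-content μ d = to-partition (λ α → kostka-0∷ α d) (kostka-↭ μ) β

-- The coefficients at the partitions of order N are corrected in step N; by
-- triangularity this does not disturb the equations of smaller order.
module _ (f : List ℕ → ℤ) (n : ℕ) where

  private
    ps = partitions n

    S : (List ℕ → ℤ) → List ℕ → ℤ
    S c ν = ∑ ps λ μ → c μ *ᶻ kostka μ ν

    solve : ∀ N → ∃ λ c → ∀ {ν} → ν ⊢ n → order n ν < N → f ν ≡ S c ν
    solve zero    = (λ _ → 0ℤ) , λ _ ()
    solve (suc N) with c , eq ← solve N = c′ , eq′
      where
      δ : List ℕ → ℤ
      δ μ with order n μ ≟ N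
      ... | yes _ = f μ -ᶻ S c μ
      ... | no  _ = 0ℤ

      δ-hit : ∀ {μ} → order n μ ≡ N → δ μ ≡ f μ -ᶻ S c μ
      δ-hit {μ} e with order n μ ≟ N
      ... | yes _ = refl
      ... | no ne = contradiction e ne

      c′ : List ℕ → ℤ
      c′ μ = c μ +ᶻ δ μ

      correction : List ℕ → List ℕ → ℤ
      correction ν μ = δ μ *ᶻ kostka μ ν

      split : ∀ ν → S c′ ν ≡ S c ν +ᶻ ∑ ps (correction ν)
      split ν = ∑-cong ps {λ μ → c′ μ *ᶻ kostka μ ν} {λ μ → c μ *ᶻ kostka μ ν +ᶻ correction ν μ}
        (λ {μ} _ → ℤₚ.*-distribʳ-+ (kostka μ ν) (c μ) (δ μ)) ∙ ∑-+ ps (λ μ → c μ *ᶻ kostka μ ν) (correction ν)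

      off-diagonal : ∀ {ν μ} → ν ⊢ n → order n ν < suc N → μ ∈ ps →
        (order n μ ≡ N → μ ≢ ν) → correction ν μ ≡ 0ℤ
      off-diagonal {ν} {μ} pν (s≤s le) μ∈ ne with order n μ ≟ N
      ... | no _  = ℤₚ.*-zeroˡ (kostka μ ν)
      ... | yes e with kostka μ ν ℤₚ.≟ 0ℤ
      ...   | yes z = cong ((f μ -ᶻ S c μ) *ᶻ_) z ∙ ℤₚ.*-zeroʳ (f μ -ᶻ S c μ)
      ...   | no nz with partition-triangular (partitions-⊢ μ∈) pν nz
      ...     | inj₁ e′ = contradiction e′ (ne e)
      ...     | inj₂ lt = contradiction (≤-trans lt (≤-trans le (≤-reflexive (sym e)))) (<-irrefl refl)

      eq′ : ∀ {ν} → ν ⊢ n → order n ν < suc N → f ν ≡ S c′ ν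
      eq′ {ν} p lt with order n ν ≟ N
      ... | yes e = sym (split ν ∙ (cong (S c ν +ᶻ_)
        (∑-single {f = correction ν} (partitions-unique n) (∈-partitions p)
          (λ μ∈ ne → off-diagonal p lt μ∈ (λ _ → ne)) ∙
         (cong₂ _*ᶻ_ (δ-hit e) (kostka-diagonal (decreasing {ν} p)) ∙ ℤₚ.*-identityʳ (f ν -ᶻ S c ν)))
        ∙ cancel (S c ν) (f ν)))
        where
        cancel : ∀ a b → a +ᶻ (b -ᶻ a) ≡ b
        cancel a b = cong (a +ᶻ_) (ℤₚ.+-comm b (- a)) ∙ (sym (ℤₚ.+-assoc a (- a) b) ∙
          (cong (_+ᶻ b) (ℤₚ.+-inverseʳ a) ∙ ℤₚ.+-identityˡ b))
      ... | no ne = eq p (ℕₚ.≤∧≢⇒< (≤-pred lt) ne) ∙ sym (split ν ∙ (cong (S c ν +ᶻ_)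
        (∑-zero ps {correction ν} (λ μ∈ → off-diagonal p lt μ∈ λ { e refl → ne e })) ∙ ℤₚ.+-identityʳ (S c ν)))

  coefficients : List ℕ → ℤ
  -- By `order-bound` this exceeds the order of every partition of n, so all equations are solved.
  coefficients = proj₁ (solve (suc n ^ n))

  coefficients-expand : ∀ {ν} → ν ⊢ n → f ν ≡ S coefficients ν
  coefficients-expand {ν} p = proj₂ (solve (suc n ^ n)) p (order-bound n ν)

schur-expansion : ∀ {F f} → IsSymmetric F f → ∃ (IsSchurExpansion F)
schur-expansion {f = f} s = c , ⇒expansion s {c} expand
  where
  -- Equations of different sizes have no unknown in common, so the solutions for the separate n are
  -- glued along `sum μ`.
  c : List ℕ → ℤ
  c μ = coefficients f (sum μ) μ

  expand : ∀ {n ν} → ν ⊢ n → Expands f c ν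
  expand {ν = ν} (_ , p) = coefficients-expand f (sum ν) {ν} (refl , p) ∙
    ∑-cong (partitions (sum ν)) {λ μ → coefficients f (sum ν) μ *ᶻ kostka μ ν} {λ μ → c μ *ᶻ kostka μ ν}
      (λ {μ} μ∈ → cong (λ n → coefficients f n μ *ᶻ kostka μ ν) (sym (proj₁ (partitions-⊢ {sum ν} μ∈))))

-- The set U is closed under passing from a content to the shapes that contribute to it. In the
-- equation at ν, the other shapes contributing have smaller order and lie in U, so by induction
-- their coefficients vanish; the diagonal Kostka number 1 leaves c ν = f ν = 0.
coefficients-vanish : ∀ {f c n} (U : List ℕ → Set) →
  (∀ {ν} → ν ⊢ n → Expands f c ν) →
  (∀ {ν} → ν ⊢ n → U ν → f ν ≡ 0ℤ) →
  (∀ {μ ν} → μ ⊢ n → U ν → kostka μ ν ≢ 0ℤ → U μ) →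
  ∀ {ν} → ν ⊢ n → U ν → c ν ≡ 0ℤ
coefficients-vanish {f} {c} {n} U ex van up {ν} p u = go (suc n ^ n) p u (order-bound n ν)
  where
  go : ∀ N {ν} → ν ⊢ n → U ν → order n ν < N → c ν ≡ 0ℤ
  go (suc N) {ν} p u (s≤s lt) = sym (ℤₚ.*-identityʳ (c ν)) ∙
    (cong (c ν *ᶻ_) (sym (kostka-diagonal (decreasing {ν} p))) ∙
    (sym (∑-single {f = term} (partitions-unique n) (∈-partitions p) others) ∙
    (cong (λ n → ∑ (partitions n) term) (sym (proj₁ p)) ∙ (sym (ex p) ∙ van p u))))
    where
    term : List ℕ → ℤ
    term μ = c μ *ᶻ kostka μ ν
    others : ∀ {μ} → μ ∈ partitions n → μ ≢ ν → term μ ≡ 0ℤ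
    others {μ} μ∈ ne with kostka μ ν ℤₚ.≟ 0ℤ
    ... | yes z = cong (c μ *ᶻ_) z ∙ ℤₚ.*-zeroʳ (c μ)
    ... | no nz with partition-triangular (partitions-⊢ μ∈) p nz
    ...   | inj₁ e  = contradiction e ne
    ...   | inj₂ l = cong (_*ᶻ kostka μ ν) (go N (partitions-⊢ μ∈) (up (partitions-⊢ μ∈) u nz) (≤-trans l lt))
      ∙ ℤₚ.*-zeroˡ (kostka μ ν)

-- Symmetry of the chromatic series

HasColouring? : (G : Graph (Fin n)) (α : Vec ℕ k) → Decidable λ κ → Proper G κ × content κ ≡ α
HasColouring? G α κ = proper? G κ ×-dec Vecₚ.≡-dec _≟_ (content κ) α

colourings : Graph (Fin n) → ∀ k → Vec ℕ k → List (Vec (Fin k) n)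
colourings {n} G k α = filter (HasColouring? G α) (allWords n k)

colourings-unique : ∀ (G : Graph (Fin n)) k α → Unique (colourings G k α)
colourings-unique {n} G k α = Uniqueₚ.filter⁺ (HasColouring? G α) (allWords-unique n k)

∈-colourings : ∀ (G : Graph (Fin n)) {α : Vec ℕ k} {κ} →
  Proper G κ → (∀ i → occ i κ ≡ lookup α i) → κ ∈ colourings G k α
∈-colourings G {α} {κ} p e = ∈-filter⁺ (HasColouring? G α) (∈-allWords κ) (p , occ-content {w = κ} e)

colourings-∈ : ∀ (G : Graph (Fin n)) {α : Vec ℕ k} {κ} →
  κ ∈ colourings G k α → Proper G κ × ∀ i → occ i κ ≡ lookup α i
colourings-∈ {n = n} {k} G {α} {κ} κ∈ =
  let (_ , p , c) = ∈-filter⁻ (HasColouring? G α) {xs = allWords n k} κ∈ in p , content-occ {w = κ} c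

occ-map : ∀ {f : Fin k → Fin l} → (∀ {i j} → f i ≡ f j → i ≡ j) →
  ∀ i (κ : Vec (Fin k) n) → occ (f i) (mapᵛ f κ) ≡ occ i κ
occ-map inj i []      = refl
occ-map {f = f} inj i (x ∷ κ) with x Finₚ.≟ i
... | yes refl = occ-yes (mapᵛ f κ) refl ∙ cong suc (occ-map inj i κ)
... | no ne    = occ-no (mapᵛ f κ) (ne ∘ inj) ∙ occ-map inj i κ

map-injective : ∀ {f : Fin k → Fin l} → (∀ {i j} → f i ≡ f j → i ≡ j) →
  ∀ {v w : Vec (Fin k) n} → mapᵛ f v ≡ mapᵛ f w → v ≡ w
map-injective inj {[]}    {[]}    e = refl
map-injective inj {_ ∷ v} {_ ∷ w} e =
  let (p , q) = Vecₚ.∷-injective e in cong₂ _∷_ (inj p) (map-injective inj q)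

proper-map : ∀ (G : Graph (Fin n)) {f : Fin k → Fin l} κ → (∀ {i j} → f i ≡ f j → i ≡ j) →
  Proper G κ → Proper G (mapᵛ f κ)
proper-map G {f} κ inj p u v u~v e =
  p u v u~v (inj (sym (Vecₚ.lookup-map u f κ) ∙ (e ∙ Vecₚ.lookup-map v f κ)))

proper-map⁻ : ∀ (G : Graph (Fin n)) (f : Fin k → Fin l) κ → Proper G (mapᵛ f κ) → Proper G κ
proper-map⁻ G f κ p u v u~v e =
  p u v u~v (Vecₚ.lookup-map u f κ ∙ (cong f e ∙ sym (Vecₚ.lookup-map v f κ)))

module _ (G : Graph (Fin n)) where

  X-reindex : (π : Fin k ↔ Fin l) {α : Vec ℕ k} {β : Vec ℕ l} →
    (∀ i → lookup α i ≡ lookup β (Inverse.to π i)) → X G k α ≡ X G l β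
  X-reindex {k} {l} π {α} {β} e = cong +_ (bijection-length (mapᵛ to)
    (colourings-unique G k α) (colourings-unique G l β)
    (λ {κ} κ∈ → let (p , c) = colourings-∈ G κ∈ in ∈-colourings G (proper-map G κ to-inj p) λ j →
      cong (λ j → occ j (mapᵛ to κ)) (sym (to-from j)) ∙ (occ-map to-inj (from j) κ ∙
      (c (from j) ∙ (e (from j) ∙ cong (lookup β) (to-from j)))))
    (λ _ _ → map-injective to-inj)
    (λ {κ} κ∈ → let (p , c) = colourings-∈ G κ∈ in
      mapᵛ from κ ,
      ∈-colourings G (proper-map G κ from-inj p) (λ i →
        cong (λ i → occ i (mapᵛ from κ)) (sym (from-to i)) ∙ (occ-map from-inj (to i) κ ∙ (c (to i) ∙ sym (e i)))) ,
      sym (Vecₚ.map-∘ to from κ) ∙ (Vecₚ.map-cong to-from κ ∙ Vecₚ.map-id κ)))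
    where
    open Inverse π using (to; from; strictlyInverseˡ; strictlyInverseʳ)
    to-from : ∀ j → to (from j) ≡ j
    to-from = strictlyInverseˡ
    from-to : ∀ i → from (to i) ≡ i
    from-to = strictlyInverseʳ
    to-inj : ∀ {i j} → to i ≡ to j → i ≡ j
    to-inj {i} {j} e = sym (from-to i) ∙ (cong from e ∙ from-to j)
    from-inj : ∀ {i j} → from i ≡ from j → i ≡ j
    from-inj {i} {j} e = sym (to-from i) ∙ (cong to e ∙ to-from j)

  X-0∷ : (α : Vec ℕ k) → X G (suc k) (0 ∷ α) ≡ X G k α
  X-0∷ {k} α = sym (cong +_ (bijection-length (mapᵛ suc)
    (colourings-unique G k α) (colourings-unique G (suc k) (0 ∷ α))
    (λ {κ} κ∈ → let (p , c) = colourings-∈ G κ∈ in ∈-colourings G (proper-map G κ Finₚ.suc-injective p) λ where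
      zero    → occ-zero κ
      (suc i) → occ-map Finₚ.suc-injective i κ ∙ c i)
    (λ _ _ → map-injective Finₚ.suc-injective)
    λ {κ} κ∈ → let (p , c) = colourings-∈ G κ∈ ; (κ′ , e) = lower κ (c zero) in
      κ′ , ∈-colourings G (proper-map⁻ G suc κ′ (subst (Proper G) (sym e) p)) (λ i →
        sym (occ-map Finₚ.suc-injective i κ′) ∙ (cong (occ (suc i)) e ∙ c (suc i))) , e))
    where
    occ-zero : ∀ {n} (κ : Vec (Fin k) n) → occ zero (mapᵛ suc κ) ≡ 0
    occ-zero []      = refl
    occ-zero (x ∷ κ) = occ-zero κ
    lower : ∀ {n} (κ : Vec (Fin (suc k)) n) → occ zero κ ≡ 0 → ∃ λ κ′ → mapᵛ suc κ′ ≡ κ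
    lower []          e = [] , refl
    lower (suc x ∷ κ) e = let (κ′ , e′) = lower κ e in x ∷ κ′ , cong (suc x ∷_) e′

  chromatic : List ℕ → ℤ
  chromatic α = X G (length α) (fromList α)

  private
    -- The round trip through lists changes the length index as well, so both are transported
    -- together in a Σ-type.
    repack : (α : Vec ℕ k) → _≡_ {A = Σ ℕ (Vec ℕ)} (k , α) (length (toList α) , fromList (toList α))
    repack []      = refl
    repack (a ∷ α) = cong (λ (k , α) → suc k , a ∷ α) (repack α)

    lookup-fromList : ∀ (α : List ℕ) i → lookupᴸ α i ≡ lookup (fromList α) i
    lookup-fromList (a ∷ α) zero    = refl
    lookup-fromList (a ∷ α) (suc i) = lookup-fromList α i

  X-symmetric : IsSymmetric (X G) chromatic
  X-symmetric = record
    { value = λ α → cong (λ (k , α) → X G k α) (repack α)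
    ; perm  = λ {α} {β} p → let q = ↭⇒↭ₛ p in X-reindex (onIndices q) λ i →
        sym (lookup-fromList α i) ∙ (onIndices-lookup q i ∙ lookup-fromList β (Inverse.to (onIndices q) i))
    ; drop₀ = λ α → X-0∷ (fromList α)
    }

-- Attaching a complete graph by a bridge

infix 4 _~[_]_
_~[_]_ : {V : Set} → V → Graph V → V → Set
u ~[ G ] v = Graph._~_ G u v

-- Qₜ t w is attach Q (# 1) t w by definition.
attach : ∀ {m} → Graph (Fin m) → Fin m → ∀ t → Fin t → Graph (Fin (m + t))
attach {m} G a t w = addEdge (pullback (splitAt m) (G ⊕ completeGraph t)) (a ↑ˡ t) (m ↑ʳ w)

module Attach {m : ℕ} (G : Graph (Fin m)) (a : Fin m) {t : ℕ} (w : Fin t) where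

  infix 4 _≈_
  -- One constructor per kind of edge, so that later arguments split on edges instead of unfolding
  -- `addEdge`, `pullback` and `splitAt`; `from-side` and `to-side` translate.
  data _≈_ : Fin m ⊎ Fin t → Fin m ⊎ Fin t → Set where
    inG     : ∀ {u v} → u ~[ G ] v → inj₁ u ≈ inj₁ v
    inK     : ∀ {i j} → i ≢ j → inj₂ i ≈ inj₂ j
    bridge  : inj₁ a ≈ inj₂ w
    bridge⁻ : inj₂ w ≈ inj₁ a

  vertex : Fin m ⊎ Fin t → Fin (m + t)
  vertex = join m t

  side : Fin (m + t) → Fin m ⊎ Fin t
  side = splitAt m

  vertex-side : ∀ u → vertex (side u) ≡ u
  vertex-side = Finₚ.join-splitAt m t

  vertex-injective : ∀ {x y} → vertex x ≡ vertex y → x ≡ y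
  vertex-injective {x} {y} e =
    sym (Finₚ.splitAt-join m t x) ∙ (cong side e ∙ Finₚ.splitAt-join m t y)

  private
    G⊕K = G ⊕ completeGraph t

    separate : ∀ {x y} → x ~[ G⊕K ] y → side (vertex x) ~[ G⊕K ] side (vertex y)
    separate {x} {y} p rewrite Finₚ.splitAt-join m t x | Finₚ.splitAt-join m t y = p

    separate⁻ : ∀ {x y} → side (vertex x) ~[ G⊕K ] side (vertex y) → x ~[ G⊕K ] y
    separate⁻ {x} {y} p rewrite Finₚ.splitAt-join m t x | Finₚ.splitAt-join m t y = p

    edge : ∀ x y → x ~[ G⊕K ] y → vertex x ~[ attach G a t w ] vertex y
    edge x y p =
      (λ e → Graph.~-irrefl G⊕K {y} (subst (λ x → x ~[ G⊕K ] y) (vertex-injective {x} {y} e) p)) ,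
      inj₁ (separate {x} {y} p)

  adjacent : ∀ {x y} → x ≈ y → vertex x ~[ attach G a t w ] vertex y
  adjacent (inG {u} {v} p) = edge (inj₁ u) (inj₁ v) p
  adjacent (inK {i} {j} p) = edge (inj₂ i) (inj₂ j) p
  adjacent bridge  = (λ e → contradiction (vertex-injective {inj₁ a} {inj₂ w} e) λ ()) ,
    inj₂ (inj₁ (refl , refl))
  adjacent bridge⁻ = (λ e → contradiction (vertex-injective {inj₂ w} {inj₁ a} e) λ ()) ,
    inj₂ (inj₂ (refl , refl))

  adjacent⁻ : ∀ x y → vertex x ~[ attach G a t w ] vertex y → x ≈ y
  adjacent⁻ (inj₁ u) (inj₁ v) (_ , inj₁ p) = inG (separate⁻ {inj₁ u} {inj₁ v} p)
  adjacent⁻ (inj₂ u) (inj₂ v) (_ , inj₁ p) = inK (separate⁻ {inj₂ u} {inj₂ v} p)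
  adjacent⁻ (inj₁ u) (inj₂ v) (_ , inj₁ p) = ⊥-elim (separate⁻ {inj₁ u} {inj₂ v} p)
  adjacent⁻ (inj₂ u) (inj₁ v) (_ , inj₁ p) = ⊥-elim (separate⁻ {inj₂ u} {inj₁ v} p)
  adjacent⁻ x y (_ , inj₂ (inj₁ (p , q)))
    with refl ← vertex-injective {x} {inj₁ a} p | refl ← vertex-injective {y} {inj₂ w} q = bridge
  adjacent⁻ x y (_ , inj₂ (inj₂ (p , q)))
    with refl ← vertex-injective {x} {inj₂ w} p | refl ← vertex-injective {y} {inj₁ a} q = bridge⁻

  from-side : ∀ {u v} → side u ≈ side v → u ~[ attach G a t w ] v
  from-side {u} {v} p = subst (λ u → u ~[ attach G a t w ] v) (vertex-side u)
    (subst (λ v → vertex (side u) ~[ attach G a t w ] v) (vertex-side v) (adjacent p))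

  to-side : ∀ {u v} → u ~[ attach G a t w ] v → side u ≈ side v
  to-side {u} {v} p = adjacent⁻ (side u) (side v)
    (subst (λ u → u ~[ attach G a t w ] vertex (side v)) (sym (vertex-side u))
      (subst (λ v → u ~[ attach G a t w ] v) (sym (vertex-side v)) p))

-- Colour classes

positions : Fin k → Vec (Fin k) n → List (Fin n)
positions i []      = []
positions i (x ∷ κ) with x Finₚ.≟ i
... | yes _ = zero ∷ map suc (positions i κ)
... | no  _ = map suc (positions i κ)

length-positions : (i : Fin k) (κ : Vec (Fin k) n) → length (positions i κ) ≡ occ i κ
length-positions i []      = refl
length-positions i (x ∷ κ) with x Finₚ.≟ i
... | yes _ = cong suc (length-map suc (positions i κ) ∙ length-positions i κ)
... | no  _ = length-map suc (positions i κ) ∙ length-positions i κ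

positions-unique : (i : Fin k) (κ : Vec (Fin k) n) → Unique (positions i κ)
positions-unique i []      = []
positions-unique i (x ∷ κ) with x Finₚ.≟ i
... | yes _ = Allₚ.map⁺ (Allₗ.universal (λ _ ()) (positions i κ)) ∷
  Uniqueₚ.map⁺ Finₚ.suc-injective (positions-unique i κ)
... | no  _ = Uniqueₚ.map⁺ Finₚ.suc-injective (positions-unique i κ)

∈-positions : (i : Fin k) (κ : Vec (Fin k) n) → ∀ {u} → u ∈ positions i κ → lookup κ u ≡ i
∈-positions i (x ∷ κ) u∈ with x Finₚ.≟ i
∈-positions i (x ∷ κ) (here refl) | yes e = e
∈-positions i (x ∷ κ) (there u∈)  | yes _ with v , v∈ , refl ← ∈-map⁻ suc u∈ = ∈-positions i κ v∈
∈-positions i (x ∷ κ) u∈          | no _  with v , v∈ , refl ← ∈-map⁻ suc u∈ = ∈-positions i κ v∈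

unique-length : ∀ {c} {xs : List (Fin c)} → Unique xs → length xs ≤ c
unique-length {c} {xs} u = subst (_≤ c) (↭-length {xs = filter (λ x → ∈-dec Finₚ._≟_ x xs) (allFin c)}
    (↭-unique (Uniqueₚ.filter⁺ (λ x → ∈-dec Finₚ._≟_ x xs) (Uniqueₚ.allFin⁺ c)) u
      (λ x∈ → proj₂ (∈-filter⁻ (λ x → ∈-dec Finₚ._≟_ x xs) {xs = allFin c} x∈))
      (λ {x} x∈ → ∈-filter⁺ (λ x → ∈-dec Finₚ._≟_ x xs) (∈-allFin x) x∈)))
  (≤-trans (Listₚ.length-filter (λ x → ∈-dec Finₚ._≟_ x xs) (allFin c)) (≤-reflexive (Listₚ.length-tabulate id)))

-- The fibres of q are cliques. A colour class is independent, so q is injective on it, and the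
-- pigeonhole principle bounds its size.
clique-cover : ∀ {c} (G : Graph (Fin n)) (q : Fin n → Fin c) →
  (∀ u v → q u ≡ q v → u ≡ v ⊎ u ~[ G ] v) →
  ∀ (κ : Vec (Fin k) n) → Proper G κ → ∀ i → occ i κ ≤ c
clique-cover G q cover κ p i = subst (_≤ _)
  (length-map q (positions i κ) ∙ length-positions i κ)
  (unique-length (map-unique (λ {u} {v} u∈ v∈ e → same u∈ v∈ (cover u v e)) (positions-unique i κ)))
  where
  same : ∀ {u v} → u ∈ positions i κ → v ∈ positions i κ → u ≡ v ⊎ u ~[ G ] v → u ≡ v
  same u∈ v∈ (inj₁ e) = e
  same u∈ v∈ (inj₂ a) = contradiction (∈-positions i κ u∈ ∙ sym (∈-positions i κ v∈)) (p _ _ a)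

empty-length : {A : Set} (xs : List A) → (∀ {x} → x ∉ xs) → length xs ≡ 0
empty-length []       e = refl
empty-length (x ∷ xs) e = contradiction (here refl) e

module _ {m : ℕ} (G : Graph (Fin m)) (a : Fin m) {t : ℕ} (w : Fin t) where
  open Attach G a w

  module _ {c : ℕ} (q : Fin m → Fin c) (cover : ∀ u v → q u ≡ q v → u ≡ v ⊎ u ~[ G ] v) where

    private
      part : Fin m ⊎ Fin t → Fin (suc c)
      part (inj₁ u) = suc (q u)
      part (inj₂ _) = zero

      part-covered : ∀ x y → part x ≡ part y → x ≡ y ⊎ x ≈ y
      part-covered (inj₁ u) (inj₁ v) e with cover u v (Finₚ.suc-injective e)
      ... | inj₁ refl = inj₁ refl
      ... | inj₂ u~v  = inj₂ (inG u~v)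
      part-covered (inj₂ i) (inj₂ j) e with i Finₚ.≟ j
      ... | yes refl = inj₁ refl
      ... | no i≢j   = inj₂ (inK i≢j)

      covered : ∀ u v → part (side u) ≡ part (side v) → u ≡ v ⊎ u ~[ attach G a t w ] v
      covered u v e with part-covered (side u) (side v) e
      ... | inj₁ e′ = inj₁ (sym (vertex-side u) ∙ (cong vertex e′ ∙ vertex-side v))
      ... | inj₂ p  = inj₂ (from-side p)

    -- K_t is one clique more than those covering G, whence `suc c`; for Q the bound is 5.
    chromatic-large-part : ∀ α → suc c < head₀ α → chromatic (attach G a t w) α ≡ 0ℤ
    chromatic-large-part (b ∷ α) c<b =
      cong +_ (empty-length (colourings (attach G a t w) _ (fromList (b ∷ α))) λ {κ} κ∈ →
        let (p , e) = colourings-∈ (attach G a t w) κ∈ in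
        <-irrefl refl (<-≤-trans c<b (≤-trans (≤-reflexive (sym (e zero)))
          (clique-cover (attach G a t w) (part ∘ side) covered κ p zero))))

  chromatic-few-parts : ∀ α → length α < t → chromatic (attach G a t w) α ≡ 0ℤ
  chromatic-few-parts α l<t = cong +_ (empty-length (colourings (attach G a t w) _ (fromList α)) λ {κ} κ∈ →
    let (p , _) = colourings-∈ (attach G a t w) κ∈ in
    <-irrefl refl (<-≤-trans l<t (Finₚ.injective⇒≤ {f = λ i → lookup κ (m ↑ʳ i)} (injective κ p))))
    where
    injective : ∀ κ → Proper (attach G a t w) κ → ∀ {i j} → lookup κ (m ↑ʳ i) ≡ lookup κ (m ↑ʳ j) → i ≡ j
    injective κ p {i} {j} e with i Finₚ.≟ j
    ... | yes e′ = e′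
    ... | no i≢j = contradiction e (p _ _ (adjacent (inK i≢j)))

-- Permutations, and the factorisation in t colours

K : ∀ n → Graph (Fin n)
K = completeGraph

-- A proper colouring of K_n with n colours is a permutation, and this is the form in which
-- permutations arise by restricting a colouring of the attached graph.
permutations : ∀ n → List (Vec (Fin n) n)
permutations n = filter (proper? (K n)) (allWords n n)

permutations-unique : ∀ n → Unique (permutations n)
permutations-unique n = Uniqueₚ.filter⁺ (proper? (K n)) (allWords-unique n n)

∈-permutations : {κ : Vec (Fin n) n} → Proper (K n) κ → κ ∈ permutations n
∈-permutations {n} p = ∈-filter⁺ (proper? (K n)) (∈-allWords _) p

permutations-∈ : {κ : Vec (Fin n) n} → κ ∈ permutations n → Proper (K n) κ
permutations-∈ {n} κ∈ = proj₂ (∈-filter⁻ (proper? (K n)) {xs = allWords n n} κ∈)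

sends? : (w j : Fin n) → Decidable λ (κ : Vec (Fin n) n) → lookup κ w ≡ j
sends? w j κ = lookup κ w Finₚ.≟ j

sending : (w j : Fin n) → List (Vec (Fin n) n)
sending {n} w j = filter (sends? w j) (permutations n)

avoiding : (w j : Fin n) → List (Vec (Fin n) n)
avoiding {n} w j = filter (λ κ → ¬? (sends? w j κ)) (permutations n)

length-filter-¬ : {A : Set} {P : A → Set} (P? : Decidable P) (xs : List A) →
  length (filter P? xs) + length (filter (λ x → ¬? (P? x)) xs) ≡ length xs
length-filter-¬ P? []       = refl
length-filter-¬ P? (x ∷ xs) with P? x
... | yes _ = cong suc (length-filter-¬ P? xs)
... | no  _ = +-suc _ _ ∙ cong suc (length-filter-¬ P? xs)

lookup-ext : {A : Set} (v v′ : Vec A n) → (∀ i → lookup v i ≡ lookup v′ i) → v ≡ v′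
lookup-ext v v′ e = sym (Vecₚ.tabulate∘lookup v) ∙ (Vecₚ.tabulate-cong e ∙ Vecₚ.tabulate∘lookup v′)

module _ {n : ℕ} (w j : Fin (suc n)) where

  private
    extend : Vec (Fin n) n → Vec (Fin (suc n)) (suc n)
    extend κ = insertAt (mapᵛ (punchIn j) κ) w j

    at-w : ∀ κ → lookup (extend κ) w ≡ j
    at-w κ = Vecₚ.insertAt-lookup (mapᵛ (punchIn j) κ) w j

    off-w : ∀ κ i → lookup (extend κ) (punchIn w i) ≡ punchIn j (lookup κ i)
    off-w κ i = Vecₚ.insertAt-punchIn (mapᵛ (punchIn j) κ) w j i ∙ Vecₚ.lookup-map i (punchIn j) κ

    data Position : Fin (suc n) → Set where
      at  : Position w
      off : ∀ i → Position (punchIn w i)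

    position : ∀ u → Position u
    position u with w Finₚ.≟ u
    ... | yes refl = at
    ... | no w≢u   = subst Position (Finₚ.punchIn-punchOut w≢u) (off (punchOut w≢u))

    extend-proper : ∀ {κ} → Proper (K n) κ → Proper (K (suc n)) (extend κ)
    extend-proper {κ} p u v u≢v e with position u | position v
    ... | at    | at    = u≢v refl
    ... | at    | off i = Finₚ.punchInᵢ≢i j (lookup κ i) (sym (off-w κ i) ∙ (sym e ∙ at-w κ))
    ... | off i | at    = Finₚ.punchInᵢ≢i j (lookup κ i) (sym (off-w κ i) ∙ (e ∙ at-w κ))
    ... | off i | off l = p i l (u≢v ∘ cong (punchIn w))
      (Finₚ.punchIn-injective j _ _ (sym (off-w κ i) ∙ (e ∙ off-w κ l)))

    extend-injective : ∀ {κ κ′} → extend κ ≡ extend κ′ → κ ≡ κ′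
    extend-injective {κ} {κ′} e = lookup-ext κ κ′ λ i → Finₚ.punchIn-injective j _ _
      (sym (off-w κ i) ∙ (cong (λ κ → lookup κ (punchIn w i)) e ∙ off-w κ′ i))

    restrict : ∀ {κ} → Proper (K (suc n)) κ → lookup κ w ≡ j → ∃ λ κ′ → Proper (K n) κ′ × extend κ′ ≡ κ
    restrict {κ} p e = κ′ ,
      (λ u v u≢v e′ → p (punchIn w u) (punchIn w v) (u≢v ∘ Finₚ.punchIn-injective w u v)
        (sym (value u) ∙ (cong (punchIn j) e′ ∙ value v))) ,
      lookup-ext (extend κ′) κ (λ u → agree (position u))
      where
      j≢ : ∀ i → j ≢ lookup κ (punchIn w i)
      j≢ i e′ = p w (punchIn w i) (Finₚ.punchInᵢ≢i w i ∘ sym) (e ∙ e′)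
      κ′ = tabulate λ i → punchOut (j≢ i)
      value : ∀ i → punchIn j (lookup κ′ i) ≡ lookup κ (punchIn w i)
      value i = cong (punchIn j) (Vecₚ.lookup∘tabulate (λ i → punchOut (j≢ i)) i) ∙ Finₚ.punchIn-punchOut (j≢ i)
      agree : ∀ {u} → Position u → lookup (extend κ′) u ≡ lookup κ u
      agree at      = at-w κ′ ∙ sym e
      agree (off i) = off-w κ′ i ∙ value i

  -- Deleting the vertex w and the colour j, by `punchOut`, leaves an arbitrary permutation of the
  -- rest.
  length-sending : length (sending w j) ≡ length (permutations n)
  length-sending = sym (bijection-length extend (permutations-unique n)
    (Uniqueₚ.filter⁺ (sends? w j) (permutations-unique (suc n)))
    (λ {κ} κ∈ → ∈-filter⁺ (sends? w j) (∈-permutations (extend-proper (permutations-∈ κ∈))) (at-w κ))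
    (λ _ _ → extend-injective)
    λ {κ} κ∈ → let (κ∈′ , e) = ∈-filter⁻ (sends? w j) {xs = permutations (suc n)} κ∈
                   (κ′ , p , e′) = restrict (permutations-∈ κ∈′) e in κ′ , ∈-permutations p , e′)

length-permutations : ∀ n → length (permutations n) ≡ n !
length-permutations zero    = refl
length-permutations (suc n) = ℤₚ.+-injective (begin
  + length (permutations (suc n))
    ≡⟨ cong +_ (↭-length (↭-unique (permutations-unique (suc n))
        (concatMap-unique {xs = allFin (suc n)} (λ {j} _ → Uniqueₚ.filter⁺ (sends? zero j) (permutations-unique (suc n)))
          (λ {j} {j′} κ∈ κ∈′ →
            sym (proj₂ (∈-filter⁻ (sends? zero j) {xs = permutations (suc n)} κ∈)) ∙
            proj₂ (∈-filter⁻ (sends? zero j′) {xs = permutations (suc n)} κ∈′))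
          (Uniqueₚ.allFin⁺ (suc n)))
        (λ {κ} κ∈ → ∈-concatMap (∈-allFin (lookup κ zero)) (∈-filter⁺ (sends? zero (lookup κ zero)) κ∈ refl))
        (λ κ∈ → let (j , _ , κ∈′) = ∈-concatMap′ {xs = allFin (suc n)} κ∈ in
          proj₁ (∈-filter⁻ (sends? zero j) {xs = permutations (suc n)} κ∈′)))) ⟩
  + length (concatMap (sending zero) (allFin (suc n)))
    ≡⟨ length-concatMap (sending zero) (allFin (suc n)) ⟩
  ∑ (allFin (suc n)) (λ j → + length (sending zero j))
    ≡⟨ ∑-cong (allFin (suc n)) {λ j → + length (sending zero j)} {λ _ → + (n !)}
        (λ {j} _ → cong +_ (length-sending zero j ∙ length-permutations n)) ⟩
  ∑ (allFin (suc n)) (λ _ → + (n !))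
    ≡⟨ ∑-const (allFin (suc n)) (+ (n !)) ⟩
  + length (allFin (suc n)) *ᶻ + (n !)
    ≡⟨ cong (λ l → + l *ᶻ + (n !)) (Listₚ.length-tabulate {n = suc n} id) ⟩
  + suc n *ᶻ + (n !)
    ≡⟨ sym (ℤₚ.pos-* (suc n) (n !)) ⟩
  + (suc n !) ∎)
  where open ≡-Reasoning

-- With t = n + 1, the n! permutations sending w to j are removed from (n + 1)! = n! + n · n!, an
-- identity that holds by unfolding. This is the source of the factor (t - 1)(t - 1)!.
length-avoiding : ∀ {t} (w j : Fin t) → length (avoiding w j) ≡ (t ∸ 1) * (t ∸ 1) !
length-avoiding {suc n} w j = +-cancelˡ-≡ (n !) _ _
  (cong (_+ length (avoiding w j)) (sym (length-sending w j ∙ length-permutations n)) ∙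
   (length-filter-¬ (sends? w j) (permutations (suc n)) ∙ length-permutations (suc n)))

occ-absent : (i : Fin k) (κ : Vec (Fin k) n) → (∀ u → lookup κ u ≢ i) → occ i κ ≡ 0
occ-absent i []      ne = refl
occ-absent i (x ∷ κ) ne = occ-no κ (ne zero) ∙ occ-absent i κ (ne ∘ suc)

occ-once : (i : Fin k) (κ : Vec (Fin k) n) → Proper (K n) κ → ∀ u → lookup κ u ≡ i → occ i κ ≡ 1
occ-once i (x ∷ κ) p zero    e = occ-yes κ e ∙ cong suc
  (occ-absent i κ λ v e′ → p zero (suc v) (λ ()) (e ∙ sym e′))
occ-once i (x ∷ κ) p (suc u) e = occ-no κ (λ e′ → p zero (suc u) (λ ()) (e′ ∙ sym e)) ∙
  occ-once i κ (λ v v′ ne → p (suc v) (suc v′) (ne ∘ Finₚ.suc-injective)) u e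

occ-permutation : (κ : Vec (Fin n) n) → Proper (K n) κ → ∀ i → occ i κ ≡ 1
occ-permutation {zero}  κ p ()
occ-permutation {suc n} κ p i with Finₚ.any? (λ u → lookup κ u Finₚ.≟ i)
... | yes (u , e) = occ-once i κ p u e
-- A missed colour could be punched out, which would inject n + 1 vertices into n colours.
... | no none = contradiction
  (Finₚ.injective⇒≤ {f = λ u → punchOut (λ e → none (u , sym e))} λ {u} {v} e →
    injective u v (Finₚ.punchOut-injective (λ e → none (u , sym e)) (λ e → none (v , sym e)) e))
  (ℕₚ.n≮n n)
  where
  injective : ∀ u v → lookup κ u ≡ lookup κ v → u ≡ v
  injective u v e with u Finₚ.≟ v
  ... | yes e′ = e′
  ... | no u≢v = contradiction e (p u v u≢v)

occ-++ : ∀ {m} (i : Fin k) (κ : Vec (Fin k) m) (κ′ : Vec (Fin k) n) → occ i (κ ++ᵛ κ′) ≡ occ i κ + occ i κ′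
occ-++ i []      κ′ = refl
occ-++ i (x ∷ κ) κ′ with x Finₚ.≟ i
... | yes _ = cong suc (occ-++ i κ κ′)
... | no  _ = occ-++ i κ κ′

module _ {m : ℕ} (G : Graph (Fin m)) (a : Fin m) {t : ℕ} (w : Fin t) where
  open Attach G a w

  private
    G⁺ = attach G a t w

    lookup-vertex : (κ : Vec (Fin k) m) (κ′ : Vec (Fin k) t) → ∀ x →
      lookup (κ ++ᵛ κ′) (vertex x) ≡ [ lookup κ , lookup κ′ ]′ x
    lookup-vertex κ κ′ (inj₁ u) = Vecₚ.lookup-++ˡ κ κ′ u
    lookup-vertex κ κ′ (inj₂ i) = Vecₚ.lookup-++ʳ κ κ′ i

    proper-++ : (κ : Vec (Fin k) m) (κ′ : Vec (Fin k) t) →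
      Proper G κ → Proper (K t) κ′ → lookup κ′ w ≢ lookup κ a → Proper G⁺ (κ ++ᵛ κ′)
    proper-++ κ κ′ p p′ ne u v u~v e = go (to-side u~v)
      (sym (lookup-vertex κ κ′ (side u)) ∙ (cong (lookup (κ ++ᵛ κ′)) (vertex-side u) ∙
      (e ∙ (sym (cong (lookup (κ ++ᵛ κ′)) (vertex-side v)) ∙ lookup-vertex κ κ′ (side v)))))
      where
      go : ∀ {x y} → x ≈ y → [ lookup κ , lookup κ′ ]′ x ≢ [ lookup κ , lookup κ′ ]′ y
      go (inG u~v) = p _ _ u~v
      go (inK i≢j) = p′ _ _ i≢j
      go bridge    = ne ∘ sym
      go bridge⁻   = ne

    proper-++⁻ : (κ : Vec (Fin k) m) (κ′ : Vec (Fin k) t) → Proper G⁺ (κ ++ᵛ κ′) →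
      Proper G κ × Proper (K t) κ′ × lookup κ′ w ≢ lookup κ a
    proper-++⁻ κ κ′ p =
      (λ u v u~v → along (inG u~v)) , (λ i j i≢j → along (inK i≢j)) , along bridge⁻
      where
      along : ∀ {x y} → x ≈ y → [ lookup κ , lookup κ′ ]′ x ≢ [ lookup κ , lookup κ′ ]′ y
      along {x} {y} x≈y e = p _ _ (adjacent x≈y)
        (lookup-vertex κ κ′ x ∙ (e ∙ sym (lookup-vertex κ κ′ y)))

  -- With exactly t colours, the vertices of K_t use each colour once.
  X-attach : (β : Vec ℕ t) → X G⁺ t (mapᵛ suc β) ≡ + ((t ∸ 1) * (t ∸ 1) !) *ᶻ X G t β
  X-attach β = begin
    + length (colourings G⁺ t (mapᵛ suc β))
      ≡⟨ cong +_ (↭-length (↭-unique (colourings-unique G⁺ t (mapᵛ suc β)) pairs-unique to from)) ⟩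
    + length pairs
      ≡⟨ length-concatMap fibre (colourings G t β) ⟩
    ∑ (colourings G t β) (λ κ → + length (fibre κ))
      -- The bridge forbids a single colour at w, namely that of a, so the number of extensions is
      -- the same for every κ.
      ≡⟨ ∑-cong (colourings G t β) {λ κ → + length (fibre κ)} {λ _ → + N} (λ {κ} _ → cong +_
          (length-map (κ ++ᵛ_) (avoiding w (lookup κ a)) ∙ length-avoiding w (lookup κ a))) ⟩
    ∑ (colourings G t β) (λ _ → + N)
      ≡⟨ ∑-const (colourings G t β) (+ N) ⟩
    X G t β *ᶻ + N
      ≡⟨ ℤₚ.*-comm (X G t β) (+ N) ⟩
    + N *ᶻ X G t β ∎
    where
    open ≡-Reasoning
    N = (t ∸ 1) * (t ∸ 1) !

    avoids? : ∀ j → Decidable λ (κ : Vec (Fin t) t) → ¬ (lookup κ w ≡ j)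
    avoids? j κ = ¬? (sends? w j κ)

    fibre : Vec (Fin t) m → List (Vec (Fin t) (m + t))
    fibre κ = map (κ ++ᵛ_) (avoiding w (lookup κ a))

    pairs : List (Vec (Fin t) (m + t))
    pairs = concatMap fibre (colourings G t β)

    fibre-∈ : ∀ {κ υ} → υ ∈ fibre κ → ∃ λ κ′ → Proper (K t) κ′ × lookup κ′ w ≢ lookup κ a × υ ≡ κ ++ᵛ κ′
    fibre-∈ {κ} υ∈ = let (κ′ , κ′∈ , e) = ∈-map⁻ (κ ++ᵛ_) υ∈
                         (κ′∈′ , ne) = ∈-filter⁻ (avoids? (lookup κ a)) {xs = permutations t} κ′∈ in
      κ′ , permutations-∈ κ′∈′ , ne , e

    pairs-unique : Unique pairs
    pairs-unique = concatMap-unique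
      (λ {κ} _ → Uniqueₚ.map⁺ (λ {x} {y} → Vecₚ.++-injectiveʳ κ κ)
        (Uniqueₚ.filter⁺ (avoids? (lookup κ a)) (permutations-unique t)))
      (λ {κ} {κ₂} υ∈ υ∈′ → let (_ , _ , _ , e) = fibre-∈ {κ} υ∈ ; (_ , _ , _ , e′) = fibre-∈ {κ₂} υ∈′ in
        Vecₚ.++-injectiveˡ κ κ₂ (sym e ∙ e′))
      (colourings-unique G t β)

    occ-pair : ∀ κ {κ′} → Proper (K t) κ′ → ∀ i → occ i (κ ++ᵛ κ′) ≡ suc (occ i κ)
    occ-pair κ {κ′} p′ i = occ-++ i κ κ′ ∙ (cong (_+_ (occ i κ)) (occ-permutation κ′ p′ i) ∙ +-comm (occ i κ) 1)

    to : ∀ {υ} → υ ∈ colourings G⁺ t (mapᵛ suc β) → υ ∈ pairs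
    to {υ} υ∈ with p , c ← colourings-∈ G⁺ υ∈ | κ , κ′ , refl ← splitAtᵛ m υ =
      let (pκ , pκ′ , ne) = proper-++⁻ κ κ′ p in
      ∈-concatMap (∈-colourings G pκ (λ i → suc-injective
          (sym (occ-pair κ pκ′ i) ∙ (c i ∙ Vecₚ.lookup-map i suc β))))
        (∈-map⁺ (κ ++ᵛ_) (∈-filter⁺ (avoids? (lookup κ a)) (∈-permutations pκ′) ne))

    from : ∀ {υ} → υ ∈ pairs → υ ∈ colourings G⁺ t (mapᵛ suc β)
    from υ∈ with κ , κ∈ , υ∈′ ← ∈-concatMap′ {xs = colourings G t β} υ∈
      with κ′ , p′ , ne , refl ← fibre-∈ {κ} υ∈′ | p , c ← colourings-∈ G κ∈ =
      ∈-colourings G⁺ (proper-++ κ κ′ p p′ ne) (λ i →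
        occ-pair κ p′ i ∙ (cong suc (c i) ∙ sym (Vecₚ.lookup-map i suc β)))

-- Counting colourings by backtracking

-- The rows of the strict upper half of an adjacency matrix.
data Upper : ℕ → Set where
  []  : Upper 0
  _∷_ : Vec Bool n → Upper n → Upper (suc n)

upper : ∀ {n} → Graph (Fin n) → Upper n
upper {zero}  G = []
upper {suc n} G = tabulate (λ v → does (Graph._~?_ G zero (suc v))) ∷ upper (pullback suc G)

forbid : Fin k → Vec Bool n → Vec (Vec Bool k) n → Vec (Vec Bool k) n
forbid x = zipWith λ e s → if e then s [ x ]≔ false else s

-- S records the colours still allowed at each vertex.
search : Upper n → Vec (Vec Bool k) n → Vec ℕ k → List (Vec (Fin k) n)
assign : Vec Bool n → Upper n → Vec (Vec Bool k) n → Vec ℕ k → Fin k → Bool → ℕ → List (Vec (Fin k) (suc n))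
search []      []      α = if does (sumᵛ α ≟ 0) then [] ∷ [] else []
search {k = k} (r ∷ R) (s ∷ S) α = concatMap (λ x → assign r R S α x (lookup s x) (lookup α x)) (allFin k)
assign r R S α x true  (suc b) = map (x ∷_) (search R (forbid x r S) (α [ x ]≔ b))
assign r R S α x _     _       = []

Compatible : Upper n → Vec (Fin k) n → Set
Compatible []      []      = ⊤
Compatible (r ∷ R) (x ∷ κ) = (∀ v → lookup r v ≡ true → lookup κ v ≢ x) × Compatible R κ

Allowed : Vec (Vec Bool k) n → Vec (Fin k) n → Set
Allowed S κ = ∀ v → lookup (lookup S v) (lookup κ v) ≡ true

module _ {x : Fin k} where

  forbid-allowed : ∀ {r} {S : Vec (Vec Bool k) n} {κ} → Allowed S κ →
    (∀ v → lookup r v ≡ true → lookup κ v ≢ x) → Allowed (forbid x r S) κ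
  forbid-allowed {r = r} {S} {κ} p ne v
    rewrite Vecₚ.lookup-zipWith (λ e s → if e then s [ x ]≔ false else s) v r S with lookup r v | ne v
  ... | false | _   = p v
  ... | true  | ne′ = Vecₚ.lookup∘update′ (ne′ refl) (lookup S v) false ∙ p v

  allowed-forbid : ∀ r (S : Vec (Vec Bool k) n) κ → Allowed (forbid x r S) κ →
    Allowed S κ × (∀ v → lookup r v ≡ true → lookup κ v ≢ x)
  allowed-forbid r S κ p = (λ v → proj₁ (at v)) , (λ v → proj₂ (at v))
    where
    at : ∀ v → lookup (lookup S v) (lookup κ v) ≡ true × (lookup r v ≡ true → lookup κ v ≢ x)
    at v with p v
    ... | pv rewrite Vecₚ.lookup-zipWith (λ e s → if e then s [ x ]≔ false else s) v r S with lookup r v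
    ...   | false = pv , λ ()
    ...   | true with lookup κ v Finₚ.≟ x
    ...     | yes refl = contradiction (sym (Vecₚ.lookup∘update (lookup κ v) (lookup S v) false) ∙ pv) λ ()
    ...     | no ne    = (sym (Vecₚ.lookup∘update′ ne (lookup S v) false) ∙ pv) , λ _ → ne

sum-zero : (α : Vec ℕ k) → sumᵛ α ≡ 0 → ∀ i → lookup α i ≡ 0
sum-zero (a ∷ α) e zero    = ℕₚ.m+n≡0⇒m≡0 a e
sum-zero (a ∷ α) e (suc i) = sum-zero α (ℕₚ.m+n≡0⇒n≡0 a e) i

zero-sum : (α : Vec ℕ k) → (∀ i → lookup α i ≡ 0) → sumᵛ α ≡ 0
zero-sum []      e = refl
zero-sum (a ∷ α) e = cong₂ _+_ (e zero) (zero-sum α (e ∘ suc))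

assign-∈ : ∀ {r : Vec Bool n} {R S} {α : Vec ℕ k} {x b a κ} → κ ∈ assign r R S α x b a →
  b ≡ true × ∃ λ a′ → a ≡ suc a′ × ∃ λ κ′ → κ′ ∈ search R (forbid x r S) (α [ x ]≔ a′) × κ ≡ x ∷ κ′
assign-∈ {x = x} {true} {suc a} κ∈ = refl , a , refl , ∈-map⁻ (x ∷_) κ∈

search-∈ : ∀ (R : Upper n) S (α : Vec ℕ k) {κ} → κ ∈ search R S α →
  Compatible R κ × Allowed S κ × ∀ i → occ i κ ≡ lookup α i
search-∈ [] [] α κ∈ with sumᵛ α ≟ 0
search-∈ [] [] α κ∈ | yes e rewrite e with here refl ← κ∈ = tt , (λ ()) , λ i → sym (sum-zero α e i)
search-∈ [] [] α κ∈ | no ne with sumᵛ α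
... | zero = contradiction refl ne
search-∈ [] [] α () | no ne | suc _
search-∈ {k = k} (r ∷ R) (s ∷ S) α κ∈
  with x , _ , κ∈′ ← ∈-concatMap′ {xs = allFin k} κ∈
  with e , a , e′ , κ , κ∈″ , refl ← assign-∈ {r = r} {R} {S} {α} {x} {lookup s x} {lookup α x} κ∈′
  with C , A , c ← search-∈ R (forbid x r S) (α [ x ]≔ a) κ∈″
  with A′ , ne ← allowed-forbid r S κ A =
  (ne , C) , (λ { zero → e ; (suc v) → A′ v }) , multiplicity
  where
  multiplicity : ∀ i → occ i (x ∷ κ) ≡ lookup α i
  multiplicity i with x Finₚ.≟ i
  ... | yes refl = cong suc (c i ∙ Vecₚ.lookup∘update i α a) ∙ sym e′
  ... | no x≢i   = c i ∙ Vecₚ.lookup∘update′ (x≢i ∘ sym) α a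

∈-search : ∀ (R : Upper n) S (α : Vec ℕ k) {κ} → Compatible R κ → Allowed S κ → (∀ i → occ i κ ≡ lookup α i) →
  κ ∈ search R S α
∈-search [] [] α {[]} C A c rewrite zero-sum α (sym ∘ c) = here refl
∈-search {k = k} (r ∷ R) (s ∷ S) α {x ∷ κ} (ne , C) A c =
  ∈-concatMap {f = λ x → assign r R S α x (lookup s x) (lookup α x)} (∈-allFin x) assigned
  where
  a = occ x κ
  α-x : suc a ≡ lookup α x
  α-x = sym (occ-yes κ refl) ∙ c x
  rest : ∀ i → occ i κ ≡ lookup (α [ x ]≔ a) i
  rest i with x Finₚ.≟ i
  ... | yes refl = sym (Vecₚ.lookup∘update i α a)
  ... | no x≢i   = sym (occ-no κ x≢i) ∙ (c i ∙ sym (Vecₚ.lookup∘update′ (x≢i ∘ sym) α a))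
  assigned : x ∷ κ ∈ assign r R S α x (lookup s x) (lookup α x)
  assigned rewrite A zero | sym α-x =
    ∈-map⁺ (x ∷_) (∈-search R (forbid x r S) (α [ x ]≔ a) C (forbid-allowed {r = r} {S} {κ} (A ∘ suc) ne) rest)

search-unique : ∀ (R : Upper n) S (α : Vec ℕ k) → Unique (search R S α)
search-unique [] [] α with sumᵛ α
... | zero  = [] ∷ []
... | suc _ = []
search-unique {k = k} (r ∷ R) (s ∷ S) α =
  concatMap-unique (λ {x} _ → unique x (lookup s x) (lookup α x)) same (Uniqueₚ.allFin⁺ k)
  where
  unique : ∀ x b a → Unique (assign r R S α x b a)
  unique x true  (suc a) = Uniqueₚ.map⁺ (proj₂ ∘ Vecₚ.∷-injective) (search-unique R (forbid x r S) (α [ x ]≔ a))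
  unique x true  zero    = []
  unique x false a       = []
  same : ∀ {x x′ κ} → κ ∈ assign r R S α x (lookup s x) (lookup α x) →
    κ ∈ assign r R S α x′ (lookup s x′) (lookup α x′) → x ≡ x′
  same {x} {x′} κ∈ κ∈′ =
    let (_ , _ , _ , _ , _ , e)  = assign-∈ {r = r} {R} {S} {α} {x} {lookup s x} {lookup α x} κ∈
        (_ , _ , _ , _ , _ , e′) = assign-∈ {r = r} {R} {S} {α} {x′} {lookup s x′} {lookup α x′} κ∈′ in
    proj₁ (Vecₚ.∷-injective (sym e ∙ e′))

compatible-proper : ∀ {n} (G : Graph (Fin n)) {κ : Vec (Fin k) n} → Compatible (upper G) κ → Proper G κ
compatible-proper {n = suc n} G {x ∷ κ} (ne , C) = proper
  where
  near : ∀ v → zero ~[ G ] suc v → lookup κ v ≢ x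
  near v a = ne v (Vecₚ.lookup∘tabulate (λ v → does (Graph._~?_ G zero (suc v))) v ∙
    dec-true (Graph._~?_ G zero (suc v)) a)
  proper : Proper G (x ∷ κ)
  proper zero    zero    a = contradiction a (Graph.~-irrefl G)
  proper zero    (suc v) a = near v a ∘ sym
  proper (suc u) zero    a = near u (Graph.~-sym G a)
  proper (suc u) (suc v) a = compatible-proper (pullback suc G) C u v a

proper-compatible : ∀ {n} (G : Graph (Fin n)) {κ : Vec (Fin k) n} → Proper G κ → Compatible (upper G) κ
proper-compatible {n = zero}  G {[]}    p = tt
proper-compatible {n = suc n} G {x ∷ κ} p =
  (λ v e e′ → p zero (suc v) (adjacent (Graph._~?_ G zero (suc v))
     (sym (Vecₚ.lookup∘tabulate (λ v → does (Graph._~?_ G zero (suc v))) v) ∙ e)) (sym e′)) ,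
  proper-compatible (pullback suc G) (λ u v → p (suc u) (suc v))
  where
  adjacent : {A : Set} (d : Dec A) → does d ≡ true → A
  adjacent (yes a) _ = a

-- The definition of `X` runs through all words, of which there are 5^13 for Q with five colours.
-- The search cuts off a partial colouring as soon as a colour is forbidden or used up, so the
-- values can be computed.
X-search : ∀ (G : Graph (Fin n)) (α : Vec ℕ k) →
  X G k α ≡ + length (search (upper G) (replicateᵛ n (replicateᵛ k true)) α)
X-search {n} {k} G α = cong +_ (↭-length (↭-unique (colourings-unique G k α) (search-unique (upper G) full α)
  (λ {κ} κ∈ → let (p , c) = colourings-∈ G κ∈ in ∈-search (upper G) full α (proper-compatible G p) (allowed {κ}) c)
  (λ κ∈ → let (C , _ , c) = search-∈ (upper G) full α κ∈ in ∈-colourings G (compatible-proper G C) c)))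
  where
  full = replicateᵛ n (replicateᵛ k true)
  allowed : ∀ {κ : Vec (Fin k) n} → Allowed full κ
  allowed {κ} v = cong (λ s → lookup s (lookup κ v)) (Vecₚ.lookup-replicate v (replicateᵛ k true)) ∙
    Vecₚ.lookup-replicate (lookup κ v) true

positions-∈ : (i : Fin k) (κ : Vec (Fin k) n) → ∀ u → lookup κ u ≡ i → u ∈ positions i κ
positions-∈ i (x ∷ κ) u e with x Finₚ.≟ i | u
... | yes _ | zero  = here refl
... | yes _ | suc v = there (∈-map⁺ suc (positions-∈ i κ v e))
... | no ne | zero  = contradiction e ne
... | no _  | suc v = ∈-map⁺ suc (positions-∈ i κ v e)

module _ {o o⁻¹ : Fin n → Fin n} (oo⁻¹ : ∀ u → o (o⁻¹ u) ≡ u) (o⁻¹o : ∀ u → o⁻¹ (o u) ≡ u) where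

  private
    permute : (Fin n → Fin n) → Vec (Fin k) n → Vec (Fin k) n
    permute f κ = tabulate (lookup κ ∘ f)

    lookup-permute : ∀ f (κ : Vec (Fin k) n) u → lookup (permute f κ) u ≡ lookup κ (f u)
    lookup-permute f κ u = Vecₚ.lookup∘tabulate (lookup κ ∘ f) u

    occ-permute : (κ : Vec (Fin k) n) → ∀ i → occ i (permute o κ) ≡ occ i κ
    occ-permute κ i = sym (length-positions i (permute o κ)) ∙ (bijection-length o
      (positions-unique i (permute o κ)) (positions-unique i κ)
      (λ {u} u∈ → positions-∈ i κ (o u) (sym (lookup-permute o κ u) ∙ ∈-positions i (permute o κ) u∈))
      (λ {u} {v} _ _ e → sym (o⁻¹o u) ∙ (cong o⁻¹ e ∙ o⁻¹o v))
      (λ {u} u∈ → o⁻¹ u , positions-∈ i (permute o κ) (o⁻¹ u)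
        (lookup-permute o κ (o⁻¹ u) ∙ (cong (lookup κ) (oo⁻¹ u) ∙ ∈-positions i κ u∈)) , oo⁻¹ u)
      ∙ length-positions i κ)

    permute-inverse : (κ : Vec (Fin k) n) → permute o (permute o⁻¹ κ) ≡ κ
    permute-inverse κ = lookup-ext _ κ λ u → lookup-permute o (permute o⁻¹ κ) u ∙
      (lookup-permute o⁻¹ κ (o u) ∙ cong (lookup κ) (o⁻¹o u))

    permute-inverse′ : (κ : Vec (Fin k) n) → permute o⁻¹ (permute o κ) ≡ κ
    permute-inverse′ κ = lookup-ext _ κ λ u → lookup-permute o⁻¹ (permute o κ) u ∙
      (lookup-permute o κ (o⁻¹ u) ∙ cong (lookup κ) (oo⁻¹ u))

  X-relabel : ∀ (G : Graph (Fin n)) (α : Vec ℕ k) → X G k α ≡ X (pullback o G) k α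
  X-relabel {k} G α = cong +_ (bijection-length (permute o)
    (colourings-unique G k α) (colourings-unique (pullback o G) k α)
    (λ {κ} κ∈ → let (p , c) = colourings-∈ G κ∈ in ∈-colourings (pullback o G)
      (λ u v u~v e → p (o u) (o v) u~v (sym (lookup-permute o κ u) ∙ (e ∙ lookup-permute o κ v)))
      (λ i → occ-permute κ i ∙ c i))
    (λ {κ} {κ′} _ _ e → sym (permute-inverse′ κ) ∙ (cong (permute o⁻¹) e ∙ permute-inverse′ κ′))
    (λ {κ} κ∈ → let (p , c) = colourings-∈ (pullback o G) κ∈ in permute o⁻¹ κ ,
      ∈-colourings G
        (λ u v u~v e → p (o⁻¹ u) (o⁻¹ v)
          (subst (λ u → u ~[ G ] o (o⁻¹ v)) (sym (oo⁻¹ u)) (subst (λ v → u ~[ G ] v) (sym (oo⁻¹ v)) u~v))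
          (sym (lookup-permute o⁻¹ κ u) ∙ (e ∙ lookup-permute o⁻¹ κ v)))
        (λ i → sym (occ-permute (permute o⁻¹ κ) i) ∙ (cong (occ i) (permute-inverse κ) ∙ c i)) ,
      permute-inverse κ))

-- Connectedness and claw-freeness

module _ {m : ℕ} (G : Graph (Fin m)) where
  open Graph G using (_~_; _~?_)

  Near : Fin m → Fin m → Set
  Near u v = u ≡ v ⊎ u ~ v

  near? : ∀ u v → Dec (Near u v)
  near? u v = (u Finₚ.≟ v) ⊎-dec (u ~? v)

  -- `Near` admits equality, which disposes of coinciding leaves. The alternative `Near v v′`
  -- precedes the quantifier over the third leaf, so the decision procedure skips it for most pairs.
  NoClaw : Set
  NoClaw = ∀ u v → u ~ v → ∀ v′ → u ~ v′ →
    Near v v′ ⊎ (∀ v″ → u ~ v″ → Near v v″ ⊎ Near v′ v″)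

  no-claw? : Dec NoClaw
  no-claw? = Finₚ.all? λ u → Finₚ.all? λ v → (u ~? v) →-dec Finₚ.all? λ v′ → (u ~? v′) →-dec
    (near? v v′ ⊎-dec Finₚ.all? λ v″ → (u ~? v″) →-dec (near? v v″ ⊎-dec near? v′ v″))

  -- The condition that keeps the bridge at a from creating a claw: the neighbours of a form a
  -- clique.
  Simplicial : Fin m → Set
  Simplicial a = ∀ v → a ~ v → ∀ v′ → a ~ v′ → Near v v′

  simplicial? : ∀ a → Dec (Simplicial a)
  simplicial? a = Finₚ.all? λ v → (a ~? v) →-dec Finₚ.all? λ v′ → (a ~? v′) →-dec near? v v′

  module _ (parent : Fin m → Fin m) where

    Climbs : Set
    Climbs = ∀ u → Near u (parent u)

    climbs? : Dec Climbs
    climbs? = Finₚ.all? λ u → near? u (parent u)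

    climb-connected : ∀ {root} → Climbs → (∀ u → parent (parent (parent u)) ≡ root) → Connected G
    climb-connected {root} climbs top u v = to-root u ◅◅ reverseˢ (Graph.~-sym G) (to-root v)
      where
      step : ∀ {u v} → Near u v → Star _~_ u v
      step (inj₁ refl) = ε
      step (inj₂ p)    = p ◅ ε
      to-root : ∀ u → Star _~_ u root
      to-root u = subst (Star _~_ u) (top u)
        (step (climbs u) ◅◅ (step (climbs (parent u)) ◅◅ step (climbs (parent (parent u)))))

-- A spanning tree of height three rooted at u₁₀. The root is its own parent, so exactly three steps
-- lead there from every vertex.
Q-parent : Fin 13 → Fin 13
Q-parent = lookup (# 11 ∷ # 10 ∷ # 10 ∷ # 2 ∷ # 5 ∷ # 11 ∷ # 7 ∷ # 10 ∷ # 10 ∷ # 11 ∷ # 10 ∷ # 10 ∷ # 2 ∷ [])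

Q-connected : Connected Q
Q-connected = climb-connected Q Q-parent (toWitness {a? = climbs? Q Q-parent} tt)
  (toWitness {a? = Finₚ.all? λ u → Q-parent (Q-parent (Q-parent u)) Finₚ.≟ # 10} tt)

Q-no-claw : NoClaw Q
Q-no-claw = toWitness {a? = no-claw? Q} tt

Q-simplicial : Simplicial Q (# 1)
Q-simplicial = toWitness {a? = simplicial? Q (# 1)} tt

module _ {m : ℕ} (G : Graph (Fin m)) (a : Fin m) {t : ℕ} (w : Fin t) where
  open Attach G a w
  private G⁺ = attach G a t w

  attach-connected : Connected G → Connected G⁺
  attach-connected connected u v = to-a u ◅◅ reverseˢ (Graph.~-sym G⁺) (to-a v)
    where
    from : ∀ x → Star _≈_ x (inj₁ a)
    from (inj₁ u) = gmap inj₁ inG (connected u a)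
    from (inj₂ i) with i Finₚ.≟ w
    ... | yes refl = bridge⁻ ◅ ε
    ... | no i≢w   = inK i≢w ◅ bridge⁻ ◅ ε
    to-a : ∀ u → Star (Graph._~_ G⁺) u (vertex (inj₁ a))
    to-a u = subst (λ u → Star (Graph._~_ G⁺) u (vertex (inj₁ a))) (vertex-side u) (gmap vertex adjacent (from (side u)))

  module _ (no-claw : NoClaw G) (simplicial : Simplicial G a) where

    private
      Near′ : Fin m ⊎ Fin t → Fin m ⊎ Fin t → Set
      Near′ x y = x ≡ y ⊎ x ≈ y

      nearG : ∀ {u v} → Near G u v → Near′ (inj₁ u) (inj₁ v)
      nearG (inj₁ refl) = inj₁ refl
      nearG (inj₂ p)    = inj₂ (inG p)

      nearK : ∀ i j → Near′ (inj₂ i) (inj₂ j)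
      nearK i j with i Finₚ.≟ j
      ... | yes refl = inj₁ refl
      ... | no i≢j   = inj₂ (inK i≢j)

      -- Only centres at the ends of the bridge are new. At a, two leaves lie in G and are near each
      -- other because a is simplicial; at w, two leaves lie in the clique K_t. If the bridge is
      -- used twice, two leaves coincide.
      ≈-claw : ∀ {x y y′ y″} → x ≈ y → x ≈ y′ → x ≈ y″ → Near′ y y′ ⊎ Near′ y y″ ⊎ Near′ y′ y″
      ≈-claw (inG p) (inG p′) (inG p″) with no-claw _ _ p _ p′
      ... | inj₁ n = inj₁ (nearG n)
      ... | inj₂ h with h _ p″
      ...   | inj₁ n = inj₂ (inj₁ (nearG n))
      ...   | inj₂ n = inj₂ (inj₂ (nearG n))
      ≈-claw (inG p) (inG p′) bridge   = inj₁ (nearG (simplicial _ p _ p′))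
      ≈-claw (inG p) bridge   (inG p″) = inj₂ (inj₁ (nearG (simplicial _ p _ p″)))
      ≈-claw bridge  (inG p′) (inG p″) = inj₂ (inj₂ (nearG (simplicial _ p′ _ p″)))
      ≈-claw bridge  bridge   _        = inj₁ (inj₁ refl)
      ≈-claw bridge  (inG _)  bridge   = inj₂ (inj₁ (inj₁ refl))
      ≈-claw (inG _) bridge   bridge   = inj₂ (inj₂ (inj₁ refl))
      ≈-claw (inK _) (inK _)  _        = inj₁ (nearK _ _)
      ≈-claw (inK _) bridge⁻  (inK _)  = inj₂ (inj₁ (nearK _ _))
      ≈-claw bridge⁻ (inK _)  (inK _)  = inj₂ (inj₂ (nearK _ _))
      ≈-claw bridge⁻ bridge⁻  _        = inj₁ (inj₁ refl)
      ≈-claw bridge⁻ (inK _)  bridge⁻  = inj₂ (inj₁ (inj₁ refl))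
      ≈-claw (inK _) bridge⁻  bridge⁻  = inj₂ (inj₂ (inj₁ refl))

    attach-claw-free : ClawFree G⁺
    attach-claw-free (f , injective , edges) = conclude (≈-claw (spoke (# 0)) (spoke (# 1)) (spoke (# 2)))
      where
      leaf : Fin 3 → Fin m ⊎ Fin t
      leaf i = side (f (inj₂ i))
      spoke : ∀ i → side (f (inj₁ (# 0))) ≈ leaf i
      spoke i = to-side (Equivalence.to (edges (inj₁ (# 0)) (inj₂ i)) tt)
      apart : ∀ i j → i ≢ j → ¬ Near′ (leaf i) (leaf j)
      apart i j i≢j (inj₁ e) with refl ← injective
        (sym (vertex-side (f (inj₂ i))) ∙ (cong vertex e ∙ vertex-side (f (inj₂ j)))) = i≢j refl
      apart i j i≢j (inj₂ p) = Equivalence.from (edges (inj₂ i) (inj₂ j)) (from-side p)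
      conclude : ¬ (Near′ (leaf (# 0)) (leaf (# 1)) ⊎ Near′ (leaf (# 0)) (leaf (# 2)) ⊎ Near′ (leaf (# 1)) (leaf (# 2)))
      conclude (inj₁ n)        = apart (# 0) (# 1) (λ ()) n
      conclude (inj₂ (inj₁ n)) = apart (# 0) (# 2) (λ ()) n
      conclude (inj₂ (inj₂ n)) = apart (# 1) (# 2) (λ ()) n

-- Line graphs

module _ {n : ℕ} {H : Graph (Fin n)} where
  private L = lineGraph H

  two-ends : ∀ {v v′ v″} (e : Edge H) → v IsEndOf e → v′ IsEndOf e → v″ IsEndOf e → v ≡ v′ ⊎ v ≡ v″ ⊎ v′ ≡ v″
  two-ends e (inj₁ refl) (inj₁ refl) _           = inj₁ refl
  two-ends e (inj₁ refl) (inj₂ refl) (inj₁ refl) = inj₂ (inj₁ refl)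
  two-ends e (inj₁ refl) (inj₂ refl) (inj₂ refl) = inj₂ (inj₂ refl)
  two-ends e (inj₂ refl) (inj₂ refl) _           = inj₁ refl
  two-ends e (inj₂ refl) (inj₁ refl) (inj₂ refl) = inj₂ (inj₁ refl)
  two-ends e (inj₂ refl) (inj₁ refl) (inj₁ refl) = inj₂ (inj₂ refl)

  meet-once : ∀ {e f : Edge H} → e ≢ f → ∀ {v v′} → v IsEndOf e → v IsEndOf f →
    v′ IsEndOf e → v′ IsEndOf f → v ≡ v′
  meet-once e≢f (inj₁ refl) _ (inj₁ refl) _ = refl
  meet-once e≢f (inj₂ refl) _ (inj₂ refl) _ = refl
  meet-once e≢f _ (inj₁ refl) _ (inj₁ refl) = refl
  meet-once e≢f _ (inj₂ refl) _ (inj₂ refl) = refl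
  meet-once e≢f (inj₁ refl) (inj₁ refl) (inj₂ refl) (inj₂ refl) = contradiction refl e≢f
  meet-once e≢f (inj₂ refl) (inj₂ refl) (inj₁ refl) (inj₁ refl) = contradiction refl e≢f
  -- Both ends agree crosswise, which contradicts that ends are stored in increasing order; the
  -- irrelevant order proofs are recovered by deciding the order.
  meet-once {mkEdge s t p _} {mkEdge .t .s q _} e≢f (inj₁ refl) (inj₂ refl) (inj₂ refl) (inj₁ refl) =
    contradiction (recompute (t Finₚ.<? s) q) (ℕₚ.<-asym (recompute (s Finₚ.<? t) p))
  meet-once {mkEdge s t p _} {mkEdge .t .s q _} e≢f (inj₂ refl) (inj₁ refl) (inj₁ refl) (inj₂ refl) =
    contradiction (recompute (t Finₚ.<? s) q) (ℕₚ.<-asym (recompute (s Finₚ.<? t) p))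

  end? : ∀ v (e : Edge H) → Dec (v IsEndOf e)
  end? v e = (v Finₚ.≟ Edge.src e) ⊎-dec (v Finₚ.≟ Edge.tgt e)

  -- Otherwise a, b, c form a triangle, and no further edge meets all three.
  common-end₃ : ∀ {a b c x : Edge H} {p} → a ~[ L ] b → a ~[ L ] c → b ~[ L ] c →
    a ~[ L ] x → b ~[ L ] x → c ~[ L ] x → p IsEndOf a → p IsEndOf b → p IsEndOf c
  common-end₃ {a} {b} {c} {p = p} (a≢b , _) (_ , q , qa , qc) (_ , r , rb , rc)
    (a≢x , u , ua , ux) (b≢x , v , vb , vx) (c≢x , z , zc , zx) pa pb with end? p c
  ... | yes pc = pc
  ... | no p∉c with two-ends a pa qa ua | two-ends b pb rb vb | two-ends c qc rc zc
  ...   | inj₁ refl | _ | _ = contradiction qc p∉c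
  ...   | _ | inj₁ refl | _ = contradiction rc p∉c
  ...   | _ | _ | inj₁ refl = contradiction (subst (_IsEndOf c) (meet-once a≢b qa rb pa pb) qc) p∉c
  ...   | inj₂ (inj₁ refl) | _ | inj₂ (inj₁ refl) =
    contradiction (subst (_IsEndOf c) (meet-once a≢x qa zx pa ux) qc) p∉c
  ...   | inj₂ (inj₁ refl) | _ | inj₂ (inj₂ refl) =
    contradiction (subst (_IsEndOf c) (meet-once b≢x rb zx pb ux) rc) p∉c
  ...   | inj₂ (inj₂ refl) | inj₂ (inj₁ refl) | _ =
    contradiction (subst (_IsEndOf c) (meet-once a≢x qa ux pa vx) qc) p∉c
  ...   | inj₂ (inj₂ refl) | inj₂ (inj₂ refl) | _ = contradiction (subst (_IsEndOf c)
    (meet-once a≢b qa (subst (_IsEndOf b) (sym (meet-once c≢x qc ux rc vx)) rb) pa pb) qc) p∉c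

  -- By `common-end₃`, p lies on c too. If x missed p, two of a, b, c would meet x at the same one
  -- of its two ends and hence share a second vertex besides p.
  common-end₄ : ∀ {a b c x : Edge H} {p} → a ~[ L ] b → a ~[ L ] c → b ~[ L ] c →
    a ~[ L ] x → b ~[ L ] x → c ~[ L ] x → p IsEndOf a → p IsEndOf b → p IsEndOf x
  common-end₄ {x = x} {p} a~b a~c b~c a~x@(_ , u , ua , ux) b~x@(_ , v , vb , vx) c~x@(_ , z , zc , zx) pa pb
    with end? p x | common-end₃ a~b a~c b~c a~x b~x c~x pa pb
  ... | yes px | _  = px
  ... | no p∉x | pc with two-ends x ux vx zx
  ...   | inj₁ refl        = contradiction (subst (_IsEndOf x) (meet-once (proj₁ a~b) ua vb pa pb) ux) p∉x
  ...   | inj₂ (inj₁ refl) = contradiction (subst (_IsEndOf x) (meet-once (proj₁ a~c) ua zc pa pc) ux) p∉x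
  ...   | inj₂ (inj₂ refl) = contradiction (subst (_IsEndOf x) (meet-once (proj₁ b~c) vb zc pb pc) vx) p∉x

  no-K₅-minus-edge : ∀ {a b c x y : Edge H} → a ~[ L ] b → a ~[ L ] c → b ~[ L ] c →
    a ~[ L ] x → b ~[ L ] x → c ~[ L ] x → a ~[ L ] y → b ~[ L ] y → c ~[ L ] y → x ≢ y → x ~[ L ] y
  no-K₅-minus-edge a~b@(_ , p , pa , pb) a~c b~c a~x b~x c~x a~y b~y c~y x≢y =
    x≢y , p , common-end₄ a~b a~c b~c a~x b~x c~x pa pb , common-end₄ a~b a~c b~c a~y b~y c~y pa pb

module _ {m : ℕ} (G : Graph (Fin m)) (a : Fin m) {t : ℕ} (w : Fin t) where
  open Attach G a w

  attach-not-line : ∀ {p q r x y} → p ~[ G ] q → p ~[ G ] r → q ~[ G ] r →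
    p ~[ G ] x → q ~[ G ] x → r ~[ G ] x → p ~[ G ] y → q ~[ G ] y → r ~[ G ] y →
    x ≢ y → ¬ x ~[ G ] y → ¬ IsLineGraph (attach G a t w)
  attach-not-line {x = x} {y} pq pr qr px qx rx py qy ry x≢y x≁y (_ , H , f , edges) =
    apart (no-K₅-minus-edge (edge pq) (edge pr) (edge qr) (edge px) (edge qx) (edge rx) (edge py) (edge qy) (edge ry)
      (λ e → x≢y (distinct (sym (Inverse.strictlyInverseʳ f (vertex (inj₁ x))) ∙
        (cong (Inverse.from f) e ∙ Inverse.strictlyInverseʳ f (vertex (inj₁ y)))))))
    where
    image : Fin m → Edge H
    image u = Inverse.to f (vertex (inj₁ u))
    edge : ∀ {u v} → u ~[ G ] v → image u ~[ lineGraph H ] image v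
    edge {u} {v} p = Equivalence.to (edges (vertex (inj₁ u)) (vertex (inj₁ v))) (adjacent (inG p))
    distinct : vertex (inj₁ x) ≡ vertex (inj₁ y) → x ≡ y
    distinct e with refl ← vertex-injective {inj₁ x} {inj₁ y} e = refl
    apart : ¬ image x ~[ lineGraph H ] image y
    apart p with inG q ← adjacent⁻ (inj₁ x) (inj₁ y)
      (Equivalence.from (edges (vertex (inj₁ x)) (vertex (inj₁ y))) p) = x≁y q

-- Shapes ending in ones, and the coefficient at the target

ones : ℕ → List ℕ
ones s = replicate s 1

-- With as many rows as letters, every letter must remove a whole row. A letter of multiplicity 1
-- removes a single cell, so the last row has length 1; the rest follows by induction on s.
kostka-ones : ∀ s {μ} α → Linked _≥_ μ → All (0 <_) μ → length μ ≡ length α + s →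
  kostka μ (α ++ ones s) ≢ 0ℤ → ∃ λ ν → μ ≡ ν ++ ones s × length ν ≡ length α
kostka-ones zero    {μ} α d p l ne = μ , sym (Listₚ.++-identityʳ μ) , l ∙ +-identityʳ (length α)
kostka-ones (suc s) {μ} α d p l ne with initLast μ
... | []      = contradiction (l ∙ +-suc (length α) s) λ ()
... | μ′ ∷ʳ′ x = peel-last (last-one (kostka-∷ (μ′ ∷ʳ x) 1 (α ++ ones s) ne′))
  where
  ne′ : kostka (μ′ ∷ʳ x) (1 ∷ α ++ ones s) ≢ 0ℤ
  ne′ = ne ∘ (kostka-↭ (μ′ ∷ʳ x) (shift 1 α (ones s)) ∙_)
  length-μ′ : length μ′ ≡ length α + s
  length-μ′ = suc-injective (sym (Listₚ.length-++ μ′ ∙ +-comm (length μ′) 1) ∙ (l ∙ +-suc (length α) s))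
  length-α : length μ′ ≡ length (α ++ ones s)
  length-α = length-μ′ ∙ sym (Listₚ.length-++ α ∙ cong (_+_ (length α)) (Listₚ.length-replicate s))
  last-one : (∃ λ ν → ν ⊴ μ′ ∷ʳ x × sum ν + 1 ≡ sum (μ′ ∷ʳ x) × kostka ν (α ++ ones s) ≢ 0ℤ) → x ≡ 1
  last-one (ν , strip , e , ne″) = ≤-antisym
    (ℕₚ.+-cancelˡ-≤ (sum μ′) x 1 (≤-trans (≤-reflexive (sym (e ∙ sum-∷ʳ μ′ x)))
      (+-monoˡ-≤ 1 (⊴-last μ′ strip
        (subst (λ l → sum (drop l ν) ≡ 0) (sym length-α) (kostka-drop ν (α ++ ones s) ne″))))))
    (Allₗ.head (Allₚ.++⁻ʳ μ′ p))
  peel-last : x ≡ 1 → ∃ λ ν → μ′ ∷ʳ x ≡ ν ++ ones (suc s) × length ν ≡ length α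
  peel-last refl with ν , refl , l′ ← kostka-ones s α (linked-init μ′ d) (Allₚ.++⁻ˡ μ′ p) length-μ′
    (ne′ ∘ (kostka-last-row (α ++ ones s) length-α d ∙_)) =
    ν , Listₚ.++-assoc ν (ones s) (1 ∷ []) ∙ cong (ν ++_) (sym (replicate-∷ʳ s 1)) , l′

extend : ℕ → List ℕ → List ℕ
extend s ν = ν ++ ones s

-- Together with `extend s` this adds a first column of k + s cells, the counterpart of multiplying
-- by x₁⋯x_{k+s}.
raise : ∀ {k} → Vec ℕ k → List ℕ
raise β = toList (mapᵛ suc β)

chromatic-extend : ∀ {m l} (G : Graph (Fin m)) (a : Fin m) {s : ℕ} (w : Fin (l + s)) (β : Vec ℕ l) →
  chromatic (attach G a (l + s) w) (extend s (raise β)) ≡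
  + ((l + s ∸ 1) * (l + s ∸ 1) !) *ᶻ X G l β
chromatic-extend {l = l} G a {s} w β = begin
  chromatic G⁺ (extend s (raise β))
    ≡⟨ cong (chromatic G⁺) (sym (list-of β)) ⟩
  chromatic G⁺ (toList (mapᵛ suc β₀))
    ≡⟨ sym (value (X-symmetric G⁺) (mapᵛ suc β₀)) ⟩
  X G⁺ (l + s) (mapᵛ suc β₀)
    ≡⟨ X-attach G a w β₀ ⟩
  + N *ᶻ X G (l + s) β₀
    ≡⟨ cong (+ N *ᶻ_) (value (X-symmetric G) β₀) ⟩
  + N *ᶻ chromatic G (toList β₀)
    ≡⟨ cong (λ α → + N *ᶻ chromatic G α) (Vecₚ.toList-++ β (replicateᵛ s 0) ∙
        cong (toList β ++_) (Vecₚ.toList-replicate s 0)) ⟩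
  + N *ᶻ chromatic G (toList β ++ replicate s 0)
    ≡⟨ cong (+ N *ᶻ_) (perm (X-symmetric G) (++-comm (toList β) (replicate s 0))) ⟩
  + N *ᶻ chromatic G (replicate s 0 ++ toList β)
    ≡⟨ cong (+ N *ᶻ_) (drop-zeros (drop₀ (X-symmetric G)) s (toList β)) ⟩
  + N *ᶻ chromatic G (toList β)
    ≡⟨ cong (+ N *ᶻ_) (sym (value (X-symmetric G) β)) ⟩
  + N *ᶻ X G l β ∎
  where
  open ≡-Reasoning
  open IsSymmetric
  N = (l + s ∸ 1) * (l + s ∸ 1) !
  G⁺ = attach G a (l + s) w
  β₀ : Vec ℕ (l + s)
  β₀ = β ++ᵛ replicateᵛ s 0
  zeros : ∀ s → toList (mapᵛ suc (replicateᵛ s 0)) ≡ ones s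
  zeros zero    = refl
  zeros (suc s) = cong (1 ∷_) (zeros s)
  list-of : ∀ {k} (β : Vec ℕ k) → toList (mapᵛ suc (β ++ᵛ replicateᵛ s 0)) ≡ extend s (raise β)
  list-of (b ∷ β) = cong (suc b ∷_) (list-of β)
  list-of []      = zeros s

sum-ones : ∀ s → sum (ones s) ≡ s
sum-ones zero    = refl
sum-ones (suc s) = cong suc (sum-ones s)

sum-extend : ∀ s ν → sum (extend s ν) ≡ sum ν + s
sum-extend s ν = sum-++ ν (ones s) ∙ cong (_+_ (sum ν)) (sum-ones s)

linked-extend : ∀ s {ν} → Linked _≥_ ν → All (0 <_) ν → Linked _≥_ (extend s ν)
linked-extend zero          []      []       = []
linked-extend (suc zero)    []      []       = [-]
linked-extend (suc (suc s)) []      []       = ≤-refl ∷ linked-extend (suc s) [] []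
linked-extend zero          [-]     (p ∷ []) = [-]
linked-extend (suc s)       [-]     (p ∷ []) = p ∷ linked-extend (suc s) [] []
linked-extend s             (q ∷ d) (_ ∷ ps) = q ∷ linked-extend s d ps

-- The partitions of 18 into five parts from 1 to 5.
shapes : List (List ℕ)
shapes = (5 ∷ 5 ∷ 5 ∷ 2 ∷ 1 ∷ []) ∷ (5 ∷ 5 ∷ 4 ∷ 3 ∷ 1 ∷ []) ∷ (5 ∷ 5 ∷ 4 ∷ 2 ∷ 2 ∷ [])
  ∷ (5 ∷ 5 ∷ 3 ∷ 3 ∷ 2 ∷ []) ∷ (5 ∷ 4 ∷ 4 ∷ 4 ∷ 1 ∷ []) ∷ (5 ∷ 4 ∷ 4 ∷ 3 ∷ 2 ∷ [])
  ∷ (5 ∷ 4 ∷ 3 ∷ 3 ∷ 3 ∷ []) ∷ (4 ∷ 4 ∷ 4 ∷ 4 ∷ 2 ∷ []) ∷ (4 ∷ 4 ∷ 4 ∷ 3 ∷ 3 ∷ []) ∷ []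

shape-words : List (Vec ℕ 5)
shape-words = words (1 ∷ 2 ∷ 3 ∷ 4 ∷ 5 ∷ []) 5

shapes-complete : All (λ v → sum (toList v) ≡ 18 → Linked _≥_ (toList v) → toList v ∈ shapes) shape-words
shapes-complete = toWitness {a? = Allₗ.all? (λ v → (sum (toList v) ≟ 18) →-dec
  (Linkedₗ.linked? ℕₚ._≥?_ (toList v) →-dec (toList v ∈ᴸ? shapes))) shape-words} tt

shapes-partitions : All (λ ν → ν ⊢ 18 × length ν ≡ 5) shapes
shapes-partitions = toWitness {a? = Allₗ.all? (λ ν → isPartitionOf? 18 ν ×-dec (length ν ≟ 5)) shapes} tt

shapes-unique : Unique shapes
shapes-unique = toWitness {a? = unique? shapes} tt

target : List ℕ
target = 4 ∷ 4 ∷ 4 ∷ 4 ∷ 2 ∷ []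

-- The column of the inverse Kostka matrix at the target shape.
inverse-column : List (ℤ × Vec ℕ 5)
inverse-column = (+ 1 , 3 ∷ 3 ∷ 3 ∷ 3 ∷ 1 ∷ []) ∷ (- + 3 , 4 ∷ 3 ∷ 3 ∷ 2 ∷ 1 ∷ []) ∷ (- + 1 , 4 ∷ 3 ∷ 3 ∷ 3 ∷ 0 ∷ [])
  ∷ (+ 1 , 4 ∷ 4 ∷ 2 ∷ 2 ∷ 1 ∷ []) ∷ (+ 2 , 4 ∷ 4 ∷ 3 ∷ 1 ∷ 1 ∷ []) ∷ (+ 2 , 4 ∷ 4 ∷ 3 ∷ 2 ∷ 0 ∷ [])
  ∷ (- + 2 , 4 ∷ 4 ∷ 4 ∷ 1 ∷ 0 ∷ []) ∷ []

-- A functional dual to the target among the nine shapes, which is verified by evaluation. Its seven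
-- contents are the shapes that dominate the target; 54333 and 44433 do not.
inverse-sum : List ℕ → ℤ
inverse-sum ν = ∑ inverse-column λ (v , β) → v *ᶻ kostka ν (raise β)

inverse-sum-diagonal : inverse-sum target ≡ 1ℤ
inverse-sum-diagonal = refl

inverse-sum-off-diagonal : All (λ ν → ν ≢ target → inverse-sum ν ≡ 0ℤ) shapes
inverse-sum-off-diagonal = toWitness
  {a? = Allₗ.all? (λ ν → ¬? (ν ≟ᴸ target) →-dec (inverse-sum ν ℤₚ.≟ 0ℤ)) shapes} tt

inverse-column-shapes : All (λ (_ , β) → raise β ∈ shapes) inverse-column
inverse-column-shapes = toWitness {a? = Allₗ.all? (λ (_ , β) → raise β ∈ᴸ? shapes) inverse-column} tt

linked-++ˡ : ∀ μ {ν} → Linked _≥_ (μ ++ ν) → Linked _≥_ μ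
linked-++ˡ []          d       = []
linked-++ˡ (_ ∷ [])    d       = [-]
linked-++ˡ (_ ∷ _ ∷ μ) (p ∷ d) = p ∷ linked-++ˡ (_ ∷ μ) d

linked-bound : ∀ {μ b} → Linked _≥_ μ → head₀ μ ≤ b → All (_≤ b) μ
linked-bound []      p = []
linked-bound [-]     p = p ∷ []
linked-bound (q ∷ d) p = p ∷ linked-bound d (≤-trans q p)

∈-shapes : ∀ ν → length ν ≡ 5 → sum ν ≡ 18 → Linked _≥_ ν → All (0 <_) ν → All (_≤ 5) ν → ν ∈ shapes
∈-shapes (a ∷ b ∷ c ∷ d ∷ e ∷ []) refl 18≡ dec pos bound =
  Allₗ.lookup shapes-complete (∈-words (a ∷ b ∷ c ∷ d ∷ e ∷ []) (entries pos bound)) 18≡ dec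
  where
  entries : ∀ {ν} → All (0 <_) ν → All (_≤ 5) ν → All (_∈ (1 ∷ 2 ∷ 3 ∷ 4 ∷ 5 ∷ [])) ν
  entries []       []       = []
  entries (p ∷ ps) (q ∷ qs) = entry p q ∷ entries ps qs
    where
    entry : ∀ {x} → 0 < x → x ≤ 5 → x ∈ (1 ∷ 2 ∷ 3 ∷ 4 ∷ 5 ∷ [])
    entry {1} _ _ = here refl
    entry {2} _ _ = there (here refl)
    entry {3} _ _ = there (there (here refl))
    entry {4} _ _ = there (there (there (here refl)))
    entry {5} _ _ = there (there (there (there (here refl))))
    entry {suc (suc (suc (suc (suc (suc x)))))} _ (s≤s (s≤s (s≤s (s≤s (s≤s ())))))

extend-⊢ : ∀ s {ν n} → ν ⊢ n → extend s ν ⊢ n + s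
extend-⊢ s {ν} (e , d , p) =
  sum-extend s ν ∙ cong (_+ s) e , linked-extend s d p , Allₚ.++⁺ p (Allₚ.replicate⁺ s (s≤s z≤n))

shapes-⊢ : ∀ {ν} → ν ∈ shapes → ν ⊢ 18
shapes-⊢ ν∈ = proj₁ (Allₗ.lookup shapes-partitions ν∈)

length-extend : ∀ s ν → length (extend s ν) ≡ length ν + s
length-extend s ν = Listₚ.length-++ ν ∙ cong (_+_ (length ν)) (Listₚ.length-replicate s)

-- Shapes with fewer than 5 + s rows or a row longer than 5 have coefficient 0, so only the
-- extended shapes contribute.
module _ {m : ℕ} (G : Graph (Fin m)) (a : Fin m) (q : Fin m → Fin 4)
  (cover : ∀ u v → q u ≡ q v → Near G u v) {s : ℕ} (w : Fin (5 + s))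
  {c : List ℕ → ℤ} (expansion : IsSchurExpansion (X (attach G a (5 + s) w)) c) where

  private
    G⁺ = attach G a (5 + s) w
    N = (4 + s) * (4 + s) !

    expands : ∀ α → Expands (chromatic G⁺) c α
    expands = expansion⇒ (X-symmetric G⁺) {c} expansion

    -- Both alternatives pass from a content to every contributing shape: such a shape has no more
    -- rows than there are letters, and its first row is at least the first part.
    Large : List ℕ → Set
    Large μ = length μ < 5 + s ⊎ 5 < head₀ μ

    head-bound : ∀ μ ν → 5 < head₀ ν → kostka μ ν ≢ 0ℤ → 5 < head₀ μ
    head-bound μ (a ∷ ν) 5<a ne = <-≤-trans 5<a (kostka-head μ a ν ne)

    y : List ℕ → ℤ
    y ν = c (extend s ν)

    -- The size stays a variable tied to 18 + s by an equation, which keeps `partitions n` from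
    -- unfolding.
    module _ {n : ℕ} (n≡ : 18 + s ≡ n) where

      large-vanish : ∀ {μ} → μ ⊢ n → Large μ → c μ ≡ 0ℤ
      large-vanish = coefficients-vanish {f = chromatic G⁺} {c} Large (λ {ν} _ → expands ν)
        (λ { {ν} _ (inj₁ l) → chromatic-few-parts G a w ν l
           ; {ν} _ (inj₂ l) → chromatic-large-part G a w q cover ν l })
        (λ { {μ} {ν} p (inj₁ l) ne → inj₁ (≤-<-trans (kostka-length μ ν (positive {μ} p) ne) l)
           ; {μ} {ν} p (inj₂ l) ne → inj₂ (head-bound μ ν l ne) })

      equation : ∀ {ν} → ν ∈ shapes → chromatic G⁺ (extend s ν) ≡ ∑ shapes (λ μ → y μ *ᶻ kostka μ ν)
      equation {ν} ν∈ = begin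
        chromatic G⁺ (extend s ν)
          ≡⟨ expands (extend s ν) ⟩
        ∑ (partitions (sum (extend s ν))) term
          ≡⟨ cong (λ n → ∑ (partitions n) term) (proj₁ (extend-⊢ s (shapes-⊢ ν∈)) ∙ n≡) ⟩
        ∑ (partitions n) term
          ≡⟨ ∑-support {f = term} (partitions-unique n)
              (Uniqueₚ.map⁺ (λ {μ} {μ′} → Listₚ.++-cancelʳ (ones s) μ μ′) shapes-unique) member off-shapes ⟩
        ∑ (map (extend s) shapes) term
          ≡⟨ ∑-map (extend s) shapes term ⟩
        ∑ shapes (λ μ → y μ *ᶻ kostka (extend s μ) (extend s ν))
          ≡⟨ ∑-cong shapes {λ μ → y μ *ᶻ kostka (extend s μ) (extend s ν)} {λ μ → y μ *ᶻ kostka μ ν} (λ {μ} μ∈ →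
              cong (y μ *ᶻ_) (kostka-last-rows μ ν 1 s (rows μ∈ ∙ sym (rows ν∈))
                (proj₁ (proj₂ (extend-⊢ s (shapes-⊢ μ∈)))))) ⟩
        ∑ shapes (λ μ → y μ *ᶻ kostka μ ν) ∎
        where
        open ≡-Reasoning
        term : List ℕ → ℤ
        term μ = c μ *ᶻ kostka μ (extend s ν)
        rows : ∀ {μ} → μ ∈ shapes → length μ ≡ 5
        rows μ∈ = proj₂ (Allₗ.lookup shapes-partitions μ∈)
        member : ∀ {μ} → μ ∈ map (extend s) shapes → μ ∈ partitions n
        member μ∈ with μ , μ∈′ , refl ← ∈-map⁻ (extend s) μ∈ =
          ∈-partitions (subst (extend s μ ⊢_) n≡ (extend-⊢ s (shapes-⊢ μ∈′)))
        length-ν : length (extend s ν) ≡ 5 + s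
        length-ν = length-extend s ν ∙ cong (_+ s) (rows ν∈)
        off-shapes : ∀ {μ} → μ ∈ partitions n → μ ∉ map (extend s) shapes → term μ ≡ 0ℤ
        off-shapes {μ} μ∈ μ∉ with kostka μ (extend s ν) ℤₚ.≟ 0ℤ | length μ <? 5 + s | 5 <? head₀ μ
        ... | yes z | _ | _ = cong (c μ *ᶻ_) z ∙ ℤₚ.*-zeroʳ (c μ)
        ... | no _  | yes l | _ = cong (_*ᶻ kostka μ (extend s ν)) (large-vanish (partitions-⊢ μ∈) (inj₁ l)) ∙
          ℤₚ.*-zeroˡ (kostka μ (extend s ν))
        ... | no _  | no _ | yes l = cong (_*ᶻ kostka μ (extend s ν)) (large-vanish (partitions-⊢ μ∈) (inj₂ l)) ∙
          ℤₚ.*-zeroˡ (kostka μ (extend s ν))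
        -- The content has 5 + s letters, so the shape has exactly that many rows and ends in s
        -- ones; what precedes them is one of the nine shapes.
        ... | no nz | no l | no h with p@(e , d , pos) ← partitions-⊢ {n} μ∈
          with ρ , refl , lρ ← kostka-ones s ν d pos
            (≤-antisym (≤-trans (kostka-length μ (extend s ν) pos nz) (≤-reflexive (length-extend s ν)))
              (≤-trans (≤-reflexive (cong (_+ s) (rows ν∈))) (≮⇒≥ l))) nz =
          contradiction (∈-map⁺ (extend s) (∈-shapes ρ (lρ ∙ rows ν∈)
            (+-cancelʳ-≡ s (sum ρ) 18 (sym (sum-extend s ρ) ∙ (e ∙ sym n≡))) (linked-++ˡ ρ d) (Allₚ.++⁻ˡ ρ pos)
            (Allₚ.++⁻ˡ ρ (linked-bound d (≮⇒≥ h))))) μ∉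

  -- The dual column is applied to the nine equations and the sums are interchanged. Keeping the
  -- count F and its total z abstract confines the heavy evaluation to `Q-counts`.
  attach-coefficient : (F : Vec ℕ 5 → ℤ) (z : ℤ) → (∀ β → X G 5 β ≡ F β) →
    ∑ inverse-column (λ (v , β) → v *ᶻ F β) ≡ z → c (extend s target) ≡ + N *ᶻ z
  attach-coefficient F z X≡F ∑≡z = begin
    y target
      ≡⟨ sym (ℤₚ.*-identityʳ (y target)) ⟩
    y target *ᶻ 1ℤ
      ≡⟨ cong (y target *ᶻ_) (sym inverse-sum-diagonal) ⟩
    y target *ᶻ inverse-sum target
      ≡⟨ sym (∑-single {f = λ ν → y ν *ᶻ inverse-sum ν} shapes-unique target∈
          (λ {ν} ν∈ ne → cong (y ν *ᶻ_) (Allₗ.lookup inverse-sum-off-diagonal ν∈ ne) ∙ ℤₚ.*-zeroʳ (y ν))) ⟩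
    ∑ shapes (λ ν → y ν *ᶻ inverse-sum ν)
      ≡⟨ ∑-cong shapes {λ ν → y ν *ᶻ inverse-sum ν} {λ ν → ∑ inverse-column (cell ν)} (λ {ν} _ →
          ∑-*ˡ (y ν) inverse-column (λ (v , β) → v *ᶻ kostka ν (raise β))) ⟩
    ∑ shapes (λ ν → ∑ inverse-column (cell ν))
      ≡⟨ ∑-swap shapes inverse-column cell ⟩
    ∑ inverse-column (λ b → ∑ shapes (λ ν → cell ν b))
      ≡⟨ ∑-cong inverse-column {λ b → ∑ shapes (λ ν → cell ν b)} {λ b → + N *ᶻ (proj₁ b *ᶻ F (proj₂ b))} column ⟩
    ∑ inverse-column (λ (v , β) → + N *ᶻ (v *ᶻ F β))
      ≡⟨ sym (∑-*ˡ (+ N) inverse-column (λ (v , β) → v *ᶻ F β)) ⟩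
    + N *ᶻ ∑ inverse-column (λ (v , β) → v *ᶻ F β)
      ≡⟨ cong (+ N *ᶻ_) ∑≡z ⟩
    + N *ᶻ z ∎
    where
    open ≡-Reasoning
    open import Algebra.Properties.CommutativeSemigroup ℤₚ.*-commutativeSemigroup
      using () renaming (x∙yz≈y∙xz to *-left-comm)
    target∈ : target ∈ shapes
    target∈ = toWitness {a? = target ∈ᴸ? shapes} tt
    cell : List ℕ → ℤ × Vec ℕ 5 → ℤ
    cell ν (v , β) = y ν *ᶻ (v *ᶻ kostka ν (raise β))
    column : ∀ {b} → b ∈ inverse-column →
      ∑ shapes (λ ν → cell ν b) ≡ + N *ᶻ (proj₁ b *ᶻ F (proj₂ b))
    column {v , β} b∈ = ∑-cong shapes {λ ν → cell ν (v , β)} {λ ν → v *ᶻ (y ν *ᶻ kostka ν (raise β))}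
        (λ {ν} _ → *-left-comm (y ν) v (kostka ν (raise β))) ∙
      (sym (∑-*ˡ v shapes (λ ν → y ν *ᶻ kostka ν (raise β))) ∙
      (cong (v *ᶻ_) (sym (equation refl (Allₗ.lookup inverse-column-shapes b∈)) ∙
        (chromatic-extend G a w β ∙ cong (+ N *ᶻ_) (X≡F β))) ∙
       *-left-comm v (+ N) (F β)))

-- The data of Q and the conclusion

-- Colouring the clique u₁₃, u₅, u₉, u₁₁, u₁₂ first keeps the search small.
Q-order Q-order⁻¹ : Fin 13 → Fin 13
Q-order   = lookup (# 0 ∷ # 5 ∷ # 9 ∷ # 11 ∷ # 12 ∷ # 4 ∷ # 10 ∷ # 2 ∷ # 7 ∷ # 8 ∷ # 6 ∷ # 1 ∷ # 3 ∷ [])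
Q-order⁻¹ = lookup (# 0 ∷ # 11 ∷ # 7 ∷ # 12 ∷ # 5 ∷ # 1 ∷ # 10 ∷ # 8 ∷ # 9 ∷ # 2 ∷ # 6 ∷ # 3 ∷ # 4 ∷ [])

Q-count : Vec ℕ 5 → ℤ
Q-count β = + length (search (upper (pullback Q-order Q)) (replicateᵛ 13 (replicateᵛ 5 true)) β)

X-Q : ∀ β → X Q 5 β ≡ Q-count β
X-Q β = X-relabel {o = Q-order} {Q-order⁻¹}
  (toWitness {a? = Finₚ.all? λ u → Q-order (Q-order⁻¹ u) Finₚ.≟ u} tt)
  (toWitness {a? = Finₚ.all? λ u → Q-order⁻¹ (Q-order u) Finₚ.≟ u} tt) Q β ∙ X-search (pullback Q-order Q) β

-- The seven values are 4032, 1584, 0, 576, 0, 0 and 0.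
Q-counts : ∑ inverse-column (λ (v , β) → v *ᶻ Q-count β) ≡ - + 144
Q-counts = refl

-- The cliques {u₄,u₅,u₉,u₁₃}, {u₆,u₇,u₈}, {u₁,u₁₀,u₁₁} and {u₂,u₃,u₁₂} cover Q.
Q-cover : Fin 13 → Fin 4
Q-cover = lookup (# 0 ∷ # 2 ∷ # 3 ∷ # 3 ∷ # 0 ∷ # 0 ∷ # 1 ∷ # 1 ∷ # 1 ∷ # 0 ∷ # 2 ∷ # 2 ∷ # 3 ∷ [])

Q-covered : ∀ u v → Q-cover u ≡ Q-cover v → Near Q u v
Q-covered = toWitness {a? = Finₚ.all? λ u → Finₚ.all? λ v → (Q-cover u Finₚ.≟ Q-cover v) →-dec near? Q u v} tt

-- u₅, u₉, u₁₃, u₄, u₁₁ induce K₅ minus the edge u₄u₁₁.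
Qₜ-not-line : ∀ {t} (w : Fin t) → ¬ IsLineGraph (Qₜ t w)
Qₜ-not-line w = attach-not-line Q (# 1) w {# 0} {# 5} {# 9} {# 4} {# 11}
  (edge (# 0) (# 5)) (edge (# 0) (# 9)) (edge (# 5) (# 9))
  (edge (# 0) (# 4)) (edge (# 5) (# 4)) (edge (# 9) (# 4))
  (edge (# 0) (# 11)) (edge (# 5) (# 11)) (edge (# 9) (# 11))
  (λ ()) (toWitness {a? = ¬? (Graph._~?_ Q (# 4) (# 11))} tt)
  where
  edge : ∀ u v {_ : True (Graph._~?_ Q u v)} → u ~[ Q ] v
  edge u v {p} = toWitness p

Qₜ-connected : ∀ {t} (w : Fin t) → Connected (Qₜ t w)
Qₜ-connected w = attach-connected Q (# 1) w Q-connected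

Qₜ-expansion : ∀ {t} (w : Fin t) → ∃ (IsSchurExpansion (X (Qₜ t w)))
Qₜ-expansion {t} w = schur-expansion (X-symmetric (Qₜ t w))

Qₜ-claw-free : ∀ {t} (w : Fin t) → ClawFree (Qₜ t w)
Qₜ-claw-free w = attach-claw-free Q (# 1) w Q-no-claw Q-simplicial

target-extend-⊢ : ∀ s → extend s target ⊢ 18 + s
target-extend-⊢ s = extend-⊢ s (toWitness {a? = isPartitionOf? 18 target} tt)

*-144-form : ∀ m n → + (m * n) *ᶻ - + 144 ≡ - (+ (144 * m * n))
*-144-form m n = sym (ℤₚ.neg-distribʳ-* (+ (m * n)) (+ 144)) ∙ cong -_ (sym (ℤₚ.pos-* (m * n) 144) ∙
  cong +_ (ℕₚ.*-comm (m * n) 144 ∙ sym (ℕₚ.*-assoc 144 m n)))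

Qₜ-coefficient : ∀ {s} (w : Fin (5 + s)) {c} → IsSchurExpansion (X (Qₜ (5 + s) w)) c →
  c (extend s target) ≡ - (+ (144 * (4 + s) * (4 + s) !))
Qₜ-coefficient {s} w {c} expansion =
  attach-coefficient Q (# 1) Q-cover Q-covered w {c} expansion Q-count (- + 144) X-Q Q-counts ∙
  *-144-form (4 + s) ((4 + s) !)

coefficient-negative : ∀ s → - (+ (144 * (4 + s) * (4 + s) !)) <ᶻ 0ℤ
coefficient-negative s = ℤₚ.neg-mono-< (+<+ (ℕₚ.*-mono-≤ {1} {144 * (4 + s)} {1} (s≤s z≤n) (ℕₚ.1≤n! (4 + s))))

Qₜ-not-positive : ∀ {s} (w : Fin (5 + s)) → ¬ SchurPositive (Qₜ (5 + s) w)
Qₜ-not-positive {s} w (c , expansion , nonnegative) = ℤₚ.<⇒≱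
  (subst (_<ᶻ 0ℤ) (sym (Qₜ-coefficient w {c} expansion)) (coefficient-negative s))
  (nonnegative (18 + s) (extend s target) (target-extend-⊢ s))

-- The vertex numbers 13 + t separate the graphs, which makes the family infinite.
same-size : ∀ {m n} {G : Graph (Fin m)} {H : Graph (Fin n)} → G ≅ H → m ≡ n
same-size (f , _) = ↔⇒≡ f

conjecture-fails : ¬ ClawFreeConjecture
conjecture-fails conjecture = Qₜ-not-positive {0} zero (conjecture (13 + 5) (Qₜ 5 zero) (Qₜ-claw-free {5} zero))

theorem4p4 : (∀ t → 5 ≤ t → (w : Fin t) →
    Connected (Qₜ t w)
    × ClawFree (Qₜ t w)
    × ¬ IsLineGraph (Qₜ t w)
    × ([s 4 ∷ 4 ∷ 4 ∷ 4 ∷ 2 ∷ replicate (t ∸ 5) 1 ] X (Qₜ t w)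
    ≐ - (+ (144 * (t ∸ 1) * (t ∸ 1) !)))
    × - (+ (144 * (t ∸ 1) * (t ∸ 1) !)) <ᶻ 0ℤ
    × ¬ SchurPositive (Qₜ t w))
    × (∀ t t′ → 5 ≤ t → 5 ≤ t′ → (w : Fin t) (w′ : Fin t′) →
    Qₜ t w ≅ Qₜ t′ w′ → t ≡ t′)
    × ¬ ClawFreeConjecture
theorem4p4 =
  -- Matching exposes t as 5 + s, so that t ∸ 5 and t ∸ 1 compute to s and 4 + s.
  (λ { _ (s≤s (s≤s (s≤s (s≤s (s≤s {n = s} z≤n))))) w →
      Qₜ-connected w
    , Qₜ-claw-free w
    , Qₜ-not-line w
    , (Qₜ-expansion w , λ c → Qₜ-coefficient w {c})
    , coefficient-negative s
    , Qₜ-not-positive w })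
  , (λ t t′ _ _ w w′ iso → +-cancelˡ-≡ 13 t t′ (same-size {G = Qₜ t w} {Qₜ t′ w′} iso))
  , conjecture-fails
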